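{- For every partition $\lambda$ and every finite sequence of partitions $R=(R_1,\dots,R_L)$, the polynomial $d^{\diamondsuit}_{\lambda R}(t)$ does not depend on $\diamondsuit\in\{\square,\mathrm{v},\mathrm{h}\}$; that is, $d^{\square}_{\lambda R}(t)=d^{\mathrm{v}}_{\lambda R}(t)=d^{\mathrm{h}}_{\lambda R}(t)$.
   Context: $\Lambda$ is the ring of symmetric functions in $X=x_1+x_2+\cdots$ (rational coefficients, extended by auxiliary indeterminates as needed), with the scalar product for which Schur functions are orthonormal. Plethystic notation: $P[A]$ is obtained from $P\in\Lambda$ by expressing $P$ in power sums and replacing $p_k$ by $p_k[A]$, where $p_k[A]$ raises every indeterminate in $A$ (including $t$) to the $k$-th power and $p_k[A-B]=p_k[A]-p_k[B]$; $\Omega[A]=\exp(\sum_{k\ge1}p_k[A]/k)$. $P^\perp$ is the operator adjoint to multiplication by $P$ (in the $X$ variables); in particular $\Omega[XA]^\perp P[X]=P[X+A]$. The symbols: $\square$ (single cell), $\mathrm{h}$ (horizontal domino), $\mathrm{v}$ (vertical domino). Put $f_\square=s_1+s_{(1^2)}$, $f_{\mathrm{h}}=s_2$, $f_{\mathrm{v}}=s_{(1^2)}$, and let $s^\diamondsuit_\lambda=\Omega[-f_\diamondsuit]^\perp s_\lambda$ for partitions $\lambda$; $\{s^\diamondsuit_\lambda\}$ is a basis of $\Lambda$. Bernstein's operators $B_r\in\mathrm{End}(\Lambda)$ are defined by $\sum_{r\in\mathbb{Z}}B_rz^r=\Omega[zX]\,\Omega[-z^{ -1}X]^\perp$ (skew,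 then multiply). For $\nu\in\mathbb{Z}^n$, $B_\nu=B_{\nu_1}\circ\cdots\circ B_{\nu_n}$ and $B^\diamondsuit_\nu=\Omega[-f_\diamondsuit]^\perp\circ B_\nu\circ\Omega[f_\diamondsuit]^\perp$. The $t$-analogue of $V\in\mathrm{End}(\Lambda)$ is $\widetilde V(P[X])=V^Y(P[tX+(1-t)Y])|_{Y\to X}$, where $V^Y$ is $V$ acting in a second set of variables $Y$ and afterwards $Y$ is replaced by $X$. Let $\widetilde B^\diamondsuit_\nu$ be the $t$-analogue of $B^\diamondsuit_\nu$. A partition $R_j$ with $\ell(R_j)$ (nonzero) parts is regarded as an element of $\mathbb{Z}^{\ell(R_j)}$, and $d^\diamondsuit_{\lambda R}(t)$ is defined by $$\widetilde B^\diamondsuit_{R_1}\widetilde B^\diamondsuit_{R_2}\cdots\widetilde B^\diamondsuit_{R_L}\,1=\sum_\lambda d^\diamondsuit_{\lambda R}(t)\,s^\diamondsuit_\lambda .$$ -}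

module Defs where

open import Level using (0ℓ)
open import Algebra.Bundles using (CommutativeRing)
import Algebra.Properties.Semiring.Sum as SemiringSum
import Algebra.Properties.Semiring.Exp as SemiringExp
open import Data.Nat.Base as ℕ using (ℕ; zero; suc; NonZero; _!; _≥_)
open import Data.Nat.Properties using (_!≢0)
open import Data.Integer.Base as ℤ using (ℤ; +_; -[1+_])
open import Data.Rational.Base as ℚ using (ℚ)
open import Data.Rational.Properties using (+-*-commutativeRing)
open import Data.Fin.Base using (Fin; zero; suc; toℕ; punchIn)
open import Data.List.Base as List
  using (List; []; _∷_; [_]; _++_; map; foldr; length; lookup; cartesianProductWith)
open import Data.List.Relation.Unary.All using (All; []; _∷_)
open import Data.List.Relation.Unary.Linked using (Linked; []; [-]; _∷_)
open import Data.List.Relation.Unary.Unique.Propositional using (Unique)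
open import Data.List.Membership.Propositional using (_∉_)
open import Data.Product.Base using (_×_; _,_)
open import Data.Unit.Base using (⊤; tt)
open import Function.Base using (_∘_; id)
open import Relation.Binary.PropositionalEquality.Core using (_≢_)

------------------------------------------------------------------------
-- The polynomial ring R[V], presented as the free commutative R-algebra
-- on V: terms modulo the least congruence that makes them a commutative
-- ring and con : R → R[V] a ring homomorphism.

module Polynomial (R : CommutativeRing 0ℓ 0ℓ) (V : Set) where

  private module R = CommutativeRing R

  infixl 6 _+_
  infixl 7 _*_
  infix  8 -_
  infix  4 _≈_

  data Poly : Set where
    con : R.Carrier → Poly
    var : V → Poly
    _+_ : Poly → Poly → Poly
    _*_ : Poly → Poly → Poly
    -_  : Poly → Poly

  data _≈_ : Poly → Poly → Set where
    ≈-refl      : ∀ {P} → P ≈ P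
    ≈-sym       : ∀ {P Q} → P ≈ Q → Q ≈ P
    ≈-trans     : ∀ {P Q S} → P ≈ Q → Q ≈ S → P ≈ S
    +-cong      : ∀ {P P′ Q Q′} → P ≈ P′ → Q ≈ Q′ → P + Q ≈ P′ + Q′
    *-cong      : ∀ {P P′ Q Q′} → P ≈ P′ → Q ≈ Q′ → P * Q ≈ P′ * Q′
    -‿cong      : ∀ {P P′} → P ≈ P′ → - P ≈ - P′
    +-assoc     : ∀ P Q S → (P + Q) + S ≈ P + (Q + S)
    +-comm      : ∀ P Q → P + Q ≈ Q + P
    +-identityˡ : ∀ P → con R.0# + P ≈ P
    -‿inverseˡ  : ∀ P → - P + P ≈ con R.0#
    *-assoc     : ∀ P Q S → (P * Q) * S ≈ P * (Q * S)
    *-comm      : ∀ P Q → P * Q ≈ Q * P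
    *-identityˡ : ∀ P → con R.1# * P ≈ P
    distribˡ    : ∀ P Q S → P * (Q + S) ≈ P * Q + P * S
    con-cong    : ∀ {a b} → a R.≈ b → con a ≈ con b
    con-+       : ∀ a b → con (a R.+ b) ≈ con a + con b
    con-*       : ∀ a b → con (a R.* b) ≈ con a * con b

  polyRing : CommutativeRing 0ℓ 0ℓ
  polyRing = record
    { Carrier = Poly
    ; _≈_ = _≈_
    ; _+_ = _+_
    ; _*_ = _*_
    ; -_  = -_
    ; 0#  = con R.0#
    ; 1#  = con R.1#
    ; isCommutativeRing = record
      { isRing = record
        { +-isAbelianGroup = record
          { isGroup = record
            { isMonoid = record
              { isSemigroup = record
                { isMagma = record
                  { isEquivalence = record
                    { refl = ≈-refl ; sym = ≈-sym ; trans = ≈-trans }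
                  ; ∙-cong = +-cong
                  }
                ; assoc = +-assoc
                }
              ; identity =
                  +-identityˡ , λ P → ≈-trans (+-comm P _) (+-identityˡ P)
              }
            ; inverse =
                -‿inverseˡ , λ P → ≈-trans (+-comm P _) (-‿inverseˡ P)
            ; ⁻¹-cong = -‿cong
            }
          ; comm = +-comm
          }
        ; *-cong = *-cong
        ; *-assoc = *-assoc
        ; *-identity = *-identityˡ , λ P → ≈-trans (*-comm P _) (*-identityˡ P)
        ; distrib = distribˡ , λ P Q S →
            ≈-trans (*-comm (Q + S) P)
              (≈-trans (distribˡ P Q S) (+-cong (*-comm P Q) (*-comm P S)))
        }
      ; *-comm = *-comm
      }
    }

  module Eval (S : CommutativeRing 0ℓ 0ℓ) where
    private module S = CommutativeRing S

    eval : (R.Carrier → S.Carrier) → (V → S.Carrier) → Poly → S.Carrier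
    eval f g (con a) = f a
    eval f g (var v) = g v
    eval f g (P + Q) = eval f g P S.+ eval f g Q
    eval f g (P * Q) = eval f g P S.* eval f g Q
    eval f g (- P)   = S.- eval f g P

------------------------------------------------------------------------

module ℚt = Polynomial +-*-commutativeRing ⊤

ℚ[t] : Set
ℚ[t] = ℚt.Poly

ℚ[t]-ring : CommutativeRing 0ℓ 0ℓ
ℚ[t]-ring = ℚt.polyRing

infix 4 _≈ₜ_
_≈ₜ_ : ℚ[t] → ℚ[t] → Set
_≈ₜ_ = ℚt._≈_

t : ℚ[t]
t = ℚt.var tt

------------------------------------------------------------------------
-- Sym A is the ring of polynomials over ℚ[t] in the power sums of the
-- alphabets a ∈ A.  The variable (a , k) stands for p_{k+1}[a], so that
-- all power sums p_1, p_2, … occur and p_0 does not.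

module SymRing (A : Set) = Polynomial ℚ[t]-ring (A × ℕ)

Sym : Set → Set
Sym A = SymRing.Poly A

Sym-ring : Set → CommutativeRing 0ℓ 0ℓ
Sym-ring A = SymRing.polyRing A

alphabet : {A : Set} → A → Sym A
alphabet {A} a = SymRing.var (a , 0)

-- adams k A is p_k[A] (k ≥ 1): every indeterminate, including t, is
-- raised to the k-th power, so p_{j+1}[a] becomes p_{(j+1)k}[a].

adamsₜ : ℕ → ℚ[t] → ℚ[t]
adamsₜ k = ℚt.Eval.eval ℚ[t]-ring ℚt.con (λ _ → t ^ k)
  where open SemiringExp (CommutativeRing.semiring ℚ[t]-ring)

adams : {A : Set} → ℕ → Sym A → Sym A
adams {A} k = SymRing.Eval.eval A (Sym-ring A)
  (λ c → SymRing.con (adamsₜ k c))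
  (λ (a , j) → SymRing.var (a , ℕ.pred (suc j ℕ.* k)))

------------------------------------------------------------------------

Λ : Set
Λ = Sym ⊤

Λ-ring : CommutativeRing 0ℓ 0ℓ
Λ-ring = Sym-ring ⊤

open SymRing ⊤ using (con; var; _+_; _*_; -_; _≈_) public
open SemiringSum (CommutativeRing.semiring Λ-ring) public
  using (sum; sum-syntax; sum⁺-syntax)

0Λ 1Λ X : Λ
0Λ = CommutativeRing.0# Λ-ring
1Λ = CommutativeRing.1# Λ-ring
X  = alphabet tt

rational : ℚ → Λ
rational q = con (ℚt.con q)

ΣList : {I : Set} → List I → (I → Λ) → Λ
ΣList is f = foldr (λ i P → f i + P) 0Λ is

infix 9 _⟦_⟧
_⟦_⟧ : {A : Set} → Λ → Sym A → Sym A
_⟦_⟧ {A} P E =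
  SymRing.Eval.eval ⊤ (Sym-ring A) SymRing.con (λ (_ , j) → adams (suc j) E) P

-- An upper bound for the degree of the element represented by a term,
-- where p_k has degree k.

deg : Λ → ℕ
deg (con c)       = 0
deg (var (_ , j)) = suc j
deg (P + Q)       = deg P ℕ.⊔ deg Q
deg (P * Q)       = deg P ℕ.+ deg Q
deg (- P)         = deg P

-- F : Series stands for Σ_n F n z^n.

Series : Set
Series = ℕ → Λ

one : Series
one zero    = 1Λ
one (suc _) = 0Λ

infixl 7 _⊛_
_⊛_ : Series → Series → Series
(F ⊛ G) n = ∑[ i ≤ n ] (F (toℕ i) * G (n ℕ.∸ toℕ i))

power : Series → ℕ → Series
power F zero    = one
power F (suc m) = F ⊛ power F m

-- exp F = Σ_m F^m / m! for F without constant term: then F^m has no term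
-- below z^m, so only m ≤ n contribute to the coefficient of z^n.

exp : Series → Series
exp F n = ∑[ m ≤ n ] (1/! (toℕ m) * power F (toℕ m) n)
  where
  1/! : ℕ → Λ
  1/! m = rational ((+ 1 ℚ./ (m !)) {{m !≢0}})

-- Ωz A is Ω[zA] = exp (Σ_{k ≥ 1} z^k p_k[A] / k) as a series in z.

Ωz : Λ → Series
Ωz A = exp logΩ
  where
  logΩ : Series
  logΩ zero    = 0Λ
  logΩ (suc k) = rational (+ 1 ℚ./ suc k) * adams (suc k) A

h : ℤ → Λ
h (+ n)    = Ωz X n
h -[1+ _ ] = 0Λ

------------------------------------------------------------------------

record Partition : Set where
  constructor partition
  field
    parts       : List ℕ
    .decreasing : Linked _≥_ parts
    .positive   : All NonZero parts

open Partition public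

det : (n : ℕ) → (Fin n → Fin n → Λ) → Λ
det zero    M = 1Λ
det (suc n) M =
  ∑[ j < suc n ] (sign (toℕ j) * (M zero j * det n (λ i k → M (suc i) (punchIn j k))))
  where
  sign : ℕ → Λ
  sign zero    = 1Λ
  sign (suc j) = - sign j

-- The Jacobi–Trudi determinant det (h_{λ_i - i + j})

s : Partition → Λ
s λ′ = det (length (parts λ′)) λ i j →
  h (+ lookup (parts λ′) i ℤ.- + toℕ i ℤ.+ + toℕ j)

⟨1⟩ ⟨2⟩ ⟨1,1⟩ : Partition
⟨1⟩   = partition (1 ∷ []) [-] (_ ∷ [])
⟨2⟩   = partition (2 ∷ []) [-] (_ ∷ [])
⟨1,1⟩ = partition (1 ∷ 1 ∷ []) (ℕ.s≤s ℕ.z≤n ∷ [-]) (_ ∷ _ ∷ [])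

------------------------------------------------------------------------

-- Schur functions being a basis of Λ over ℚ[t], these fields determine the
-- scalar product up to ≈ₜ, and Adjoints determines the operators P^⊥.

record ScalarProduct : Set where
  field
    ⟨_,_⟩      : Λ → Λ → ℚ[t]
    ⟨⟩-cong    : ∀ {P P′ Q Q′} → P ≈ P′ → Q ≈ Q′ → ⟨ P , Q ⟩ ≈ₜ ⟨ P′ , Q′ ⟩
    ⟨⟩-sym     : ∀ P Q → ⟨ P , Q ⟩ ≈ₜ ⟨ Q , P ⟩
    ⟨⟩-+       : ∀ P P′ Q → ⟨ P + P′ , Q ⟩ ≈ₜ ⟨ P , Q ⟩ ℚt.+ ⟨ P′ , Q ⟩
    ⟨⟩-scale   : ∀ c P Q → ⟨ con c * P , Q ⟩ ≈ₜ c ℚt.* ⟨ P , Q ⟩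
    normal     : ∀ μ → ⟨ s μ , s μ ⟩ ≈ₜ ℚt.con ℚ.1ℚ
    orthogonal : ∀ μ ν → μ ≢ ν → ⟨ s μ , s ν ⟩ ≈ₜ ℚt.con ℚ.0ℚ

record Adjoints (Hall : ScalarProduct) : Set where
  open ScalarProduct Hall
  infix 9 _⊥
  field
    _⊥      : Λ → Λ → Λ
    adjoint : ∀ P Q S → ⟨ (P ⊥) Q , S ⟩ ≈ₜ ⟨ Q , P * S ⟩

------------------------------------------------------------------------

data XY : Set where
  X-alphabet Y-alphabet : XY

-- An element of Sym XY as a finite sum Σ a[X] b[Y], given by its list of
-- pairs (a , b).

separate : Sym XY → List (Λ × Λ)
separate (SymRing.con c)                = [ con c , 1Λ ]
separate (SymRing.var (X-alphabet , j)) = [ var (tt , j) , 1Λ ]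
separate (SymRing.var (Y-alphabet , j)) = [ 1Λ , var (tt , j) ]
separate (P SymRing.+ Q) = separate P ++ separate Q
separate (P SymRing.* Q) =
  cartesianProductWith (λ (a , b) (a′ , b′) → a * a′ , b * b′) (separate P) (separate Q)
separate (SymRing.- P)   = map (λ (a , b) → - a , b) (separate P)

-- Ṽ (P[X]) = V^Y (P[tX + (1-t)Y]) |_{Y → X}, where V^Y sends a[X] b[Y] to
-- a[X] (V b)[Y].  For linear V the result does not depend on how the
-- element of Sym XY is written as a sum of products.

tAnalogue : (Λ → Λ) → Λ → Λ
tAnalogue V P =
  ΣList (separate (P ⟦ tX+[1-t]Y ⟧)) λ (a , b) → a * V b
  where
  open CommutativeRing (Sym-ring XY) using () renaming (_+_ to _⊕_; _*_ to _⊗_)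
  tX+[1-t]Y : Sym XY
  tX+[1-t]Y = SymRing.con t ⊗ alphabet X-alphabet
            ⊕ SymRing.con (ℚt.con ℚ.1ℚ ℚt.+ ℚt.- t) ⊗ alphabet Y-alphabet

------------------------------------------------------------------------

data Symbol : Set where
  □ 𝗁 𝗏 : Symbol

f : Symbol → Λ
f □ = s ⟨1⟩ + s ⟨1,1⟩
f 𝗁 = s ⟨2⟩
f 𝗏 = s ⟨1,1⟩

module Operators {Hall : ScalarProduct} (adj : Adjoints Hall) where
  open Adjoints adj

  -- For A without constant term, Ω[A] = Σ_n Ωz A n, where Ωz A n has no
  -- component of degree below n.  Hence (Ωz A n)^⊥ P = 0 for n > deg P,
  -- and the sum may be truncated there.

  Ω[_]⊥ : Λ → Λ → Λ
  Ω[ A ]⊥ P = ∑[ n ≤ deg P ] ((Ωz A (toℕ n) ⊥) P)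

  s◇ : Symbol → Partition → Λ
  s◇ ◇ μ = Ω[ - f ◇ ]⊥ (s μ)

  -- The coefficient of z^r in Ω[zX] (Ω[-z⁻¹X]^⊥ P), where Ω[-z⁻¹X] is the
  -- series Ω[-zX] with z⁻¹ for z.

  B : ℤ → Λ → Λ
  B r P = ∑[ n ≤ deg P ] (h (r ℤ.+ + toℕ n) * (Ωz (- X) (toℕ n) ⊥) P)

  Bs : List ℤ → Λ → Λ
  Bs ν = foldr (λ r V → B r ∘ V) id ν

  B◇ : Symbol → List ℤ → Λ → Λ
  B◇ ◇ ν = Ω[ - f ◇ ]⊥ ∘ Bs ν ∘ Ω[ f ◇ ]⊥

  B̃◇ : Symbol → List ℤ → Λ → Λ
  B̃◇ ◇ ν = tAnalogue (B◇ ◇ ν)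

  B̃◇-product : Symbol → List Partition → Λ
  B̃◇-product ◇ R = foldr (λ Rⱼ → B̃◇ ◇ (map +_ (parts Rⱼ))) 1Λ R

  -- d gives the (finitely many nonzero) coefficients of P in the basis s◇ ◇.

  record Expansion (◇ : Symbol) (P : Λ) (d : Partition → ℚ[t]) : Set where
    field
      support   : List Partition
      unique    : Unique support
      outside   : ∀ μ → μ ∉ support → d μ ≈ₜ ℚt.con ℚ.0ℚ
      expansion : P ≈ ΣList support λ μ → con (d μ) * s◇ ◇ μ

{-# OPTIONS --safe #-}

-- The three symbols differ by primitive elements: f □ = f 𝗏 + p₁ and
-- f 𝗁 = f 𝗏 + p₂.  For primitive C, the operator τ = Ω[C]^⊥ is a translation
-- p_k ↦ p_k + c_k with constants c_k, and conjugation by τ turns the operators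
-- and the basis s^◇ of one symbol into those of the other.  As
-- t^k c_k + (1 − t^k) c_k = c_k, translating X and Y simultaneously commutes with
-- the substitution of tX + (1−t)Y, so τ is also compatible with t-analogues.
-- Hence τ maps one expansion to the other with the same coefficients.
--
-- The scalar product is only known through the Schur functions, so it has to be
-- shown that p_k^⊥ = k ∂/∂p_k.  Writing s_μ = B_{μ₁} ⋯ B_{μ_n} 1 with Bernstein's
-- operators B_r, multiplication by e_l adds vertical strips, e_l^⊥ (computed
-- from k ∂/∂p_k) removes them, and all terms that are not Schur functions vanish
-- by B_r B_{r+1} = 0.  This gives adjointness for the e_l, which generate Λ.

module Submission where

open import Level using (0ℓ)
open import Algebra.Bundles using (CommutativeRing)
open import Algebra.Bundles.Raw using (RawRing)
import Algebra.Properties.CommutativeMonoid.Mult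
import Algebra.Properties.Ring
import Algebra.Properties.Semiring.Mult.TCOptimised
import Algebra.Properties.Semiring.Sum
import Algebra.Solver.Ring
import Algebra.Solver.Ring.AlmostCommutativeRing as ACR
open import Data.Empty using (⊥-elim)
open import Data.Fin.Base as Fin using (Fin; toℕ; punchIn)
open import Data.Integer.Base as ℤ using (ℤ; +_; -[1+_]; 0ℤ)
import Data.Integer.Properties as ℤₚ
import Data.Integer.Solver as ℤSolver
open import Data.List.Base
  using (List; []; _∷_; _++_; map; length; lookup; tabulate; zipWith; replicate; deduplicate; cartesianProductWith; foldr)
open import Data.List.Membership.Propositional using (_∈_; _∉_)
open import Data.List.Membership.Propositional.Properties using (∈-++⁺ˡ; ∈-++⁺ʳ; ∈-deduplicate⁺)
import Data.List.Properties as Listₚ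
open import Data.List.Properties using (length-map; tabulate-cong; length-++; length-replicate)
open import Data.List.Relation.Binary.Pointwise using (Pointwise; []; _∷_; Pointwise-length)
open import Data.List.Relation.Unary.All as All using (All; []; _∷_)
open import Data.List.Relation.Unary.AllPairs using ([]; _∷_)
open import Data.List.Relation.Unary.Any using (here; there; any?)
open import Data.List.Relation.Unary.Linked as Linked using (Linked; []; [-]; _∷_)
open import Data.List.Relation.Unary.Unique.Propositional using (Unique)
import Data.List.Relation.Unary.Unique.DecPropositional.Properties as Uniqueₚ
open import Data.Maybe.Base using (Maybe; just; nothing)
open import Data.Nat.Base as ℕ using (ℕ; zero; suc; z≤n; s≤s; _!)
import Data.Nat.Properties as ℕₚ
import Data.Nat.Solver as ℕSolver
open import Data.Product.Base using (_×_; _,_; proj₁; proj₂; ∃-syntax; Σ-syntax)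
open import Data.Rational.Base as ℚ using (ℚ)
import Data.Rational.Properties as ℚₚ
open import Data.Rational.Unnormalised.Base using (mkℚᵘ; *≡*)
import Data.Rational.Unnormalised.Properties as ℚᵘₚ
open import Data.Sum.Base using (_⊎_; inj₁; inj₂)
open import Data.Unit.Base using (⊤; tt)
open import Function.Base using (_∘_; id)
open import Relation.Binary.Definitions using (DecidableEquality)
open import Relation.Binary.PropositionalEquality.Core as ≡ using (_≡_)
import Relation.Binary.Reasoning.Setoid
open import Relation.Nullary using (¬_; Dec; yes; no)
open import Relation.Nullary.Decidable using (recompute; map′)

-- Elements of Λ are terms modulo a congruence, while Ω[A]^⊥, the operators B_r and t-analogues are
-- computed from a particular term (`deg`, `separate`). Hence degree bounds are phrased up to `≈`,
-- and sums over pairs a[X] b[Y] are compared for all balanced biadditive maps at once. Generating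
-- function identities come from one device: Ω[zA] is the only series with constant term 1 solving θ
-- F = (Σ p_k[A] z^k) F, where θ = z d/dz. The same holds for the series of operators applied to a
-- fixed P, so it is enough that both sides of an identity satisfy the same equation. Bernstein's
-- operators enter through the Jacobi-Trudi determinant. As -X is primitive, Ω[-uX]^⊥ is a ring
-- homomorphism, and it sends h_m to h_m - u h_{m-1}. On a determinant it therefore replaces each
-- column by a difference of neighbouring columns; the coefficients in u are the minors in the
-- expansion along an additional first row, and that expansion is B_r. Working with (-1)^n e_n
-- instead of e_n keeps these formulas free of further signs.

-- A ring solver with integer coefficients

module IntegerSolver (R : CommutativeRing 0ℓ 0ℓ) where
  open CommutativeRing R
  open Algebra.Properties.Ring ring
  open Algebra.Properties.Semiring.Mult.TCOptimised semiring renaming (_×_ to _·_; 1+× to 1+·)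
  open Relation.Binary.Reasoning.Setoid setoid

  -- With these multiples `1 · 1#` reduces to `1#`, so the integer constants 0 and 1 of the solver
  -- are the ring's own zero and one by computation.
  fromℤ : ℤ → Carrier
  fromℤ (+ n)    = n · 1#
  fromℤ -[1+ n ] = - (suc n · 1#)

  fromℤ-⊖ : ∀ m n → fromℤ (m ℤ.⊖ n) ≈ m · 1# - n · 1#
  fromℤ-⊖ m zero = sym (trans (+-congˡ -0#≈0#) (+-identityʳ _))
  fromℤ-⊖ zero (suc n) = sym (+-identityˡ _)
  fromℤ-⊖ (suc m) (suc n) = begin
    fromℤ (suc m ℤ.⊖ suc n)                   ≡⟨ ≡.cong fromℤ (ℤₚ.[1+m]⊖[1+n]≡m⊖n m n) ⟩
    fromℤ (m ℤ.⊖ n)                           ≈⟨ fromℤ-⊖ m n ⟩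
    m · 1# - n · 1#                           ≈⟨ +-identityˡ _ ⟨
    0# + (m · 1# - n · 1#)                    ≈⟨ +-congʳ (-‿inverseʳ 1#) ⟨
    (1# - 1#) + (m · 1# - n · 1#)             ≈⟨ +-assoc _ _ _ ⟩
    1# + (- 1# + (m · 1# - n · 1#))           ≈⟨ +-congˡ (+-comm _ _) ⟩
    1# + ((m · 1# - n · 1#) - 1#)             ≈⟨ +-congˡ (+-assoc _ _ _) ⟩
    1# + (m · 1# + (- (n · 1#) - 1#))         ≈⟨ +-assoc _ _ _ ⟨
    (1# + m · 1#) + (- (n · 1#) - 1#)         ≈⟨ +-congˡ (+-comm _ _) ⟩
    (1# + m · 1#) + (- 1# - n · 1#)           ≈⟨ +-congˡ (-‿+-comm 1# (n · 1#)) ⟩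
    (1# + m · 1#) - (1# + n · 1#)             ≈⟨ +-cong (1+· m 1#) (-‿cong (1+· n 1#)) ⟨
    suc m · 1# - suc n · 1#                   ∎

  fromℤ-+ : ∀ i j → fromℤ (i ℤ.+ j) ≈ fromℤ i + fromℤ j
  fromℤ-+ (+ m)    (+ n)    = ×-homo-+ 1# m n
  fromℤ-+ (+ m)    -[1+ n ] = fromℤ-⊖ m (suc n)
  fromℤ-+ -[1+ m ] (+ n)    = trans (fromℤ-⊖ n (suc m)) (+-comm _ _)
  fromℤ-+ -[1+ m ] -[1+ n ] = begin
    - (suc (suc (m ℕ.+ n)) · 1#)    ≡⟨ ≡.cong (λ k → - (k · 1#)) (ℕₚ.+-suc (suc m) n) ⟨
    - ((suc m ℕ.+ suc n) · 1#)      ≈⟨ -‿cong (×-homo-+ 1# (suc m) (suc n)) ⟩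
    - (suc m · 1# + suc n · 1#)     ≈⟨ -‿+-comm _ _ ⟨
    - (suc m · 1#) - suc n · 1#     ∎

  fromℤ-- : ∀ i → fromℤ (ℤ.- i) ≈ - fromℤ i
  fromℤ-- (+ zero)  = sym -0#≈0#
  fromℤ-- (+ suc n) = refl
  fromℤ-- -[1+ n ]  = sym (-‿involutive _)

  fromℤ-+* : ∀ m j → fromℤ (+ m ℤ.* j) ≈ m · 1# * fromℤ j
  fromℤ-+* zero    j = trans (reflexive (≡.cong fromℤ (ℤₚ.*-zeroˡ j))) (sym (zeroˡ _))
  fromℤ-+* (suc m) j = begin
    fromℤ (+ suc m ℤ.* j)            ≡⟨ ≡.cong fromℤ (ℤₚ.suc-* (+ m) j) ⟩
    fromℤ (j ℤ.+ + m ℤ.* j)          ≈⟨ fromℤ-+ j (+ m ℤ.* j) ⟩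
    fromℤ j + fromℤ (+ m ℤ.* j)      ≈⟨ +-cong (sym (*-identityˡ _)) (fromℤ-+* m j) ⟩
    1# * fromℤ j + m · 1# * fromℤ j  ≈⟨ distribʳ _ _ _ ⟨
    (1# + m · 1#) * fromℤ j          ≈⟨ *-congʳ (1+· m 1#) ⟨
    suc m · 1# * fromℤ j             ∎

  fromℤ-* : ∀ i j → fromℤ (i ℤ.* j) ≈ fromℤ i * fromℤ j
  fromℤ-* (+ m)    j = fromℤ-+* m j
  fromℤ-* -[1+ m ] j = begin
    fromℤ (-[1+ m ] ℤ.* j)         ≡⟨ ≡.cong fromℤ (ℤₚ.neg-distribˡ-* (+ suc m) j) ⟨
    fromℤ (ℤ.- (+ suc m ℤ.* j))    ≈⟨ fromℤ-- (+ suc m ℤ.* j) ⟩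
    - fromℤ (+ suc m ℤ.* j)        ≈⟨ -‿cong (fromℤ-+* (suc m) j) ⟩
    - (suc m · 1# * fromℤ j)       ≈⟨ -‿distribˡ-* _ _ ⟩
    - (suc m · 1#) * fromℤ j       ∎

  private
    ℤ-rawRing : RawRing 0ℓ 0ℓ
    ℤ-rawRing = CommutativeRing.rawRing ℤₚ.+-*-commutativeRing

    homomorphism : ℤ-rawRing ACR.-Raw-AlmostCommutative⟶ ACR.fromCommutativeRing R
    homomorphism = record
      { ⟦_⟧    = fromℤ
      ; +-homo = fromℤ-+
      ; *-homo = fromℤ-*
      ; -‿homo = fromℤ--
      ; 0-homo = refl
      ; 1-homo = refl
      }

    dec : ∀ i j → Maybe (fromℤ i ≈ fromℤ j)
    dec i j with i ℤₚ.≟ j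
    ... | yes i≡j = just (reflexive (≡.cong fromℤ i≡j))
    ... | no  _   = nothing

  open Algebra.Solver.Ring ℤ-rawRing (ACR.fromCommutativeRing R) homomorphism dec public
    using (solve; _:=_; _:+_; _:*_; :-_; _:-_; con)

-- Formal power series in one variable

module Sequences (R : CommutativeRing 0ℓ 0ℓ) where
  open CommutativeRing R
  open Algebra.Properties.Ring ring
  open Algebra.Properties.CommutativeMonoid.Mult +-commutativeMonoid public
    using () renaming (_×_ to _·_; ×-congʳ to ·-congʳ; ×-distrib-+ to ·-distrib-+)
  open Relation.Binary.Reasoning.Setoid setoid
  open IntegerSolver R

  Seq : Set
  Seq = ℕ → Carrier

  infix 4 _≋_
  _≋_ : Seq → Seq → Set
  F ≋ G = ∀ n → F n ≈ G n

  ↑ : Seq → Seq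
  ↑ F zero    = 0#
  ↑ F (suc n) = F n

  ↑-cong : ∀ {F G} → F ≋ G → ↑ F ≋ ↑ G
  ↑-cong e zero    = refl
  ↑-cong e (suc n) = e n

  -- The Euler operator z d/dz.
  θ : Seq → Seq
  θ F n = n · F n

  Σ< : ℕ → Seq → Carrier
  Σ< zero    F = 0#
  Σ< (suc N) F = F 0 + Σ< N (F ∘ suc)

  Σ<-cong-< : ∀ N {F G} → (∀ n → n ℕ.< N → F n ≈ G n) → Σ< N F ≈ Σ< N G
  Σ<-cong-< zero    F≈G = refl
  Σ<-cong-< (suc N) F≈G = +-cong (F≈G 0 (s≤s z≤n)) (Σ<-cong-< N λ n n<N → F≈G (suc n) (s≤s n<N))

  Σ<-cong : ∀ N {F G} → F ≋ G → Σ< N F ≈ Σ< N G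
  Σ<-cong N F≈G = Σ<-cong-< N λ n _ → F≈G n

  Σ<-zero : ∀ N {F} → (∀ n → F n ≈ 0#) → Σ< N F ≈ 0#
  Σ<-zero zero    F≈0 = refl
  Σ<-zero (suc N) F≈0 = trans (+-cong (F≈0 0) (Σ<-zero N (F≈0 ∘ suc))) (+-identityˡ 0#)

  Σ<-+ : ∀ N F G → Σ< N (λ n → F n + G n) ≈ Σ< N F + Σ< N G
  Σ<-+ zero    F G = sym (+-identityˡ 0#)
  Σ<-+ (suc N) F G = begin
    (F 0 + G 0) + Σ< N (λ n → F (suc n) + G (suc n))         ≈⟨ +-congˡ (Σ<-+ N _ _) ⟩
    (F 0 + G 0) + (Σ< N (F ∘ suc) + Σ< N (G ∘ suc))          ≈⟨ solve 4 (λ a b c d → (a :+ b) :+ (c :+ d) := (a :+ c) :+ (b :+ d)) refl _ _ _ _ ⟩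
    (F 0 + Σ< N (F ∘ suc)) + (G 0 + Σ< N (G ∘ suc))          ∎

  Σ<-hom : (φ : Carrier → Carrier) → φ 0# ≈ 0# → (∀ x y → φ (x + y) ≈ φ x + φ y) →
           ∀ N F → φ (Σ< N F) ≈ Σ< N (φ ∘ F)
  Σ<-hom φ φ-0 φ-+ zero    F = φ-0
  Σ<-hom φ φ-0 φ-+ (suc N) F = trans (φ-+ _ _) (+-congˡ (Σ<-hom φ φ-0 φ-+ N (F ∘ suc)))

  Σ<-extend : ∀ {M N} F → M ℕ.≤ N → (∀ n → M ℕ.≤ n → F n ≈ 0#) → Σ< N F ≈ Σ< M F
  Σ<-extend {N = N} F z≤n F≈0 = Σ<-zero N λ n → F≈0 n z≤n
  Σ<-extend F (s≤s M≤N) F≈0 = +-congˡ (Σ<-extend (F ∘ suc) M≤N λ n M≤n → F≈0 (suc n) (s≤s M≤n))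

  Σ<-swap : ∀ M N (F : ℕ → ℕ → Carrier) → Σ< M (λ i → Σ< N (F i)) ≈ Σ< N (λ j → Σ< M (λ i → F i j))
  Σ<-swap zero    N F = sym (Σ<-zero N λ _ → refl)
  Σ<-swap (suc M) N F = trans (+-congˡ (Σ<-swap M N (F ∘ suc))) (sym (Σ<-+ N (F 0) _))

  additive⇒0 : (φ : Carrier → Carrier) → (∀ {x y} → x ≈ y → φ x ≈ φ y) →
               (∀ x y → φ (x + y) ≈ φ x + φ y) → φ 0# ≈ 0#
  additive⇒0 φ φ-cong φ-+ = x+x≈x⇒x≈0 _ (trans (sym (φ-+ 0# 0#)) (φ-cong (+-identityˡ 0#)))

  additive⇒· : (φ : Carrier → Carrier) → φ 0# ≈ 0# → (∀ x y → φ (x + y) ≈ φ x + φ y) →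
               ∀ n x → φ (n · x) ≈ n · φ x
  additive⇒· φ φ-0 φ-+ zero    x = φ-0
  additive⇒· φ φ-0 φ-+ (suc n) x = trans (φ-+ _ _) (+-congˡ (additive⇒· φ φ-0 φ-+ n x))

  -- Series are convolved with respect to two pairings: the product of the ring, and later the
  -- action `_▷_` of Λ on itself by differential operators, which is not commutative.
  record Biadditive (_∙_ : Carrier → Carrier → Carrier) : Set where
    field
      ∙-cong   : ∀ {x x′ y y′} → x ≈ x′ → y ≈ y′ → x ∙ y ≈ x′ ∙ y′
      ∙-distˡ  : ∀ x y z → x ∙ (y + z) ≈ x ∙ y + x ∙ z
      ∙-distʳ  : ∀ z x y → (x + y) ∙ z ≈ x ∙ z + y ∙ z

    ∙-zeroʳ : ∀ x → x ∙ 0# ≈ 0#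
    ∙-zeroʳ x = additive⇒0 (x ∙_) (∙-cong refl) (∙-distˡ x)

    ∙-zeroˡ : ∀ x → 0# ∙ x ≈ 0#
    ∙-zeroˡ x = additive⇒0 (_∙ x) (λ e → ∙-cong e refl) (∙-distʳ x)

  *-biadditive : Biadditive _*_
  *-biadditive = record { ∙-cong = *-cong ; ∙-distˡ = distribˡ ; ∙-distʳ = distribʳ }

  module Convolution {_∙_ : Carrier → Carrier → Carrier} (biadditive : Biadditive _∙_) where
    open Biadditive biadditive

    infixl 7 _⋆_
    _⋆_ : Seq → Seq → Seq
    (F ⋆ G) zero    = F 0 ∙ G 0
    (F ⋆ G) (suc n) = F 0 ∙ G (suc n) + ((F ∘ suc) ⋆ G) n

    ⋆-cong-≤ : ∀ {F F′ G G′} n → (∀ k → k ℕ.≤ n → F k ≈ F′ k) → (∀ k → k ℕ.≤ n → G k ≈ G′ k) →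
               (F ⋆ G) n ≈ (F′ ⋆ G′) n
    ⋆-cong-≤ zero    F≈F′ G≈G′ = ∙-cong (F≈F′ 0 z≤n) (G≈G′ 0 z≤n)
    ⋆-cong-≤ (suc n) F≈F′ G≈G′ = +-cong (∙-cong (F≈F′ 0 z≤n) (G≈G′ (suc n) ℕₚ.≤-refl))
      (⋆-cong-≤ n (λ k k≤n → F≈F′ (suc k) (s≤s k≤n)) (λ k k≤n → G≈G′ k (ℕₚ.m≤n⇒m≤1+n k≤n)))

    ⋆-cong : ∀ {F F′ G G′} → F ≋ F′ → G ≋ G′ → F ⋆ G ≋ F′ ⋆ G′
    ⋆-cong F≈F′ G≈G′ n = ⋆-cong-≤ n (λ k _ → F≈F′ k) (λ k _ → G≈G′ k)

    ⋆-zero : ∀ {F G} → (∀ i j → F i ∙ G j ≈ 0#) → ∀ n → (F ⋆ G) n ≈ 0#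
    ⋆-zero FG≈0 zero    = FG≈0 0 0
    ⋆-zero FG≈0 (suc n) = trans (+-cong (FG≈0 0 (suc n)) (⋆-zero (λ i → FG≈0 (suc i)) n)) (+-identityˡ 0#)

    ⋆-+ˡ : ∀ F F′ G n → ((λ k → F k + F′ k) ⋆ G) n ≈ (F ⋆ G) n + (F′ ⋆ G) n
    ⋆-+ˡ F F′ G zero    = ∙-distʳ _ _ _
    ⋆-+ˡ F F′ G (suc n) = trans (+-cong (∙-distʳ _ _ _) (⋆-+ˡ (F ∘ suc) (F′ ∘ suc) G n))
      (solve 4 (λ a b c d → (a :+ b) :+ (c :+ d) := (a :+ c) :+ (b :+ d)) refl _ _ _ _)

    ⋆-+ʳ : ∀ F G G′ n → (F ⋆ (λ k → G k + G′ k)) n ≈ (F ⋆ G) n + (F ⋆ G′) n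
    ⋆-+ʳ F G G′ zero    = ∙-distˡ _ _ _
    ⋆-+ʳ F G G′ (suc n) = trans (+-cong (∙-distˡ _ _ _) (⋆-+ʳ (F ∘ suc) G G′ n))
      (solve 4 (λ a b c d → (a :+ b) :+ (c :+ d) := (a :+ c) :+ (b :+ d)) refl _ _ _ _)

    ⋆-↑ˡ : ∀ F G n → (↑ F ⋆ G) (suc n) ≈ (F ⋆ G) n
    ⋆-↑ˡ F G n = trans (+-congʳ (∙-zeroˡ _)) (+-identityˡ _)

    ⋆-↑ʳ : ∀ F G → F ⋆ ↑ G ≋ ↑ (F ⋆ G)
    ⋆-↑ʳ F G zero          = ∙-zeroʳ _
    ⋆-↑ʳ F G (suc zero)    = trans (+-congˡ (∙-zeroʳ _)) (+-identityʳ _)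
    ⋆-↑ʳ F G (suc (suc n)) = +-congˡ (⋆-↑ʳ (F ∘ suc) G (suc n))

    ⋆-suc : ∀ F G n → (F ⋆ G) (suc n) ≈ (F ⋆ (G ∘ suc)) n + F (suc n) ∙ G 0
    ⋆-suc F G zero    = refl
    ⋆-suc F G (suc n) = trans (+-congˡ (⋆-suc (F ∘ suc) G n)) (sym (+-assoc _ _ _))

    θ-⋆ : ∀ F G n → θ (F ⋆ G) n ≈ (θ F ⋆ G) n + (F ⋆ θ G) n
    θ-⋆ F G zero = sym (trans (+-cong (∙-zeroˡ _) (∙-zeroʳ _)) (+-identityˡ 0#))
    θ-⋆ F G (suc n) = begin
      suc n · (F 0 ∙ G (suc n) + FG)                        ≈⟨ ·-distrib-+ _ _ (suc n) ⟩
      suc n · (F 0 ∙ G (suc n)) + (FG + n · FG)              ≈⟨ +-cong (sym (additive⇒· (F 0 ∙_) (∙-zeroʳ _) (∙-distˡ _) (suc n) _))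
                                                                       (+-congˡ (θ-⋆ (F ∘ suc) G n)) ⟩
      F 0 ∙ θ G (suc n) + (FG + ((θ (F ∘ suc) ⋆ G) n + ((F ∘ suc) ⋆ θ G) n))
        ≈⟨ solve 4 (λ a b c d → a :+ (b :+ (c :+ d)) := (b :+ c) :+ (a :+ d)) refl _ _ _ _ ⟩
      (FG + (θ (F ∘ suc) ⋆ G) n) + (F ⋆ θ G) (suc n)         ≈⟨ +-congʳ (⋆-+ˡ (F ∘ suc) (θ (F ∘ suc)) G n) ⟨
      ((θ F ∘ suc) ⋆ G) n + (F ⋆ θ G) (suc n)                ≈⟨ +-congʳ (trans (+-congʳ (∙-zeroˡ _)) (+-identityˡ _)) ⟨
      (θ F ⋆ G) (suc n) + (F ⋆ θ G) (suc n)                  ∎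
      where FG = ((F ∘ suc) ⋆ G) n

    -- From `I` on, `F i` only has to annihilate the values of `G`: the coefficients of Ω[zA] need
    -- not vanish, but as operators they kill everything of small degree.
    Σ<-⋆ : ∀ I {J N F G} → (∀ i → I ℕ.≤ i → ∀ j → F i ∙ G j ≈ 0#) → (∀ j → J ℕ.≤ j → G j ≈ 0#) →
           I ℕ.+ J ℕ.≤ N → Σ< N (F ⋆ G) ≈ Σ< I (λ i → F i ∙ Σ< J G)
    Σ<-⋆ zero    {N = N} F≈0 G≈0 _ = Σ<-zero N (⋆-zero λ i → F≈0 i z≤n)
    Σ<-⋆ (suc I) {J} {suc N} {F} {G} F≈0 G≈0 (s≤s I+J≤N) = begin
      F 0 ∙ G 0 + Σ< N (λ n → F 0 ∙ G (suc n) + ((F ∘ suc) ⋆ G) n)            ≈⟨ +-congˡ (Σ<-+ N _ _) ⟩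
      F 0 ∙ G 0 + (Σ< N (λ n → F 0 ∙ G (suc n)) + Σ< N ((F ∘ suc) ⋆ G))       ≈⟨ +-assoc _ _ _ ⟨
      Σ< (suc N) (λ n → F 0 ∙ G n) + Σ< N ((F ∘ suc) ⋆ G)
        ≈⟨ +-congʳ (Σ<-hom (F 0 ∙_) (∙-zeroʳ _) (∙-distˡ _) (suc N) G) ⟨
      F 0 ∙ Σ< (suc N) G + Σ< N ((F ∘ suc) ⋆ G)
        ≈⟨ +-cong (∙-cong refl (Σ<-extend G J≤1+N G≈0)) (Σ<-⋆ I (λ i I≤i → F≈0 (suc i) (s≤s I≤i)) G≈0 I+J≤N) ⟩
      F 0 ∙ Σ< J G + Σ< I (λ i → F (suc i) ∙ Σ< J G)                         ∎
      where
      J≤1+N : J ℕ.≤ suc N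
      J≤1+N = ℕₚ.m≤n⇒m≤1+n (ℕₚ.≤-trans (ℕₚ.m≤n+m J I) I+J≤N)

    module Uniqueness (·-cancel : ∀ n {x y} → suc n · x ≈ suc n · y → x ≈ y) where

      -- Since `α 0` acts as zero, coefficient n of `α ⋆ x` involves only earlier coefficients of
      -- `x`, and n can be cancelled. The hypothesis compares `θ x` with `θ y` only once the
      -- convolutions agree, so that equations with a common inhomogeneous term are covered too.
      θ-unique : ∀ {α x y} → (∀ z → α 0 ∙ z ≈ 0#) → x 0 ≈ y 0 →
                 (∀ n → (α ⋆ x) n ≈ (α ⋆ y) n → θ x n ≈ θ y n) → x ≋ y
      θ-unique {α} {x} {y} α₀≈0 x₀≈y₀ step n = upTo n n ℕₚ.≤-refl
        where
        upTo : ∀ n k → k ℕ.≤ n → x k ≈ y k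
        upTo n       zero    _         = x₀≈y₀
        upTo (suc n) (suc k) (s≤s k≤n) = ·-cancel k (step (suc k) (+-cong
          (trans (α₀≈0 _) (sym (α₀≈0 _)))
          (⋆-cong-≤ k (λ _ _ → refl) (λ i i≤k → upTo n i (ℕₚ.≤-trans i≤k k≤n)))))

  module _ {_∙_ : Carrier → Carrier → Carrier} (biadditive : Biadditive _∙_) (_∗_ : Carrier → Carrier → Carrier)
           (biadditive′ : Biadditive _∗_) where
    open Biadditive biadditive
    private
      module C = Convolution biadditive
      module C′ = Convolution biadditive′

    ⋆-assoc : (∀ x y z → (x ∗ y) ∙ z ≈ x ∙ (y ∙ z)) → ∀ F G H → (F C′.⋆ G) C.⋆ H ≋ F C.⋆ (G C.⋆ H)
    ⋆-assoc assoc F G H zero    = assoc _ _ _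
    ⋆-assoc assoc F G H (suc n) = begin
      (F 0 ∗ G 0) ∙ H (suc n) + ((λ k → F 0 ∗ G (suc k) + ((F ∘ suc) C′.⋆ G) k) C.⋆ H) n
        ≈⟨ +-cong (assoc _ _ _) (C.⋆-+ˡ _ _ H n) ⟩
      F 0 ∙ (G 0 ∙ H (suc n)) + (((λ k → F 0 ∗ G (suc k)) C.⋆ H) n + (((F ∘ suc) C′.⋆ G) C.⋆ H) n)
        ≈⟨ +-congˡ (+-cong (scale (G ∘ suc) n) (⋆-assoc assoc (F ∘ suc) G H n)) ⟩
      F 0 ∙ (G 0 ∙ H (suc n)) + (F 0 ∙ ((G ∘ suc) C.⋆ H) n + ((F ∘ suc) C.⋆ (G C.⋆ H)) n)
        ≈⟨ +-assoc _ _ _ ⟨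
      (F 0 ∙ (G 0 ∙ H (suc n)) + F 0 ∙ ((G ∘ suc) C.⋆ H) n) + ((F ∘ suc) C.⋆ (G C.⋆ H)) n
        ≈⟨ +-congʳ (∙-distˡ _ _ _) ⟨
      F 0 ∙ (G C.⋆ H) (suc n) + ((F ∘ suc) C.⋆ (G C.⋆ H)) n ∎
      where
      scale : ∀ G n → ((λ k → F 0 ∗ G k) C.⋆ H) n ≈ F 0 ∙ (G C.⋆ H) n
      scale G zero    = assoc _ _ _
      scale G (suc n) = trans (+-cong (assoc _ _ _) (scale (G ∘ suc) n)) (sym (∙-distˡ _ _ _))

  open Convolution *-biadditive public

  ⋆-comm : ∀ F G → F ⋆ G ≋ G ⋆ F
  ⋆-comm F G zero    = *-comm _ _
  ⋆-comm F G (suc n) = begin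
    F 0 * G (suc n) + ((F ∘ suc) ⋆ G) n  ≈⟨ +-cong (*-comm _ _) (⋆-comm (F ∘ suc) G n) ⟩
    G (suc n) * F 0 + (G ⋆ (F ∘ suc)) n  ≈⟨ +-comm _ _ ⟩
    (G ⋆ (F ∘ suc)) n + G (suc n) * F 0  ≈⟨ ⋆-suc G F n ⟨
    (G ⋆ F) (suc n)                      ∎

  unit : Seq
  unit zero    = 1#
  unit (suc _) = 0#

  ⋆-identityˡ : ∀ F → unit ⋆ F ≋ F
  ⋆-identityˡ F zero    = *-identityˡ _
  ⋆-identityˡ F (suc n) = trans (+-cong (*-identityˡ _) (⋆-zero (λ i j → zeroˡ _) n)) (+-identityʳ _)

  -- As a ring, series can be handled by the solver and can be entries of determinants.
  seqRing : CommutativeRing 0ℓ 0ℓ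
  seqRing = record
    { Carrier = Seq ; _≈_ = _≋_ ; _+_ = λ F G n → F n + G n ; _*_ = _⋆_ ; -_ = λ F n → - F n
    ; 0# = λ _ → 0# ; 1# = unit
    ; isCommutativeRing = record
      { isRing = record
        { +-isAbelianGroup = record
          { isGroup = record
            { isMonoid = record
              { isSemigroup = record
                { isMagma = record
                  { isEquivalence = record
                    { refl = λ _ → refl ; sym = λ e n → sym (e n) ; trans = λ e e′ n → trans (e n) (e′ n) }
                  ; ∙-cong = λ e e′ n → +-cong (e n) (e′ n)
                  }
                ; assoc = λ _ _ _ n → +-assoc _ _ _
                }
              ; identity = (λ _ n → +-identityˡ _) , (λ _ n → +-identityʳ _)
              }
            ; inverse = (λ _ n → -‿inverseˡ _) , (λ _ n → -‿inverseʳ _)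
            ; ⁻¹-cong = λ e n → -‿cong (e n)
            }
          ; comm = λ _ _ n → +-comm _ _
          }
        ; *-cong = ⋆-cong
        ; *-assoc = ⋆-assoc *-biadditive _*_ *-biadditive *-assoc
        ; *-identity = ⋆-identityˡ , (λ F n → trans (⋆-comm F unit n) (⋆-identityˡ F n))
        ; distrib = (λ F G H → ⋆-+ʳ F G H) , (λ H F G → ⋆-+ˡ F G H)
        }
      ; *-comm = ⋆-comm
      }
    }

  module _ {_▷_ : Carrier → Carrier → Carrier} (biadditive : Biadditive _▷_) where
    open Biadditive biadditive
    private module C = Convolution biadditive

    -- The coefficient `α 0` acts on each coefficient separately; what remains is the convolution
    -- with `α ∘ suc`, delayed by one place, and `↑` may be pulled out of either factor of a
    -- product.
    ⋆-Leibniz : ∀ {α} → (∀ k x y → α k ▷ (x * y) ≈ (α k ▷ x) * y + x * (α k ▷ y)) →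
                ∀ F G n → (α C.⋆ (F ⋆ G)) n ≈ ((α C.⋆ F) ⋆ G) n + (F ⋆ (α C.⋆ G)) n
    ⋆-Leibniz {α} leibniz F G n = go α leibniz n
      where
      scalar : ∀ {a} → (∀ x y → a ▷ (x * y) ≈ (a ▷ x) * y + x * (a ▷ y)) →
               ∀ F n → a ▷ (F ⋆ G) n ≈ ((λ k → a ▷ F k) ⋆ G) n + (F ⋆ (λ k → a ▷ G k)) n
      scalar leib F zero    = leib _ _
      scalar leib F (suc n) = trans (∙-distˡ _ _ _) (trans (+-cong (leib _ _) (scalar leib (F ∘ suc) n))
        (solve 4 (λ a b c d → (a :+ b) :+ (c :+ d) := (a :+ c) :+ (b :+ d)) refl _ _ _ _))

      split : ∀ α F → α C.⋆ F ≋ (λ k → α 0 ▷ F k + ↑ ((α ∘ suc) C.⋆ F) k)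
      split α F zero    = sym (+-identityʳ _)
      split α F (suc n) = refl

      go : ∀ α → (∀ k x y → α k ▷ (x * y) ≈ (α k ▷ x) * y + x * (α k ▷ y)) →
           ∀ n → (α C.⋆ (F ⋆ G)) n ≈ ((α C.⋆ F) ⋆ G) n + (F ⋆ (α C.⋆ G)) n
      go α leib zero    = leib 0 _ _
      go α leib (suc n) = begin
        α 0 ▷ (F ⋆ G) (suc n) + ((α ∘ suc) C.⋆ (F ⋆ G)) n
          ≈⟨ +-cong (scalar (leib 0) F (suc n)) (go (α ∘ suc) (leib ∘ suc) n) ⟩
        (((λ k → α 0 ▷ F k) ⋆ G) (suc n) + (F ⋆ (λ k → α 0 ▷ G k)) (suc n))
          + ((((α ∘ suc) C.⋆ F) ⋆ G) n + (F ⋆ ((α ∘ suc) C.⋆ G)) n)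
          ≈⟨ +-congˡ (+-cong (sym (⋆-↑ˡ _ G n)) (sym (⋆-↑ʳ F _ (suc n)))) ⟩
        (((λ k → α 0 ▷ F k) ⋆ G) (suc n) + (F ⋆ (λ k → α 0 ▷ G k)) (suc n))
          + ((↑ ((α ∘ suc) C.⋆ F) ⋆ G) (suc n) + (F ⋆ ↑ ((α ∘ suc) C.⋆ G)) (suc n))
          ≈⟨ solve 4 (λ a b c d → (a :+ b) :+ (c :+ d) := (a :+ c) :+ (b :+ d)) refl _ _ _ _ ⟩
        (((λ k → α 0 ▷ F k) ⋆ G) (suc n) + (↑ ((α ∘ suc) C.⋆ F) ⋆ G) (suc n))
          + ((F ⋆ (λ k → α 0 ▷ G k)) (suc n) + (F ⋆ ↑ ((α ∘ suc) C.⋆ G)) (suc n))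
          ≈⟨ +-cong (⋆-+ˡ (λ k → α 0 ▷ F k) (↑ ((α ∘ suc) C.⋆ F)) G (suc n)) (⋆-+ʳ F (λ k → α 0 ▷ G k) (↑ ((α ∘ suc) C.⋆ G)) (suc n)) ⟨
        ((λ k → α 0 ▷ F k + ↑ ((α ∘ suc) C.⋆ F) k) ⋆ G) (suc n)
          + (F ⋆ (λ k → α 0 ▷ G k + ↑ ((α ∘ suc) C.⋆ G) k)) (suc n)
          ≈⟨ +-cong (⋆-cong (split α F) (λ _ → refl) (suc n)) (⋆-cong {F = F} (λ _ → refl) (split α G) (suc n)) ⟨
        ((α C.⋆ F) ⋆ G) (suc n) + (F ⋆ (α C.⋆ G)) (suc n) ∎

  pow : Seq → ℕ → Seq
  pow F zero    = unit
  pow F (suc m) = F ⋆ pow F m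

  pow-zero : ∀ {F} → F 0 ≈ 0# → ∀ m n → n ℕ.< m → pow F m n ≈ 0#
  pow-zero F₀≈0 (suc m) zero    _         = trans (*-congʳ F₀≈0) (zeroˡ _)
  pow-zero {F} F₀≈0 (suc m) (suc n) (s≤s n<m) = begin
    F 0 * pow F m (suc n) + ((F ∘ suc) ⋆ pow F m) n    ≈⟨ +-cong (trans (*-congʳ F₀≈0) (zeroˡ _))
                                                           (⋆-cong-≤ {G′ = λ _ → 0#} n (λ _ _ → refl) λ k k≤n → pow-zero F₀≈0 m k (ℕₚ.≤-<-trans k≤n n<m)) ⟩
    0# + ((F ∘ suc) ⋆ (λ _ → 0#)) n                    ≈⟨ +-cong refl (⋆-zero (λ _ _ → zeroʳ _) n) ⟩
    0# + 0#                                            ≈⟨ +-identityˡ 0# ⟩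
    0#                                                 ∎

  ·-zero : ∀ n → n · 0# ≈ 0#
  ·-zero n = additive⇒0 (n ·_) (·-congʳ n) (λ x y → ·-distrib-+ x y n)

  ⋆-·ʳ : ∀ m F G n → (F ⋆ (λ k → m · G k)) n ≈ m · (F ⋆ G) n
  ⋆-·ʳ m F G zero    = additive⇒· (F 0 *_) (zeroʳ _) (distribˡ _) m _
  ⋆-·ʳ m F G (suc n) = trans (+-cong (additive⇒· (F 0 *_) (zeroʳ _) (distribˡ _) m _) (⋆-·ʳ m (F ∘ suc) G n))
    (sym (·-distrib-+ _ _ m))

  ⋆-scaleʳ : ∀ a G H n → (G ⋆ (λ k → a * H k)) n ≈ a * (G ⋆ H) n
  ⋆-scaleʳ a G H zero    = solve 3 (λ a g h → g :* (a :* h) := a :* (g :* h)) refl a (G 0) (H 0)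
  ⋆-scaleʳ a G H (suc n) = trans (+-congˡ (⋆-scaleʳ a (G ∘ suc) H n))
    (solve 4 (λ a g h r → g :* (a :* h) :+ a :* r := a :* (g :* h :+ r)) refl a (G 0) (H (suc n)) _)

  θ-pow : ∀ F m n → θ (pow F (suc m)) n ≈ suc m · (θ F ⋆ pow F m) n
  θ-pow F zero n = trans (θ-⋆ F unit n) (+-congˡ (⋆-zero (λ i j → trans (*-congˡ (θ-unit j)) (zeroʳ _)) n))
    where
    θ-unit : ∀ j → θ unit j ≈ 0#
    θ-unit zero    = refl
    θ-unit (suc j) = ·-zero (suc j)
  θ-pow F (suc m) n = begin
    θ (F ⋆ (F ⋆ pow F m)) n                                            ≈⟨ θ-⋆ F _ n ⟩
    (θ F ⋆ (F ⋆ pow F m)) n + (F ⋆ θ (F ⋆ pow F m)) n                  ≈⟨ +-congˡ (⋆-cong {F = F} (λ _ → refl) (θ-pow F m) n) ⟩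
    (θ F ⋆ (F ⋆ pow F m)) n + (F ⋆ (λ k → suc m · (θ F ⋆ pow F m) k)) n ≈⟨ +-congˡ (⋆-·ʳ (suc m) F _ n) ⟩
    (θ F ⋆ (F ⋆ pow F m)) n + suc m · (F ⋆ (θ F ⋆ pow F m)) n          ≈⟨ +-congˡ (·-congʳ (suc m) swap) ⟩
    suc (suc m) · (θ F ⋆ (F ⋆ pow F m)) n                              ∎
    where
    module S = CommutativeRing seqRing
    swap : (F ⋆ (θ F ⋆ pow F m)) n ≈ (θ F ⋆ (F ⋆ pow F m)) n
    swap = S.trans (S.sym (S.*-assoc F (θ F) (pow F m)))
      (S.trans (S.*-congʳ {pow F m} (S.*-comm F (θ F))) (S.*-assoc (θ F) F (pow F m))) n

  -- Σ_m c_m F^m for F 0 ≈ 0#: only the powers with m ≤ n reach the coefficient of z^n.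
  compose : (ℕ → Carrier) → Seq → Seq
  compose c F n = Σ< (suc n) (λ m → c m * pow F m n)

  -- The recursion for `c` is that of 1/m!, so this is the chain rule for the exponential: the
  -- factor produced by the power rule turns `c (suc m)` into `c m`.
  θ-exp : ∀ {c F} → (∀ m → suc m · c (suc m) ≈ c m) → F 0 ≈ 0# →
          θ (compose c F) ≋ θ F ⋆ compose c F
  θ-exp {c} {F} c-suc F₀≈0 n = begin
    -- One vanishing power is added at the end, because the term with `m = 0` drops out and the
    -- others move down by one index.
    n · compose c F n                                          ≈⟨ ·-congʳ n (Σ<-extend (λ m → c m * pow F m n) (ℕₚ.n≤1+n (suc n)) λ m n<m → vanish m n n<m) ⟨
    n · Σ< (suc (suc n)) (λ m → c m * pow F m n)               ≈⟨ Σ<-hom (n ·_) (·-zero n) (λ x y → ·-distrib-+ x y n) (suc (suc n)) (λ m → c m * pow F m n) ⟩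
    Σ< (suc (suc n)) (λ m → n · (c m * pow F m n))             ≈⟨ +-cong (constant n) (Σ<-cong (suc n) term) ⟩
    0# + Σ< (suc n) (λ m → (θ F ⋆ (λ k → c m * pow F m k)) n)  ≈⟨ +-identityˡ _ ⟩
    Σ< (suc n) (λ m → (θ F ⋆ (λ k → c m * pow F m k)) n)       ≈⟨ collect (suc n) c (pow F) ⟩
    (θ F ⋆ (λ k → Σ< (suc n) (λ m → c m * pow F m k))) n
      ≈⟨ ⋆-cong-≤ n (λ _ _ → refl) (λ k k≤n → Σ<-extend (λ m → c m * pow F m k) (s≤s k≤n) λ m k<m → vanish m k k<m) ⟩
    (θ F ⋆ compose c F) n                                      ∎
    where
    vanish : ∀ m k → k ℕ.< m → c m * pow F m k ≈ 0#
    vanish m k k<m = trans (*-congˡ (pow-zero F₀≈0 m k k<m)) (zeroʳ _)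

    constant : ∀ n → n · (c 0 * unit n) ≈ 0#
    constant zero    = refl
    constant (suc n) = trans (·-congʳ (suc n) (zeroʳ _)) (·-zero (suc n))

    term : ∀ m → n · (c (suc m) * pow F (suc m) n) ≈ (θ F ⋆ (λ k → c m * pow F m k)) n
    term m = begin
      n · (c (suc m) * pow F (suc m) n)         ≈⟨ additive⇒· (c (suc m) *_) (zeroʳ _) (distribˡ _) n _ ⟨
      c (suc m) * θ (pow F (suc m)) n           ≈⟨ *-congˡ (θ-pow F m n) ⟩
      c (suc m) * (suc m · (θ F ⋆ pow F m) n)   ≈⟨ additive⇒· (c (suc m) *_) (zeroʳ _) (distribˡ _) (suc m) _ ⟩
      suc m · (c (suc m) * (θ F ⋆ pow F m) n)   ≈⟨ additive⇒· (_* (θ F ⋆ pow F m) n) (zeroˡ _) (λ x y → distribʳ _ x y) (suc m) _ ⟨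
      suc m · c (suc m) * (θ F ⋆ pow F m) n     ≈⟨ *-congʳ (c-suc m) ⟩
      c m * (θ F ⋆ pow F m) n                   ≈⟨ ⋆-scaleʳ (c m) (θ F) (pow F m) n ⟨
      (θ F ⋆ (λ k → c m * pow F m k)) n         ∎

    collect : ∀ N (c : ℕ → Carrier) (P : ℕ → Seq) → Σ< N (λ m → (θ F ⋆ (λ k → c m * P m k)) n) ≈ (θ F ⋆ (λ k → Σ< N (λ m → c m * P m k))) n
    collect zero    c P = sym (⋆-zero (λ _ _ → zeroʳ _) n)
    collect (suc N) c P = trans (+-congˡ (collect N (c ∘ suc) (P ∘ suc))) (sym (⋆-+ʳ (θ F) (λ k → c 0 * P 0 k) (λ k → Σ< N (λ m → c (suc m) * P (suc m) k)) n))

-- Determinants by expansion along the first row, as functions of the list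
-- of rows and of the list of column labels.

module Determinants (R : CommutativeRing 0ℓ 0ℓ) where
  open CommutativeRing R
  open Algebra.Properties.Ring ring
  open Relation.Binary.Reasoning.Setoid setoid
  open IntegerSolver R

  module _ {L : Set} where

    -- The alternating sum over all choices of one entry of the list, `g` receiving the chosen entry
    -- and the list without it.
    alt : (L → List L → Carrier) → List L → Carrier
    alt g []       = 0#
    alt g (c ∷ cs) = g c cs - alt (λ x xs → g x (c ∷ xs)) cs

    Det : List (L → Carrier) → List L → Carrier
    Det []       []      = 1#
    Det []       (_ ∷ _) = 0#
    Det (φ ∷ φs) cs      = alt (λ c r → φ c * Det φs r) cs

    alt-cong : ∀ {g g′} → (∀ c r → g c r ≈ g′ c r) → ∀ cs → alt g cs ≈ alt g′ cs
    alt-cong g≈g′ []       = refl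
    alt-cong g≈g′ (c ∷ cs) = +-cong (g≈g′ c cs) (-‿cong (alt-cong (λ x r → g≈g′ x (c ∷ r)) cs))

    Det-cong : ∀ {φs ψs} → Pointwise (λ φ ψ → ∀ c → φ c ≈ ψ c) φs ψs → ∀ cs → Det φs cs ≈ Det ψs cs
    Det-cong []       []       = refl
    Det-cong []       (_ ∷ _)  = refl
    Det-cong (e ∷ es) cs       = alt-cong (λ c r → *-cong (e c) (Det-cong es r)) cs

    Vanishing : (List L → Carrier) → Set
    Vanishing F = ∀ pre x post → F (pre ++ x ∷ x ∷ post) ≈ 0#

    alt-zero : ∀ {g} → (∀ c r → g c r ≈ 0#) → ∀ cs → alt g cs ≈ 0#
    alt-zero g≈0 []       = refl
    alt-zero g≈0 (c ∷ cs) = trans (+-cong (g≈0 c cs) (-‿cong (alt-zero (λ x r → g≈0 x (c ∷ r)) cs)))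
      (-‿inverseʳ 0#)

    -- Choosing one or the other of the two equal neighbours leaves the same list with opposite
    -- signs; any other choice leaves both in place.
    alt-vanishing : ∀ {g} → (∀ c → Vanishing (g c)) → Vanishing (alt g)
    alt-vanishing {g} v [] x post = begin
      g x (x ∷ post) - (g x (x ∷ post) - alt (λ y r → g y (x ∷ x ∷ r)) post)
        ≈⟨ +-congˡ (-‿cong (+-congˡ (-‿cong (alt-zero (λ y r → v y [] x r) post)))) ⟩
      g x (x ∷ post) - (g x (x ∷ post) - 0#)
        ≈⟨ solve 1 (λ a → a :- (a :- con 0ℤ) := con 0ℤ) refl _ ⟩
      0# ∎
    alt-vanishing v (c ∷ pre) x post =
      trans (+-cong (v c pre x post) (-‿cong (alt-vanishing (λ y pre → v y (c ∷ pre)) pre x post)))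
        (-‿inverseʳ 0#)

    Det-vanishing : ∀ φs → Vanishing (Det φs)
    Det-vanishing []       []        x post = refl
    Det-vanishing []       (_ ∷ _)   x post = refl
    Det-vanishing (φ ∷ φs) pre       x post =
      alt-vanishing (λ c pre x post → trans (*-congˡ (Det-vanishing φs pre x post)) (zeroʳ _)) pre x post

  signed : ℕ → Carrier → Carrier
  signed zero    x = x
  signed (suc l) x = - signed l x

  signed-cong : ∀ l {x y} → x ≈ y → signed l x ≈ signed l y
  signed-cong zero    e = e
  signed-cong (suc l) e = -‿cong (signed-cong l e)

  signed-*ʳ : ∀ l x y → signed l (x * y) ≈ x * signed l y
  signed-*ʳ zero    x y = refl
  signed-*ʳ (suc l) x y = trans (-‿cong (signed-*ʳ l x y)) (-‿distribʳ-* x _)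

window : ℕ → ℕ → List ℕ
window x zero    = []
window x (suc n) = x ∷ window (suc x) n

-- window x (suc n) without its entry at position l ≤ n
skip : ℕ → ℕ → ℕ → List ℕ
skip x n       zero    = window (suc x) n
skip x zero    (suc l) = []
skip x (suc n) (suc l) = x ∷ skip (suc x) n l

module _ (R : CommutativeRing 0ℓ 0ℓ) where
  open CommutativeRing R
  open Algebra.Properties.Ring ring
  open Determinants R
  open Sequences R using (Σ<; Σ<-cong; Σ<-hom)

  alt-window : ∀ g x n → alt g (window x (suc n)) ≈ Σ< (suc n) (λ l → signed l (g (x ℕ.+ l) (skip x n l)))
  alt-window g x zero rewrite ℕₚ.+-identityʳ x = +-congˡ -0#≈0#
  alt-window g x (suc n) rewrite ℕₚ.+-identityʳ x = +-congˡ (trans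
    (-‿cong (alt-window (λ y r → g y (x ∷ r)) (suc x) n))
    (trans (Σ<-hom -_ -0#≈0# (λ y z → sym (-‿+-comm y z)) (suc n) (λ l → signed l (g (suc x ℕ.+ l) (x ∷ skip (suc x) n l))))
      (Σ<-cong (suc n) λ l → reflexive (≡.cong (λ k → - signed l (g k (x ∷ skip (suc x) n l))) (≡.sym (ℕₚ.+-suc x l))))))

module _ (R S : CommutativeRing 0ℓ 0ℓ) where
  private
    module R = CommutativeRing R
    module S = CommutativeRing S
    module DR = Determinants R
    module DS = Determinants S
  open S using (_≈_)

  -- The relabelling `ι` allows one matrix to contain the images of columns under two different
  -- homomorphisms.
  Det-hom : (τ : R.Carrier → S.Carrier) → τ R.0# ≈ S.0# → τ R.1# ≈ S.1# →
            (∀ x y → τ (x R.+ y) ≈ τ x S.+ τ y) → (∀ x y → τ (x R.* y) ≈ τ x S.* τ y) →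
            (∀ x → τ (R.- x) ≈ S.- τ x) →
            ∀ {L L′ : Set} (ι : L → L′) {φs ψs} → Pointwise (λ φ ψ → ∀ c → τ (φ c) ≈ ψ (ι c)) φs ψs →
            ∀ cs → τ (DR.Det φs cs) ≈ DS.Det ψs (map ι cs)
  Det-hom τ τ-0 τ-1 τ-+ τ-* τ-- {L} {L′} ι = go
    where
    alt-hom : ∀ {g : L → List L → R.Carrier} {g′ : L′ → List L′ → S.Carrier} →
              (∀ c r → τ (g c r) ≈ g′ (ι c) (map ι r)) → ∀ cs → τ (DR.alt g cs) ≈ DS.alt g′ (map ι cs)
    alt-hom e []       = τ-0
    alt-hom e (c ∷ cs) = S.trans (τ-+ _ _) (S.+-cong (e c cs)
      (S.trans (τ-- _) (S.-‿cong (alt-hom (λ x r → e x (c ∷ r)) cs))))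

    go : ∀ {φs ψs} → Pointwise (λ φ ψ → ∀ c → τ (φ c) ≈ ψ (ι c)) φs ψs →
         ∀ cs → τ (DR.Det φs cs) ≈ DS.Det ψs (map ι cs)
    go []       []       = τ-1
    go []       (_ ∷ _)  = τ-0
    go (e ∷ es) cs       = alt-hom (λ c r → S.trans (τ-* _ _) (S.*-cong (e c) (go es r))) cs

-- Multilinear expansion of columns that are differences of neighbouring columns

-- `old x` is column x of a matrix with entries constant in u, and `new x` stands for `old (suc x)`
-- minus u times `old x`.
data Label : Set where
  old new : ℕ → Label

module ColumnExpansion (R : CommutativeRing 0ℓ 0ℓ) where
  open CommutativeRing R using (Carrier; _≈_; 0#; -_) renaming (refl to ≈refl; trans to ≈trans; sym to ≈sym)
  private
    module R = CommutativeRing R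
    module DR = Determinants R
  open Algebra.Properties.Ring R.ring using (-0#≈0#)
  open Sequences R
  private module S = CommutativeRing seqRing
  open Determinants seqRing
  open IntegerSolver R

  infixl 6 _⊝u_
  _⊝u_ : Seq → Seq → Seq
  (F ⊝u G) n = F n R.- ↑ G n

  Linear : (List Label → Seq) → Set
  Linear F = ∀ pre x post →
    F (pre ++ new x ∷ post) ≋ F (pre ++ old (suc x) ∷ post) ⊝u F (pre ++ old x ∷ post)

  ↑-zero : ∀ {F} → (∀ n → F n ≈ 0#) → ∀ n → ↑ F n ≈ 0#
  ↑-zero e zero    = ≈refl
  ↑-zero e (suc n) = e n

  minus-⊝u : ∀ A B C D → (λ k → (A ⊝u B) k R.- (C ⊝u D) k) ≋ (λ k → A k R.- C k) ⊝u (λ k → B k R.- D k)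
  minus-⊝u A B C D zero    = solve 2 (λ a c → (a :- con 0ℤ) :- (c :- con 0ℤ) := (a :- c) :- con 0ℤ) ≈refl _ _
  minus-⊝u A B C D (suc n) = solve 4 (λ a b c d → (a :- b) :- (c :- d) := (a :- c) :- (b :- d)) ≈refl _ _ _ _

  ⋆-⊝u : ∀ F A B → F ⋆ (A ⊝u B) ≋ F ⋆ A ⊝u F ⋆ B
  ⋆-⊝u F A B = S.trans (S.distribˡ F A (S.- ↑ B)) (S.+-congˡ {F ⋆ A}
    (S.trans (S.sym (-‿distribʳ-* F (↑ B))) (S.-‿cong (⋆-↑ʳ F B))))
    where open Algebra.Properties.Ring S.ring using (-‿distribʳ-*)

  ⊝u-⋆ : ∀ A B F → (A ⊝u B) ⋆ F ≋ A ⋆ F ⊝u B ⋆ F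
  ⊝u-⋆ A B F = S.trans (⋆-comm (A ⊝u B) F) (S.trans (⋆-⊝u F A B)
    (⊝u-cong (⋆-comm F A) (⋆-comm F B)))
    where
    ⊝u-cong : ∀ {A A′ B B′} → A ≋ A′ → B ≋ B′ → A ⊝u B ≋ A′ ⊝u B′
    ⊝u-cong e e′ n = R.+-cong (e n) (R.-‿cong (↑-cong e′ n))

  alt-⊝u : ∀ {g g₁ g₂ : Label → List Label → Seq} → (∀ c r → g c r ≋ g₁ c r ⊝u g₂ c r) →
           ∀ cs → alt g cs ≋ alt g₁ cs ⊝u alt g₂ cs
  alt-⊝u e [] n = ≈sym (≈trans (R.+-congˡ (R.-‿cong (↑-zero (λ _ → ≈refl) n))) (R.-‿inverseʳ 0#))
  alt-⊝u {g} {g₁} {g₂} e (c ∷ cs) n = ≈trans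
    (R.+-cong (e c cs n) (R.-‿cong (alt-⊝u (λ x r → e x (c ∷ r)) cs n)))
    (minus-⊝u (g₁ c cs) (g₂ c cs) (alt (λ x r → g₁ x (c ∷ r)) cs) (alt (λ x r → g₂ x (c ∷ r)) cs) n)

  alt-linear : ∀ {g} → (∀ x r → g (new x) r ≋ g (old (suc x)) r ⊝u g (old x) r) →
               (∀ c → Linear (g c)) → Linear (alt g)
  alt-linear {g} e₁ e₂ [] x post n = ≈trans
    (R.+-cong (e₁ x post n) (R.-‿cong (alt-⊝u (λ y r → e₂ y [] x r) post n)))
    (minus-⊝u (g (old (suc x)) post) (g (old x) post)
      (alt (λ y r → g y (old (suc x) ∷ r)) post) (alt (λ y r → g y (old x ∷ r)) post) n)
  alt-linear {g} e₁ e₂ (c ∷ pre) x post n = ≈trans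
    (R.+-cong (e₂ c pre x post n)
      (R.-‿cong (alt-linear (λ x r → e₁ x (c ∷ r)) (λ y pre → e₂ y (c ∷ pre)) pre x post n)))
    (minus-⊝u (g c (pre ++ old (suc x) ∷ post)) (g c (pre ++ old x ∷ post))
      (alt (λ y r → g y (c ∷ r)) (pre ++ old (suc x) ∷ post)) (alt (λ y r → g y (c ∷ r)) (pre ++ old x ∷ post)) n)

  Det-linear : ∀ {φs} → All (λ φ → ∀ x → φ (new x) ≋ φ (old (suc x)) ⊝u φ (old x)) φs → Linear (Det φs)
  Det-linear [] []      x post n = ≈sym (≈trans (R.+-congˡ (R.-‿cong (↑-zero (λ _ → ≈refl) n))) (R.-‿inverseʳ 0#))
  Det-linear [] (_ ∷ _) x post n = ≈sym (≈trans (R.+-congˡ (R.-‿cong (↑-zero (λ _ → ≈refl) n))) (R.-‿inverseʳ 0#))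
  Det-linear {φ ∷ φs} (e ∷ es) = alt-linear
    (λ x r → S.trans (⋆-cong {G = Det φs r} (e x) (λ _ → ≈refl)) (⊝u-⋆ _ _ _))
    (λ c pre x post → S.trans (⋆-cong {φ c} (λ _ → ≈refl) (Det-linear es pre x post)) (⋆-⊝u (φ c) _ _))

  record Expandable (F : List Label → Seq) : Set where
    field
      linear    : Linear F
      vanishing : Vanishing F
      constant  : ∀ cs k → F (map old cs) (suc k) ≈ 0#

  after : ∀ {F} → Expandable F → ∀ x → Expandable (λ cs → F (old x ∷ cs))
  after E x = record
    { linear    = λ pre → linear (old x ∷ pre)
    ; vanishing = λ pre → vanishing (old x ∷ pre)
    ; constant  = λ cs → constant (x ∷ cs)
    } where open Expandable E

  signed-zero : ∀ l → DR.signed l 0# ≈ 0#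
  signed-zero zero    = ≈refl
  signed-zero (suc l) = ≈trans (R.-‿cong (signed-zero l)) -0#≈0#

  -- When the new columns are expanded into differences of old ones, only the
  -- choices without repeated columns survive.
  expand-> : ∀ {F} → Expandable F → ∀ n x l → n ℕ.< l → F (map new (window x n)) l ≈ 0#
  expand-> E zero    x (suc l) _         = Expandable.constant E [] l
  expand-> E (suc n) x (suc l) (s≤s n<l) = ≈trans (Expandable.linear E [] x _ (suc l))
    (≈trans (R.+-cong (expand-> (after E (suc x)) n (suc x) (suc l) (ℕₚ.m≤n⇒m≤1+n n<l))
                      (R.-‿cong (expand-> (after E x) n (suc x) l n<l)))
    (R.-‿inverseʳ 0#))

  -- In the coefficient of u^l the first l columns take their lower part and all others their upper
  -- part: a lower part chosen right after an upper part would repeat that column. The columns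
  -- obtained this way are the window with the entry at position l left out.
  expand-≤ : ∀ {F} → Expandable F → ∀ n x l → l ℕ.≤ n →
             F (map new (window x n)) l ≈ DR.signed l (F (map old (skip x n l)) 0)
  expand-≤ E zero    x zero    z≤n       = ≈refl
  expand-≤ E (suc n) x zero    z≤n       = ≈trans (Expandable.linear E [] x _ 0)
    (≈trans (R.+-cong (expand-≤ (after E (suc x)) n (suc x) 0 z≤n) -0#≈0#) (R.+-identityʳ _))
  expand-≤ {F} E (suc n) x (suc l) (s≤s l≤n) = ≈trans (Expandable.linear E [] x _ (suc l))
    (≈trans (R.+-cong (repeated n) (R.-‿cong (expand-≤ (after E x) n (suc x) l l≤n)))
    (R.+-identityˡ _))
    where
    repeated : ∀ n → F (old (suc x) ∷ map new (window (suc x) n)) (suc l) ≈ 0#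
    repeated n with suc l ℕₚ.≤? n
    ... | no  l≮n       = expand-> (after E (suc x)) n (suc x) (suc l) (ℕₚ.≰⇒> l≮n)
    -- The list `skip (suc x) n (suc l)` begins with `suc x`, the column already chosen.
    ... | yes (s≤s l<n) = ≈trans (expand-≤ (after E (suc x)) n (suc x) (suc l) (s≤s l<n))
      (≈trans (DR.signed-cong (suc l) (Expandable.vanishing E [] (old (suc x)) _ 0)) (signed-zero (suc l)))

  κ : R.Carrier → Seq
  κ x zero    = x
  κ x (suc _) = 0#

  κ-* : ∀ x y → κ (x R.* y) ≋ κ x ⋆ κ y
  κ-* x y zero    = ≈refl
  κ-* x y (suc n) = ≈sym (≈trans (R.+-cong (R.zeroʳ x) (⋆-zero (λ _ j → R.zeroˡ _) n)) (R.+-identityˡ 0#))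

  module Expansion (σ : R.Carrier → Seq) (σ-0 : σ 0# ≋ S.0#) (σ-1 : σ R.1# ≋ unit)
           (σ-+ : ∀ x y → σ (x R.+ y) ≋ σ x S.+ σ y) (σ-* : ∀ x y → σ (x R.* y) ≋ σ x ⋆ σ y)
           (σ-- : ∀ x → σ (R.- x) ≋ S.- σ x) where

    -- In the application `φ⁺` and `φ` are the same Jacobi-Trudi row numbered k and k + 1, which
    -- moves its entries by one column; the second component is then the rule Ω[-uX]^⊥ h_m = h_m - u
    -- h_{m-1}.
    Next : (ℕ → R.Carrier) → (ℕ → R.Carrier) → Set
    Next φ⁺ φ = ∀ c → (φ⁺ c ≈ φ (suc c)) × (σ (φ⁺ c) ≋ κ (φ⁺ c) ⊝u κ (φ c))

    private
      row : (ℕ → R.Carrier) → (ℕ → R.Carrier) → Label → Seq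
      row φ⁺ φ (new c) = σ (φ⁺ c)
      row φ⁺ φ (old c) = κ (φ c)

      row-linear : ∀ {φ⁺ φ} → Next φ⁺ φ → ∀ x → row φ⁺ φ (new x) ≋ row φ⁺ φ (old (suc x)) ⊝u row φ⁺ φ (old x)
      row-linear next x zero    = ≈trans (proj₂ (next x) 0) (R.+-congʳ (proj₁ (next x)))
      row-linear next x (suc n) = proj₂ (next x) (suc n)

      κ-Det : ∀ {φ⁺s φs} → Pointwise Next φ⁺s φs → ∀ cs → κ (DR.Det φs cs) ≋ Det (zipWith row φ⁺s φs) (map old cs)
      κ-Det nexts = Det-hom R seqRing κ (λ { zero → ≈refl ; (suc _) → ≈refl }) (λ { zero → ≈refl ; (suc _) → ≈refl })
        (λ { _ _ zero → ≈refl ; _ _ (suc _) → ≈sym (R.+-identityˡ 0#) }) κ-*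
        (λ { _ zero → ≈refl ; _ (suc _) → ≈sym -0#≈0# }) old (rows nexts)
        where
        rows : ∀ {φ⁺s φs} → Pointwise Next φ⁺s φs → Pointwise (λ φ ψ → ∀ c → κ (φ c) ≋ ψ (old c)) φs (zipWith row φ⁺s φs)
        rows []       = []
        rows (_ ∷ ns) = (λ _ _ → ≈refl) ∷ rows ns

      σ-Det : ∀ {φ⁺s φs} → Pointwise Next φ⁺s φs → ∀ cs → σ (DR.Det φ⁺s cs) ≋ Det (zipWith row φ⁺s φs) (map new cs)
      σ-Det nexts = Det-hom R seqRing σ σ-0 σ-1 σ-+ σ-* σ-- new (rows nexts)
        where
        rows : ∀ {φ⁺s φs} → Pointwise Next φ⁺s φs → Pointwise (λ φ ψ → ∀ c → σ (φ c) ≋ ψ (new c)) φ⁺s (zipWith row φ⁺s φs)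
        rows []       = []
        rows (_ ∷ ns) = (λ _ _ → ≈refl) ∷ rows ns

      expandable : ∀ {φ⁺s φs} → Pointwise Next φ⁺s φs → Expandable (Det (zipWith row φ⁺s φs))
      expandable {φ⁺s} {φs} nexts = record
        { linear    = Det-linear (linears nexts)
        ; vanishing = Det-vanishing (zipWith row φ⁺s φs)
        ; constant  = λ cs k → ≈sym (κ-Det nexts cs (suc k))
        }
        where
        linears : ∀ {φ⁺s φs} → Pointwise Next φ⁺s φs →
                  All (λ φ → ∀ x → φ (new x) ≋ φ (old (suc x)) ⊝u φ (old x)) (zipWith row φ⁺s φs)
        linears []       = []
        linears (n ∷ ns) = row-linear n ∷ linears ns

    σ-Det-≤ : ∀ {φ⁺s φs} → Pointwise Next φ⁺s φs → ∀ n l → l ℕ.≤ n →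
              σ (DR.Det φ⁺s (window 0 n)) l ≈ DR.signed l (DR.Det φs (skip 0 n l))
    σ-Det-≤ nexts n l l≤n = ≈trans (σ-Det nexts (window 0 n) l) (≈trans (expand-≤ (expandable nexts) n 0 l l≤n)
      (DR.signed-cong l (≈sym (κ-Det nexts (skip 0 n l) 0))))

    σ-Det-> : ∀ {φ⁺s φs} → Pointwise Next φ⁺s φs → ∀ n l → n ℕ.< l → σ (DR.Det φ⁺s (window 0 n)) l ≈ 0#
    σ-Det-> nexts n l n<l = ≈trans (σ-Det nexts (window 0 n) l) (expand-> (expandable nexts) n 0 l n<l)

-- The rational numbers 1/n and 1/n!

module Fractions where
  open Sequences ℚₚ.+-*-commutativeRing using (_·_)
  open ℤSolver.+-*-Solver using (solve; _:+_; _:*_; _:=_)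

  fraction-+ : ∀ i j n → (i ℚ./ suc n) ℚ.+ (j ℚ./ suc n) ≡ (i ℤ.+ j) ℚ./ suc n
  fraction-+ i j n = ℚₚ.toℚᵘ-injective (ℚᵘₚ.≃-trans (ℚₚ.toℚᵘ-homo-+ (i ℚ./ suc n) (j ℚ./ suc n))
    (ℚᵘₚ.≃-trans (ℚᵘₚ.+-cong (ℚₚ.toℚᵘ-fromℚᵘ (mkℚᵘ i n)) (ℚₚ.toℚᵘ-fromℚᵘ (mkℚᵘ j n)))
    (ℚᵘₚ.≃-trans
      (*≡* (solve 3 (λ i j d → (i :* d :+ j :* d) :* d := (i :+ j) :* (d :* d)) ≡.refl i j (+ suc n)))
      (ℚᵘₚ.≃-sym (ℚₚ.toℚᵘ-fromℚᵘ (mkℚᵘ (i ℤ.+ j) n))))))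

  ·-1/ : ∀ k n → k · (+ 1 ℚ./ suc n) ≡ + k ℚ./ suc n
  ·-1/ zero    n = ≡.sym (ℚₚ.fromℚᵘ-cong {mkℚᵘ 0ℤ n} {mkℚᵘ 0ℤ 0} (*≡* ≡.refl))
  ·-1/ (suc k) n = ≡.trans (≡.cong (+ 1 ℚ./ suc n ℚ.+_) (·-1/ k n)) (fraction-+ (+ 1) (+ k) n)

  n·1/n : ∀ n → suc n · (+ 1 ℚ./ suc n) ≡ ℚ.1ℚ
  n·1/n n = ≡.trans (·-1/ (suc n) n)
    (ℚₚ.fromℚᵘ-cong {mkℚᵘ (+ suc n) n} {mkℚᵘ (+ 1) 0} (*≡* (ℤₚ.*-comm (+ suc n) (+ 1))))

  1/! : ℕ → ℚ
  1/! m = (+ 1 ℚ./ (m !)) {{m ℕₚ.!≢0}}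

  ·-1/! : ∀ m → suc m · 1/! (suc m) ≡ 1/! m
  ·-1/! m = cancel (suc m) (m !) (suc m !) {{m ℕₚ.!≢0}} {{suc m ℕₚ.!≢0}} ≡.refl
    where
    -- Factorials are not successors by computation, so the denominators are generalised before they
    -- are matched.
    cancel : ∀ k d d′ .{{_ : ℕ.NonZero d}} .{{_ : ℕ.NonZero d′}} → d′ ≡ k ℕ.* d → k · (+ 1 ℚ./ d′) ≡ + 1 ℚ./ d
    cancel k (suc d) (suc d′) eq = ≡.trans (·-1/ k d′)
      (ℚₚ.fromℚᵘ-cong {mkℚᵘ (+ k) d′} {mkℚᵘ (+ 1) d} (*≡* (≡.trans (≡.sym (ℤₚ.pos-* k (suc d)))
        (≡.trans (≡.cong +_ (≡.sym eq)) (≡.sym (ℤₚ.*-identityˡ (+ suc d′)))))))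

-- Signed sums over vertical strips

data Shifted (step : ℤ → ℤ) (a : ℤ) : ℤ → Set where
  unmoved : Shifted step a a
  moved   : Shifted step a (step a)

-- The sum of F γ over all γ arising from α by applying step to l of its
-- entries, with sign (−1)^l.

module Shifts (R : CommutativeRing 0ℓ 0ℓ) where
  open CommutativeRing R hiding (zero)
  open Algebra.Properties.Ring ring

  shifts : (ℤ → ℤ) → ℕ → List ℤ → (List ℤ → Carrier) → Carrier
  shifts step zero    []       F = F []
  shifts step (suc l) []       F = 0#
  shifts step zero    (a ∷ as) F = shifts step zero as (λ γ → F (a ∷ γ))
  shifts step (suc l) (a ∷ as) F =
    shifts step (suc l) as (λ γ → F (a ∷ γ)) - shifts step l as (λ γ → F (step a ∷ γ))

  shifts-cong : ∀ {step} l α {F G} → (∀ γ → Pointwise (Shifted step) α γ → F γ ≈ G γ) →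
                shifts step l α F ≈ shifts step l α G
  shifts-cong zero    []       e = e [] []
  shifts-cong (suc l) []       e = refl
  shifts-cong zero    (a ∷ as) e = shifts-cong zero as λ γ p → e (a ∷ γ) (unmoved ∷ p)
  shifts-cong (suc l) (a ∷ as) e = +-cong (shifts-cong (suc l) as λ γ p → e (a ∷ γ) (unmoved ∷ p))
    (-‿cong (shifts-cong l as λ γ p → e (_ ∷ γ) (moved ∷ p)))

  shifts-0 : ∀ step α F → shifts step 0 α F ≈ F α
  shifts-0 step []       F = refl
  shifts-0 step (a ∷ as) F = shifts-0 step as (λ γ → F (a ∷ γ))

  shifts-> : ∀ step l α F → length α ℕ.< l → shifts step l α F ≈ 0#
  shifts-> step (suc l) []       F _         = refl
  shifts-> step (suc l) (a ∷ as) F (s≤s n<l) = trans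
    (+-cong (shifts-> step (suc l) as _ (s≤s (ℕₚ.<⇒≤ n<l))) (-‿cong (shifts-> step l as _ n<l))) (-‿inverseʳ 0#)

  shifts-closed : ∀ {ℓ} (𝒜 : Carrier → Set ℓ) → 𝒜 0# → (∀ {x y} → 𝒜 x → 𝒜 y → 𝒜 (x + y)) → (∀ {x} → 𝒜 x → 𝒜 (- x)) →
                  ∀ {step} l α {F} → (∀ γ → Pointwise (Shifted step) α γ → 𝒜 (F γ)) → 𝒜 (shifts step l α F)
  shifts-closed 𝒜 𝒜-0 𝒜-+ 𝒜-- zero    []       c = c [] []
  shifts-closed 𝒜 𝒜-0 𝒜-+ 𝒜-- (suc l) []       c = 𝒜-0
  shifts-closed 𝒜 𝒜-0 𝒜-+ 𝒜-- zero    (a ∷ as) c = shifts-closed 𝒜 𝒜-0 𝒜-+ 𝒜-- zero as λ γ p → c (a ∷ γ) (unmoved ∷ p)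
  shifts-closed 𝒜 𝒜-0 𝒜-+ 𝒜-- (suc l) (a ∷ as) c = 𝒜-+
    (shifts-closed 𝒜 𝒜-0 𝒜-+ 𝒜-- (suc l) as λ γ p → c (a ∷ γ) (unmoved ∷ p))
    (𝒜-- (shifts-closed 𝒜 𝒜-0 𝒜-+ 𝒜-- l as λ γ p → c (_ ∷ γ) (moved ∷ p)))

  δℤ : ℤ → ℤ → Carrier
  δℤ a b with a ℤₚ.≟ b
  ... | yes _ = 1#
  ... | no  _ = 0#

  δℤ-cong : ∀ {a b c d} → (a ≡ b → c ≡ d) → (c ≡ d → a ≡ b) → δℤ a b ≈ δℤ c d
  δℤ-cong {a} {b} {c} {d} f g with a ℤₚ.≟ b | c ℤₚ.≟ d
  ... | yes _ | yes _ = refl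
  ... | no  _ | no  _ = refl
  ... | yes p | no ¬q = ⊥-elim (¬q (f p))
  ... | no ¬p | yes q = ⊥-elim (¬p (g q))

  δ* : List ℤ → List ℤ → Carrier
  δ* []       []       = 1#
  δ* []       (_ ∷ _)  = 0#
  δ* (_ ∷ _)  []       = 0#
  δ* (a ∷ as) (b ∷ bs) = δℤ a b * δ* as bs

  δ*-refl : ∀ α → δ* α α ≈ 1#
  δ*-refl []       = refl
  δ*-refl (a ∷ as) with a ℤₚ.≟ a
  ... | yes _   = trans (*-identityˡ _) (δ*-refl as)
  ... | no  a≢a = ⊥-elim (a≢a ≡.refl)

  δ*-≢ : ∀ {α β} → ¬ α ≡ β → δ* α β ≈ 0#
  δ*-≢ {[]}     {[]}     α≢β = ⊥-elim (α≢β ≡.refl)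
  δ*-≢ {[]}     {_ ∷ _}  α≢β = refl
  δ*-≢ {_ ∷ _}  {[]}     α≢β = refl
  δ*-≢ {a ∷ as} {b ∷ bs} α≢β with a ℤₚ.≟ b
  ... | yes a≡b = trans (*-congˡ (δ*-≢ λ as≡bs → α≢β (≡.cong₂ _∷_ a≡b as≡bs))) (zeroʳ _)
  ... | no  _   = zeroˡ _

  shifts-* : ∀ step l α c F → shifts step l α (λ γ → c * F γ) ≈ c * shifts step l α F
  shifts-* step zero    []       c F = refl
  shifts-* step (suc l) []       c F = sym (zeroʳ c)
  shifts-* step zero    (a ∷ as) c F = shifts-* step zero as c _
  shifts-* step (suc l) (a ∷ as) c F = trans
    (+-cong (shifts-* step (suc l) as c _) (trans (-‿cong (shifts-* step l as c _)) (-‿distribʳ-* c _)))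
    (sym (distribˡ c _ _))

  -- γ = β for a vertical-strip increase γ of α iff α is the corresponding decrease of β
  shifts-δ* : ∀ l α β → length α ≡ length β →
              shifts ℤ.suc l α (λ γ → δ* γ β) ≈ shifts ℤ.pred l β (λ γ → δ* α γ)
  shifts-δ* zero    []       []       _  = refl
  shifts-δ* (suc l) []       []       _  = refl
  shifts-δ* zero    (a ∷ as) (b ∷ bs) eq = trans (shifts-* ℤ.suc 0 as _ _)
    (trans (*-congˡ (shifts-δ* 0 as bs (ℕₚ.suc-injective eq))) (sym (shifts-* ℤ.pred 0 bs _ _)))
  shifts-δ* (suc l) (a ∷ as) (b ∷ bs) eq = +-cong
    (trans (shifts-* ℤ.suc (suc l) as _ _)
      (trans (*-congˡ (shifts-δ* (suc l) as bs (ℕₚ.suc-injective eq))) (sym (shifts-* ℤ.pred (suc l) bs _ _))))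
    (-‿cong (trans (shifts-* ℤ.suc l as _ _)
      (trans (*-cong (δℤ-cong suc≡⇒≡pred ≡pred⇒suc≡) (shifts-δ* l as bs (ℕₚ.suc-injective eq)))
        (sym (shifts-* ℤ.pred l bs _ _)))))
    where
    suc≡⇒≡pred : ℤ.suc a ≡ b → a ≡ ℤ.pred b
    suc≡⇒≡pred ≡.refl = ≡.sym (ℤₚ.pred-suc a)
    ≡pred⇒suc≡ : a ≡ ℤ.pred b → ℤ.suc a ≡ b
    ≡pred⇒suc≡ ≡.refl = ℤₚ.suc-pred b

module _ (R S : CommutativeRing 0ℓ 0ℓ) where
  private
    module R = CommutativeRing R
    module S = CommutativeRing S
  open S using (_≈_)

  shifts-hom : (T : R.Carrier → S.Carrier) → T R.0# ≈ S.0# → (∀ x y → T (x R.+ y) ≈ T x S.+ T y) →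
               (∀ x → T (R.- x) ≈ S.- T x) →
               ∀ step l α F → T (Shifts.shifts R step l α F) ≈ Shifts.shifts S step l α (λ γ → T (F γ))
  shifts-hom T T-0 T-+ T-- step zero    []       F = S.refl
  shifts-hom T T-0 T-+ T-- step (suc l) []       F = T-0
  shifts-hom T T-0 T-+ T-- step zero    (a ∷ as) F = shifts-hom T T-0 T-+ T-- step zero as _
  shifts-hom T T-0 T-+ T-- step (suc l) (a ∷ as) F = S.trans (T-+ _ _)
    (S.+-cong (shifts-hom T T-0 T-+ T-- step (suc l) as _)
      (S.trans (T-- _) (S.-‿cong (shifts-hom T T-0 T-+ T-- step l as _))))

open import Defs

open SymRing ⊤ using (≈-refl; ≈-sym; ≈-trans; +-cong; *-cong; -‿cong; con-cong; con-+; con-*)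
open CommutativeRing Λ-ring using
  ( reflexive; +-congˡ; +-congʳ; *-congˡ; *-congʳ; +-identityˡ; +-identityʳ; *-identityˡ; *-identityʳ
  ; +-assoc; +-comm; *-assoc; *-comm; distribˡ; distribʳ; zeroˡ; zeroʳ; -‿inverseʳ; setoid )
open Algebra.Properties.Ring (CommutativeRing.ring Λ-ring) using
  (-0#≈0#; -‿involutive; -‿distribˡ-*; -‿distribʳ-*; -‿+-comm; +-inverseʳ-unique; x∙y⁻¹≈ε⇒x≈y)
open Algebra.Properties.Semiring.Sum (CommutativeRing.semiring Λ-ring) using (sum-cong-≋)
open Sequences Λ-ring
open IntegerSolver Λ-ring using (solve; _:=_; _:+_; _:*_; :-_; _:-_) renaming (con to K)
open Relation.Binary.Reasoning.Setoid setoid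
open Fractions

-- Operators on Λ

rational-cong : ∀ {p q} → p ≡ q → rational p ≈ rational q
rational-cong ≡.refl = ≈-refl

rational-+ : ∀ p q → rational (p ℚ.+ q) ≈ rational p + rational q
rational-+ p q = ≈-trans (con-cong (ℚt.con-+ p q)) (con-+ (ℚt.con p) (ℚt.con q))

private module ℚ· = Sequences ℚₚ.+-*-commutativeRing

rational-· : ∀ n p → rational (n ℚ·.· p) ≈ n · rational p
rational-· zero    p = ≈-refl
rational-· (suc n) p = ≈-trans (rational-+ p (n ℚ·.· p)) (+-congˡ (rational-· n p))

·-*ˡ : ∀ n x y → (n · x) * y ≈ n · (x * y)
·-*ˡ n x y = additive⇒· (_* y) (zeroˡ y) (λ a b → distribʳ y a b) n x

·-*ʳ : ∀ n x y → x * (n · y) ≈ n · (x * y)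
·-*ʳ n x y = additive⇒· (x *_) (zeroʳ x) (distribˡ x) n y

1/_·_ : ℕ → Λ → Λ
1/ n · x = rational (+ 1 ℚ./ suc n) * x

·-1/· : ∀ n x → suc n · (1/ n · x) ≈ x
·-1/· n x = begin
  suc n · (rational (+ 1 ℚ./ suc n) * x)   ≈⟨ ·-*ˡ (suc n) _ x ⟨
  suc n · rational (+ 1 ℚ./ suc n) * x     ≈⟨ *-congʳ (rational-· (suc n) (+ 1 ℚ./ suc n)) ⟨
  rational (suc n ℚ·.· (+ 1 ℚ./ suc n)) * x ≈⟨ *-congʳ (rational-cong (n·1/n n)) ⟩
  1Λ * x                                   ≈⟨ *-identityˡ x ⟩
  x                                        ∎

1/·-· : ∀ n x → 1/ n · (suc n · x) ≈ x
1/·-· n x = ≈-trans (·-*ʳ (suc n) _ x) (·-1/· n x)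

·-cancel : ∀ n {x y} → suc n · x ≈ suc n · y → x ≈ y
·-cancel n {x} {y} e = ≈-trans (≈-sym (1/·-· n x)) (≈-trans (*-congˡ e) (1/·-· n y))

record Linear (T : Λ → Λ) : Set where
  field
    cong  : ∀ {P Q} → P ≈ Q → T P ≈ T Q
    add   : ∀ P Q → T (P + Q) ≈ T P + T Q
    scale : ∀ c P → T (con c * P) ≈ con c * T P

  zero-hom : T 0Λ ≈ 0Λ
  zero-hom = additive⇒0 T cong add

  neg : ∀ P → T (- P) ≈ - T P
  neg P = +-inverseʳ-unique _ _ (≈-trans (≈-sym (add P (- P))) (≈-trans (cong (-‿inverseʳ P)) zero-hom))

  multiple : ∀ n P → T (n · P) ≈ n · T P
  multiple = additive⇒· T zero-hom add

  Σ<-linear : ∀ N F → T (Σ< N F) ≈ Σ< N (T ∘ F)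
  Σ<-linear = Σ<-hom T zero-hom add

∘-linear : ∀ {T U} → Linear T → Linear U → Linear (T ∘ U)
∘-linear L L′ = record
  { cong  = Linear.cong L ∘ Linear.cong L′
  ; add   = λ P Q → ≈-trans (Linear.cong L (Linear.add L′ P Q)) (Linear.add L _ _)
  ; scale = λ c P → ≈-trans (Linear.cong L (Linear.scale L′ c P)) (Linear.scale L c _)
  }

-- D j is p_{j+1}^⊥ = (j + 1) ∂/∂p_{j+1}.

δ : ℕ → ℕ → Λ
δ zero    zero    = 1Λ
δ (suc j) (suc i) = δ j i
δ zero    (suc i) = 0Λ
δ (suc j) zero    = 0Λ

D : ℕ → Λ → Λ
D j (con c)       = 0Λ
D j (var (_ , i)) = suc j · δ j i
D j (P + Q)       = D j P + D j Q
D j (P * Q)       = D j P * Q + P * D j Q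
D j (- P)         = - D j P

D-cong : ∀ j {P Q} → P ≈ Q → D j P ≈ D j Q
D-cong j SymRing.≈-refl = ≈-refl
D-cong j (SymRing.≈-sym e) = ≈-sym (D-cong j e)
D-cong j (SymRing.≈-trans e e′) = ≈-trans (D-cong j e) (D-cong j e′)
D-cong j (SymRing.+-cong e e′) = +-cong (D-cong j e) (D-cong j e′)
D-cong j (SymRing.*-cong e e′) = +-cong (*-cong (D-cong j e) e′) (*-cong e (D-cong j e′))
D-cong j (SymRing.-‿cong e) = -‿cong (D-cong j e)
D-cong j (SymRing.+-assoc P Q S) = +-assoc _ _ _
D-cong j (SymRing.+-comm P Q) = +-comm _ _
D-cong j (SymRing.+-identityˡ P) = +-identityˡ _
D-cong j (SymRing.-‿inverseˡ P) = SymRing.-‿inverseˡ _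
D-cong j (SymRing.*-assoc P Q S) = solve 6
  (λ p q s p′ q′ s′ → (p′ :* q :+ p :* q′) :* s :+ (p :* q) :* s′ := p′ :* (q :* s) :+ p :* (q′ :* s :+ q :* s′))
  ≈-refl P Q S _ _ _
D-cong j (SymRing.*-comm P Q) = solve 4 (λ p q p′ q′ → p′ :* q :+ p :* q′ := q′ :* p :+ q :* p′) ≈-refl P Q _ _
D-cong j (SymRing.*-identityˡ P) = ≈-trans (+-cong (zeroˡ P) (*-identityˡ _)) (+-identityˡ _)
D-cong j (SymRing.distribˡ P Q S) = solve 6
  (λ p q s p′ q′ s′ → p′ :* (q :+ s) :+ p :* (q′ :+ s′) := (p′ :* q :+ p :* q′) :+ (p′ :* s :+ p :* s′))
  ≈-refl P Q S _ _ _
D-cong j (SymRing.con-cong e) = ≈-refl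
D-cong j (SymRing.con-+ a b) = ≈-sym (+-identityˡ _)
D-cong j (SymRing.con-* a b) = ≈-sym (≈-trans (+-cong (zeroˡ _) (zeroʳ _)) (+-identityˡ _))

D-linear : ∀ j → Linear (D j)
D-linear j = record
  { cong  = D-cong j
  ; add   = λ P Q → ≈-refl
  ; scale = λ c P → ≈-trans (+-congʳ (zeroˡ P)) (+-identityˡ _)
  }

D-δ : ∀ k j i → D k (δ j i) ≈ 0Λ
D-δ k zero    zero    = ≈-refl
D-δ k (suc j) (suc i) = D-δ k j i
D-δ k zero    (suc i) = ≈-refl
D-δ k (suc j) zero    = ≈-refl

D-D-var : ∀ k j v → D k (D j (var v)) ≈ 0Λ
D-D-var k j (_ , i) = ≈-trans (multiple (suc j) (δ j i)) (≈-trans (·-congʳ (suc j) (D-δ k j i)) (·-zero (suc j)))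
  where open Linear (D-linear k)

D-comm : ∀ j k P → D j (D k P) ≈ D k (D j P)
D-comm j k (con c) = ≈-refl
D-comm j k (var v) = ≈-trans (D-D-var j k v) (≈-sym (D-D-var k j v))
D-comm j k (P + Q) = +-cong (D-comm j k P) (D-comm j k Q)
D-comm j k (P * Q) = ≈-trans
  (+-cong (+-congʳ (*-congʳ (D-comm j k P))) (+-congˡ (*-congˡ (D-comm j k Q))))
  (solve 8 (λ p q pj qj pk qk pp qq → (pp :* q :+ pk :* qj) :+ (pj :* qk :+ p :* qq)
                                   := (pp :* q :+ pj :* qk) :+ (pk :* qj :+ p :* qq)) ≈-refl P Q _ _ _ _ _ _)
D-comm j k (- P) = -‿cong (D-comm j k P)

-- P ▷_ is P with every p_k replaced by k ∂/∂p_k; it turns out to be P^⊥.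

infixr 8 _▷_
_▷_ : Λ → Λ → Λ
con c       ▷ Q = con c * Q
var (_ , j) ▷ Q = D j Q
(P + P′)    ▷ Q = (P ▷ Q) + (P′ ▷ Q)
(P * P′)    ▷ Q = P ▷ (P′ ▷ Q)
(- P)       ▷ Q = - (P ▷ Q)

▷-linear : ∀ P → Linear (P ▷_)
▷-linear (con c) = record
  { cong  = *-congˡ
  ; add   = distribˡ _
  ; scale = λ c′ Q → solve 3 (λ a b q → a :* (b :* q) := b :* (a :* q)) ≈-refl (con c) (con c′) Q
  }
▷-linear (var (_ , j)) = D-linear j
▷-linear (P + P′) = record
  { cong  = λ e → +-cong (L.cong e) (L′.cong e)
  ; add   = λ Q S → ≈-trans (+-cong (L.add Q S) (L′.add Q S))
      (solve 4 (λ a b c d → (a :+ b) :+ (c :+ d) := (a :+ c) :+ (b :+ d)) ≈-refl _ _ _ _)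
  ; scale = λ c Q → ≈-trans (+-cong (L.scale c Q) (L′.scale c Q)) (≈-sym (distribˡ _ _ _))
  }
  where
  module L = Linear (▷-linear P)
  module L′ = Linear (▷-linear P′)
▷-linear (P * P′) = ∘-linear (▷-linear P) (▷-linear P′)
▷-linear (- P) = record
  { cong  = -‿cong ∘ L.cong
  ; add   = λ Q S → ≈-trans (-‿cong (L.add Q S)) (≈-sym (-‿+-comm _ _))
  ; scale = λ c Q → ≈-trans (-‿cong (L.scale c Q)) (-‿distribʳ-* _ _)
  }
  where module L = Linear (▷-linear P)

-- `P ▷_` is a polynomial in the operators `D j`, so commuting with these is enough.
▷-commute : ∀ {T} → Linear T → (∀ j Q → T (D j Q) ≈ D j (T Q)) → ∀ P Q → T (P ▷ Q) ≈ P ▷ T Q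
▷-commute T-linear T-D (con c)       Q = Linear.scale T-linear c Q
▷-commute T-linear T-D (var (_ , j)) Q = T-D j Q
▷-commute T-linear T-D (P + P′)      Q = ≈-trans (Linear.add T-linear _ _)
  (+-cong (▷-commute T-linear T-D P Q) (▷-commute T-linear T-D P′ Q))
▷-commute T-linear T-D (P * P′)      Q = ≈-trans (▷-commute T-linear T-D P (P′ ▷ Q))
  (Linear.cong (▷-linear P) (▷-commute T-linear T-D P′ Q))
▷-commute T-linear T-D (- P)         Q = ≈-trans (Linear.neg T-linear _) (-‿cong (▷-commute T-linear T-D P Q))

▷-comm : ∀ P P′ Q → P ▷ (P′ ▷ Q) ≈ P′ ▷ (P ▷ Q)
▷-comm P P′ Q = ▷-commute (▷-linear P)
  (λ j S → ≈-sym (▷-commute (D-linear j) (λ k U → D-comm j k U) P S)) P′ Q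

-- Associativity of the product holds by composition of operators; its commutativity is where the
-- partial derivatives have to commute.
▷-congˡ : ∀ {P P′} → P ≈ P′ → ∀ Q → P ▷ Q ≈ P′ ▷ Q
▷-congˡ SymRing.≈-refl Q = ≈-refl
▷-congˡ (SymRing.≈-sym e) Q = ≈-sym (▷-congˡ e Q)
▷-congˡ (SymRing.≈-trans e e′) Q = ≈-trans (▷-congˡ e Q) (▷-congˡ e′ Q)
▷-congˡ (SymRing.+-cong e e′) Q = +-cong (▷-congˡ e Q) (▷-congˡ e′ Q)
▷-congˡ (SymRing.*-cong {P = P} e e′) Q = ≈-trans (Linear.cong (▷-linear P) (▷-congˡ e′ Q)) (▷-congˡ e _)
▷-congˡ (SymRing.-‿cong e) Q = -‿cong (▷-congˡ e Q)
▷-congˡ (SymRing.+-assoc P P′ P″) Q = +-assoc _ _ _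
▷-congˡ (SymRing.+-comm P P′) Q = +-comm _ _
▷-congˡ (SymRing.+-identityˡ P) Q = ≈-trans (+-congʳ (zeroˡ Q)) (+-identityˡ _)
▷-congˡ (SymRing.-‿inverseˡ P) Q = ≈-trans (SymRing.-‿inverseˡ _) (≈-sym (zeroˡ Q))
▷-congˡ (SymRing.*-assoc P P′ P″) Q = ≈-refl
▷-congˡ (SymRing.*-comm P P′) Q = ▷-comm P P′ Q
▷-congˡ (SymRing.*-identityˡ P) Q = *-identityˡ _
▷-congˡ (SymRing.distribˡ P P′ P″) Q = Linear.add (▷-linear P) _ _
▷-congˡ (SymRing.con-cong e) Q = *-congʳ (con-cong e)
▷-congˡ (SymRing.con-+ a b) Q = ≈-trans (*-congʳ (con-+ a b)) (distribʳ _ _ _)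
▷-congˡ (SymRing.con-* a b) Q = ≈-trans (*-congʳ (con-* a b)) (*-assoc _ _ _)

▷-biadditive : Biadditive _▷_
▷-biadditive = record
  { ∙-cong  = λ {P} {P′} {Q} {Q′} e e′ → ≈-trans (Linear.cong (▷-linear P) e′) (▷-congˡ e Q′)
  ; ∙-distˡ = λ P → Linear.add (▷-linear P)
  ; ∙-distʳ = λ Q P P′ → ≈-refl
  }

▷-cong : ∀ {P P′ Q Q′} → P ≈ P′ → Q ≈ Q′ → P ▷ Q ≈ P′ ▷ Q′
▷-cong = Biadditive.∙-cong ▷-biadditive

-- Evaluation and Adams operations respect the congruence

module _ (R : CommutativeRing 0ℓ 0ℓ) (V : Set) (S : CommutativeRing 0ℓ 0ℓ) where
  private
    module R = CommutativeRing R
    module S = CommutativeRing S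
    module P = Polynomial R V

  eval-cong : ∀ {φ : R.Carrier → S.Carrier} {g} → (∀ {a b} → a R.≈ b → φ a S.≈ φ b) →
              (∀ a b → φ (a R.+ b) S.≈ φ a S.+ φ b) → (∀ a b → φ (a R.* b) S.≈ φ a S.* φ b) →
              φ R.0# S.≈ S.0# → φ R.1# S.≈ S.1# →
              ∀ {p q} → p P.≈ q → P.Eval.eval S φ g p S.≈ P.Eval.eval S φ g q
  eval-cong {φ} {g} φ-cong φ-+ φ-* φ-0 φ-1 = go
    where
    go : ∀ {p q} → p P.≈ q → P.Eval.eval S φ g p S.≈ P.Eval.eval S φ g q
    go P.≈-refl = S.refl
    go (P.≈-sym e) = S.sym (go e)
    go (P.≈-trans e e′) = S.trans (go e) (go e′)
    go (P.+-cong e e′) = S.+-cong (go e) (go e′)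
    go (P.*-cong e e′) = S.*-cong (go e) (go e′)
    go (P.-‿cong e) = S.-‿cong (go e)
    go (P.+-assoc _ _ _) = S.+-assoc _ _ _
    go (P.+-comm _ _) = S.+-comm _ _
    go (P.+-identityˡ _) = S.trans (S.+-congʳ φ-0) (S.+-identityˡ _)
    go (P.-‿inverseˡ _) = S.trans (S.-‿inverseˡ _) (S.sym φ-0)
    go (P.*-assoc _ _ _) = S.*-assoc _ _ _
    go (P.*-comm _ _) = S.*-comm _ _
    go (P.*-identityˡ _) = S.trans (S.*-congʳ φ-1) (S.*-identityˡ _)
    go (P.distribˡ _ _ _) = S.distribˡ _ _ _
    go (P.con-cong e) = φ-cong e
    go (P.con-+ a b) = φ-+ a b
    go (P.con-* a b) = φ-* a b

adamsₜ-cong : ∀ k {a b} → a ≈ₜ b → adamsₜ k a ≈ₜ adamsₜ k b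
adamsₜ-cong k = eval-cong ℚₚ.+-*-commutativeRing ⊤ ℚ[t]-ring ℚt.con-cong ℚt.con-+ ℚt.con-* ℚt.≈-refl ℚt.≈-refl

adams-cong : ∀ k {A A′ : Λ} → A ≈ A′ → adams k A ≈ adams k A′
adams-cong k = eval-cong ℚ[t]-ring (⊤ × ℕ) Λ-ring (con-cong ∘ adamsₜ-cong k)
  (λ _ _ → con-+ _ _) (λ _ _ → con-* _ _) ≈-refl ≈-refl

-- Degree bounds up to the congruence

-- Low d P: P has degree less than d, so Low 0 P means P ≈ 0.

Low : ℕ → Λ → Set
Low zero    P = P ≈ 0Λ
Low (suc d) P = ∃[ Q ] P ≈ Q × deg Q ℕ.≤ d

low-deg : ∀ P → Low (suc (deg P)) P
low-deg P = P , ≈-refl , ℕₚ.≤-refl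

low-cong : ∀ d {P Q} → P ≈ Q → Low d P → Low d Q
low-cong zero    e P≈0            = ≈-trans (≈-sym e) P≈0
low-cong (suc d) e (Q , P≈Q , le) = Q , ≈-trans (≈-sym e) P≈Q , le

low-0 : ∀ d {P} → P ≈ 0Λ → Low d P
low-0 zero    e = e
low-0 (suc d) e = 0Λ , e , z≤n

low-mono : ∀ {d d′ P} → d ℕ.≤ d′ → Low d P → Low d′ P
low-mono {d′ = d′} z≤n       e              = low-0 d′ e
low-mono           (s≤s d≤d′) (Q , P≈Q , le) = Q , P≈Q , ℕₚ.≤-trans le d≤d′

low-+ : ∀ d {P Q} → Low d P → Low d Q → Low d (P + Q)
low-+ zero    e e′ = ≈-trans (+-cong e e′) (+-identityˡ 0Λ)
low-+ (suc d) (P′ , e , le) (Q′ , e′ , le′) = P′ + Q′ , +-cong e e′ , ℕₚ.⊔-lub le le′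

low-neg : ∀ d {P} → Low d P → Low d (- P)
low-neg zero    e             = ≈-trans (-‿cong e) -0#≈0#
low-neg (suc d) (P′ , e , le) = - P′ , -‿cong e , le

low-* : ∀ a b {P Q} → Low (suc a) P → Low (suc b) Q → Low (suc (a ℕ.+ b)) (P * Q)
low-* a b (P′ , e , le) (Q′ , e′ , le′) = P′ * Q′ , *-cong e e′ , ℕₚ.+-mono-≤ le le′

low-· : ∀ n d {P} → Low d P → Low d (n · P)
low-· zero    d l = low-0 d ≈-refl
low-· (suc n) d l = low-+ d l (low-· n d l)

low-con : ∀ c d {P} → Low d P → Low d (con c * P)
low-con c zero    e = ≈-trans (*-congˡ e) (zeroʳ _)
low-con c (suc d) l = low-* 0 d (low-deg (con c)) l

low-Σ< : ∀ N d {F} → (∀ n → Low d (F n)) → Low d (Σ< N F)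
low-Σ< zero    d l = low-0 d ≈-refl
low-Σ< (suc N) d l = low-+ d (l 0) (low-Σ< N d (l ∘ suc))

-- When `j` is at least `a`, the truncated bound on `P` says that `P` is zero, and then any bound
-- holds for the product.
low-*-∸ : ∀ a b j {P Q} → Low (a ℕ.∸ j) P → Low (suc b) Q → Low ((a ℕ.+ b) ℕ.∸ j) (P * Q)
low-*-∸ a b zero    {P} {Q} l l′ = go a l
  where
  go : ∀ a → Low a P → Low (a ℕ.+ b) (P * Q)
  go zero    e = low-0 b (≈-trans (*-congʳ e) (zeroˡ Q))
  go (suc a) l = low-* a b l l′
low-*-∸ zero    b (suc j) {P} {Q} e l′ = low-0 (b ℕ.∸ suc j) (≈-trans (*-congʳ e) (zeroˡ Q))
low-*-∸ (suc a) b (suc j) l l′ = low-*-∸ a b j l l′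

δ-low : ∀ j i → Low (suc i ℕ.∸ j) (δ j i)
δ-low zero    zero    = low-deg 1Λ
δ-low (suc j) (suc i) = δ-low j i
δ-low zero    (suc i) = low-0 (suc (suc i)) ≈-refl
δ-low (suc j) zero    = low-0 (0 ℕ.∸ j) ≈-refl

D-low-deg : ∀ j P → Low (deg P ℕ.∸ j) (D j P)
D-low-deg j (con c)       = low-0 (0 ℕ.∸ j) ≈-refl
D-low-deg j (var (_ , i)) = low-· (suc j) (suc i ℕ.∸ j) (δ-low j i)
D-low-deg j (P + Q)       = low-+ _ (low-mono (ℕₚ.∸-monoˡ-≤ j (ℕₚ.m≤m⊔n (deg P) (deg Q))) (D-low-deg j P))
                                    (low-mono (ℕₚ.∸-monoˡ-≤ j (ℕₚ.m≤n⊔m (deg P) (deg Q))) (D-low-deg j Q))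
D-low-deg j (P * Q)       = low-+ _ (low-*-∸ (deg P) (deg Q) j (D-low-deg j P) (low-deg Q))
  (low-cong ((deg P ℕ.+ deg Q) ℕ.∸ j) (*-comm (D j Q) P)
    (≡.subst (λ d → Low (d ℕ.∸ j) (D j Q * P)) (ℕₚ.+-comm (deg Q) (deg P))
      (low-*-∸ (deg Q) (deg P) j (D-low-deg j Q) (low-deg P))))
D-low-deg j (- P)         = low-neg _ (D-low-deg j P)

-- A substitute for `G` having no component of degree below `n`. Being a property of the operator
-- `G ▷_`, it respects `≈` and requires no grading.
record Lowers (n : ℕ) (G : Λ) : Set where
  constructor lowers
  field
    low-▷ : ∀ d {P} → Low d P → Low (d ℕ.∸ n) (G ▷ P)

open Lowers

lowers-cong : ∀ {n G H} → G ≈ H → Lowers n G → Lowers n H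
lowers-cong {n} e l = lowers λ d {P} lP → low-cong (d ℕ.∸ n) (▷-congˡ e P) (low-▷ l d lP)

lowers-mono : ∀ {m n G} → m ℕ.≤ n → Lowers n G → Lowers m G
lowers-mono m≤n l = lowers λ d lP → low-mono (ℕₚ.∸-monoʳ-≤ d m≤n) (low-▷ l d lP)

lowers-con : ∀ {c} → Lowers 0 (con c)
lowers-con {c} = lowers λ d → low-con c d

lowers-+ : ∀ {n G H} → Lowers n G → Lowers n H → Lowers n (G + H)
lowers-+ {n} l l′ = lowers λ d lP → low-+ (d ℕ.∸ n) (low-▷ l d lP) (low-▷ l′ d lP)

lowers-neg : ∀ {n G} → Lowers n G → Lowers n (- G)
lowers-neg {n} l = lowers λ d lP → low-neg (d ℕ.∸ n) (low-▷ l d lP)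

lowers-* : ∀ {m n G H} → Lowers m G → Lowers n H → Lowers (m ℕ.+ n) (G * H)
lowers-* {m} {n} {G} {H} l l′ = lowers λ d {P} lP →
  ≡.subst (λ k → Low k (G ▷ H ▷ P)) (≡.trans (ℕₚ.∸-+-assoc d n m) (≡.cong (d ℕ.∸_) (ℕₚ.+-comm n m)))
    (low-▷ l (d ℕ.∸ n) (low-▷ l′ d lP))

lowers-var : ∀ {j} → Lowers (suc j) (var (tt , j))
lowers-var {j} = lowers λ
  { zero    P≈0            → ≈-trans (D-cong j P≈0) (Linear.zero-hom (D-linear j))
  ; (suc d) (Q , P≈Q , le) → low-cong (d ℕ.∸ j) (D-cong j (≈-sym P≈Q))
      (low-mono (ℕₚ.∸-monoˡ-≤ j le) (D-low-deg j Q))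
  }

lowers-⋆ : ∀ m n {α F} → (∀ i → i ℕ.≤ n → Lowers (m ℕ.+ i) (α i)) → (∀ i → i ℕ.≤ n → Lowers i (F i)) →
           Lowers (m ℕ.+ n) ((α ⋆ F) n)
lowers-⋆ m zero    l l′ = lowers-mono (ℕₚ.≤-reflexive (≡.sym (ℕₚ.+-identityʳ (m ℕ.+ 0)))) (lowers-* (l 0 z≤n) (l′ 0 z≤n))
lowers-⋆ m (suc n) {α} {F} l l′ = lowers-+
  (lowers-mono (ℕₚ.≤-reflexive (≡.cong (ℕ._+ suc n) (≡.sym (ℕₚ.+-identityʳ m)))) (lowers-* (l 0 z≤n) (l′ (suc n) ℕₚ.≤-refl)))
  (lowers-mono (ℕₚ.≤-reflexive (ℕₚ.+-suc m n)) (lowers-⋆ (suc m) n {α ∘ suc} {F}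
    (λ i i≤n → lowers-mono (ℕₚ.≤-reflexive (≡.sym (ℕₚ.+-suc m i))) (l (suc i) (s≤s i≤n)))
    (λ i i≤n → l′ i (ℕₚ.m≤n⇒m≤1+n i≤n))))

-- If `A` has no constant term, p_k[A] has no component below degree k; this is the form in which
-- the convergence of Ω[A]^⊥ needs it.
record NoConstant (A : Λ) : Set where
  constructor noConstant
  field
    adams-lowers : ∀ k → Lowers (suc k) (adams (suc k) A)

open NoConstant

noConstant-cong : ∀ {A C} → A ≈ C → NoConstant A → NoConstant C
noConstant-cong e l = noConstant λ k → lowers-cong (adams-cong (suc k) e) (adams-lowers l k)

noConstant-+ : ∀ {A C} → NoConstant A → NoConstant C → NoConstant (A + C)
noConstant-+ l l′ = noConstant λ k → lowers-+ (adams-lowers l k) (adams-lowers l′ k)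

noConstant-neg : ∀ {A} → NoConstant A → NoConstant (- A)
noConstant-neg l = noConstant λ k → lowers-neg (adams-lowers l k)

noConstant-* : ∀ {A C} → NoConstant A → NoConstant C → NoConstant (A * C)
noConstant-* l l′ = noConstant λ k →
  lowers-mono (ℕₚ.m≤m+n (suc k) (suc k)) (lowers-* (adams-lowers l k) (adams-lowers l′ k))

noConstant-con : ∀ {c A} → NoConstant A → NoConstant (con c * A)
noConstant-con l = noConstant λ k → lowers-* lowers-con (adams-lowers l k)

noConstant-var : ∀ {j} → NoConstant (var (tt , j))
noConstant-var {j} = noConstant λ k → lowers-mono (s≤s (ℕₚ.m≤m+n k (j ℕ.* suc k))) lowers-var

-- The series Ω[zA] and its differential equation

-- The power sums p_k[A], which determine Ω[zA] by θ Ω[zA] = (Σ_k p_k[A] z^k) Ω[zA].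

powerSums : Λ → Seq
powerSums A zero    = 0Λ
powerSums A (suc k) = adams (suc k) A

sum-toℕ : ∀ n F → sum {n} (λ i → F (toℕ i)) ≡ Σ< n F
sum-toℕ zero    F = ≡.refl
sum-toℕ (suc n) F = ≡.cong (λ x → F 0 + x) (sum-toℕ n (F ∘ suc))

⊛≈⋆ : ∀ F G → F ⊛ G ≋ F ⋆ G
⊛≈⋆ F G zero    = +-identityʳ _
⊛≈⋆ F G (suc n) = +-congˡ (⊛≈⋆ (F ∘ suc) G n)

power≈pow : ∀ F m → power F m ≋ pow F m
power≈pow F zero    zero    = ≈-refl
power≈pow F zero    (suc n) = ≈-refl
power≈pow F (suc m) n = ≈-trans (⊛≈⋆ F (power F m) n) (⋆-cong {F} (λ _ → ≈-refl) (power≈pow F m) n)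

exp≈compose : ∀ {F G} → F ≋ G → exp F ≋ compose (rational ∘ 1/!) G
exp≈compose {F} {G} e n = ≈-trans (reflexive (sum-toℕ (suc n) (λ m → rational (1/! m) * power F m n)))
  (Σ<-cong (suc n) λ m → *-congˡ {rational (1/! m)} (≈-trans (power≈pow F m n) (pow-cong m n)))
  where
  pow-cong : ∀ m → pow F m ≋ pow G m
  pow-cong zero    n = ≈-refl
  pow-cong (suc m) = ⋆-cong e (pow-cong m)

Ωz-0 : ∀ A → Ωz A 0 ≈ 1Λ
Ωz-0 A = ≈-trans (+-identityʳ _) (*-identityˡ _)

-- In θ log Ω[zA] the factor k from θ cancels the denominator of p_k[A] z^k / k.
θ-Ωz : ∀ A → θ (Ωz A) ≋ powerSums A ⋆ Ωz A
θ-Ωz A n = begin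
  n · Ωz A n                                 ≈⟨ ·-congʳ n (Ωz≈compose n) ⟩
  n · compose (rational ∘ 1/!) logΩ n        ≈⟨ θ-exp (λ m → ≈-trans (≈-sym (rational-· (suc m) (1/! (suc m)))) (rational-cong (·-1/! m))) ≈-refl n ⟩
  (θ logΩ ⋆ compose (rational ∘ 1/!) logΩ) n ≈⟨ ⋆-cong θ-logΩ (λ k → ≈-sym (Ωz≈compose k)) n ⟩
  (powerSums A ⋆ Ωz A) n                     ∎
  where
  logΩ : Seq
  logΩ zero    = 0Λ
  logΩ (suc k) = 1/ k · adams (suc k) A

  Ωz≈compose : Ωz A ≋ compose (rational ∘ 1/!) logΩ
  Ωz≈compose = exp≈compose λ { zero → ≈-refl ; (suc k) → ≈-refl }

  θ-logΩ : θ logΩ ≋ powerSums A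
  θ-logΩ zero    = ≈-refl
  θ-logΩ (suc k) = ·-1/· k _

module ⋆U = Uniqueness ·-cancel

Ωz-unique : ∀ {A F} → F 0 ≈ 1Λ → θ F ≋ powerSums A ⋆ F → F ≋ Ωz A
Ωz-unique {A} F₀ θF = ⋆U.θ-unique {powerSums A} (zeroˡ) (≈-trans F₀ (≈-sym (Ωz-0 A)))
  λ n e → ≈-trans (θF n) (≈-trans e (≈-sym (θ-Ωz A n)))

Ωz-cong : ∀ {A C} → A ≈ C → Ωz A ≋ Ωz C
Ωz-cong {A} {C} e = Ωz-unique (Ωz-0 A) λ n → ≈-trans (θ-Ωz A n) (⋆-cong {G = Ωz A} powerSums-cong (λ _ → ≈-refl) n)
  where
  powerSums-cong : powerSums A ≋ powerSums C
  powerSums-cong zero    = ≈-refl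
  powerSums-cong (suc k) = adams-cong (suc k) e

-- By the Leibniz rule for θ, the product satisfies the equation whose coefficient series is the sum
-- of the two power sum series.
Ωz-+ : ∀ A C → Ωz A ⋆ Ωz C ≋ Ωz (A + C)
Ωz-+ A C = Ωz-unique (≈-trans (*-cong (Ωz-0 A) (Ωz-0 C)) (*-identityˡ 1Λ)) λ n → begin
  θ (Ωz A ⋆ Ωz C) n                                                       ≈⟨ θ-⋆ (Ωz A) (Ωz C) n ⟩
  (θ (Ωz A) ⋆ Ωz C) n + (Ωz A ⋆ θ (Ωz C)) n                               ≈⟨ +-cong (⋆-cong {G = Ωz C} (θ-Ωz A) (λ _ → ≈-refl) n) (⋆-cong {Ωz A} (λ _ → ≈-refl) (θ-Ωz C) n) ⟩
  ((powerSums A ⋆ Ωz A) ⋆ Ωz C) n + (Ωz A ⋆ (powerSums C ⋆ Ωz C)) n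
    ≈⟨ Seqs.solve 4 (λ a c x y → (a Seqs.:* x) Seqs.:* y Seqs.:+ x Seqs.:* (c Seqs.:* y) Seqs.:= (a Seqs.:+ c) Seqs.:* (x Seqs.:* y))
         (λ _ → ≈-refl) (powerSums A) (powerSums C) (Ωz A) (Ωz C) n ⟩
  ((λ k → powerSums A k + powerSums C k) ⋆ (Ωz A ⋆ Ωz C)) n
    ≈⟨ ⋆-cong {G = Ωz A ⋆ Ωz C} (λ { zero → +-identityˡ 0Λ ; (suc k) → ≈-refl }) (λ _ → ≈-refl) n ⟩
  (powerSums (A + C) ⋆ (Ωz A ⋆ Ωz C)) n                                   ∎
  where module Seqs = IntegerSolver seqRing

Ωz-unit : unit ≋ Ωz 0Λ
Ωz-unit = Ωz-unique ≈-refl λ n → ≈-trans (θ-unit n)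
  (≈-sym (⋆-zero (λ { zero _ → zeroˡ _ ; (suc _) _ → zeroˡ _ }) n))
  where
  θ-unit : ∀ n → θ unit n ≈ 0Λ
  θ-unit zero    = ≈-refl
  θ-unit (suc n) = ·-zero (suc n)

Ωz-inverse : ∀ A → Ωz A ⋆ Ωz (- A) ≋ unit
Ωz-inverse A n = ≈-trans (Ωz-+ A (- A) n) (≈-trans (Ωz-cong (-‿inverseʳ A) n) (≈-sym (Ωz-unit n)))

-- The differential equation is Newton's recursion, which gives coefficient k + 1 as 1/(k + 1) times
-- the sum of the products p_{i+1}[A] Ω_{k-i}, each of total order k + 1.
Ωz-lowers : ∀ {A} → NoConstant A → ∀ n → Lowers n (Ωz A n)
Ωz-lowers {A} l n = upTo n n ℕₚ.≤-refl
  where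
  upTo : ∀ n k → k ℕ.≤ n → Lowers k (Ωz A k)
  upTo n       zero    _         = lowers-cong (≈-sym (Ωz-0 A)) lowers-con
  upTo (suc n) (suc k) (s≤s k≤n) = lowers-cong Ωz-suc
    (lowers-* lowers-con
      (lowers-⋆ 1 k {powerSums A ∘ suc} {Ωz A} (λ i _ → adams-lowers l i) (λ i i≤k → upTo n i (ℕₚ.≤-trans i≤k k≤n))))
    where
    Ωz-suc : 1/ k · ((powerSums A ∘ suc) ⋆ Ωz A) k ≈ Ωz A (suc k)
    Ωz-suc = ·-cancel k (≈-trans (·-1/· k _) (≈-sym (≈-trans (θ-Ωz A (suc k))
      (≈-trans (+-congʳ (zeroˡ _)) (+-identityˡ _)))))

-- Locally finite sums of operators, and Ω[A]^⊥

total : (ℕ → Λ → Λ) → Λ → Λ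
total G P = Σ< (suc (deg P)) (λ n → G n P)

LocallyFinite : (ℕ → Λ → Λ) → Set
LocallyFinite G = ∀ N P → Low N P → ∀ n → N ℕ.≤ n → G n P ≈ 0Λ

module _ {G : ℕ → Λ → Λ} (finite : LocallyFinite G) where

  -- `total` stops at the degree of the given term, which differs between congruent terms. Both sums
  -- are compared with a longer common one, whose additional terms vanish.
  total-at : ∀ N {P} → Low N P → total G P ≈ Σ< N (λ n → G n P)
  total-at N {P} low = ≈-trans
    (≈-sym (Σ<-extend (λ n → G n P) (ℕₚ.m≤n+m (suc (deg P)) N) (finite _ P (low-deg P))))
    (Σ<-extend (λ n → G n P) (ℕₚ.m≤m+n N (suc (deg P))) (finite N P low))

  total-linear : (∀ n → Linear (G n)) → Linear (total G)
  total-linear linear = record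
    { cong  = λ {P} {Q} e → ≈-trans (total-at (suc (deg Q)) (low-cong (suc (deg Q)) (≈-sym e) (low-deg Q)))
        (Σ<-cong (suc (deg Q)) λ n → Linear.cong (linear n) e)
    ; add   = λ P Q → ≈-trans (Σ<-cong (suc (deg (P + Q))) (λ n → Linear.add (linear n) P Q))
        (≈-trans (Σ<-+ (suc (deg (P + Q))) (λ n → G n P) (λ n → G n Q))
        (+-cong (≈-sym (total-at _ (low-mono (s≤s (ℕₚ.m≤m⊔n (deg P) (deg Q))) (low-deg P))))
                (≈-sym (total-at _ (low-mono (s≤s (ℕₚ.m≤n⊔m (deg P) (deg Q))) (low-deg Q))))))
    ; scale = λ c P → ≈-trans (Σ<-cong (suc (deg P)) (λ n → Linear.scale (linear n) c P))
        (≈-sym (Σ<-hom (con c *_) (zeroʳ _) (distribˡ _) (suc (deg P)) (λ n → G n P)))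
    }

▷-finite : ∀ {A} → NoConstant A → LocallyFinite (λ n P → Ωz A n ▷ P)
▷-finite {A} l N P low n N≤n = ≡.subst (λ d → Low d (Ωz A n ▷ P)) (ℕₚ.m≤n⇒m∸n≡0 N≤n)
  (Lowers.low-▷ (Ωz-lowers l n) N low)

-- Ω[A]^⊥, with ▷ for ^⊥

Ω▷ : Λ → Λ → Λ
Ω▷ A = total (λ n P → Ωz A n ▷ P)

Ω▷-linear : ∀ {A} → NoConstant A → Linear (Ω▷ A)
Ω▷-linear {A} l = total-linear (▷-finite l) (λ n → ▷-linear (Ωz A n))

Ω▷-cong : ∀ {A C} → A ≈ C → ∀ P → Ω▷ A P ≈ Ω▷ C P
Ω▷-cong e P = Σ<-cong (suc (deg P)) λ n → ▷-congˡ (Ωz-cong e n) P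

module ▷⋆ = Convolution ▷-biadditive

⋆-▷ : ∀ F G P n → (F ⋆ G) n ▷ P ≈ (F ▷⋆.⋆ (λ k → G k ▷ P)) n
⋆-▷ F G P zero    = ≈-refl
⋆-▷ F G P (suc n) = +-congˡ (⋆-▷ (F ∘ suc) G P n)

Ω▷-0 : ∀ P → Ω▷ 0Λ P ≈ P
Ω▷-0 P = begin
  Ωz 0Λ 0 ▷ P + Σ< (deg P) (λ n → Ωz 0Λ (suc n) ▷ P)
    ≈⟨ +-cong (▷-congˡ (Ωz-0 0Λ) P) (Σ<-zero (deg P) λ n → ≈-trans (▷-congˡ (≈-sym (Ωz-unit (suc n))) P) (zeroˡ P)) ⟩
  1Λ * P + 0Λ  ≈⟨ +-identityʳ _ ⟩
  1Λ * P       ≈⟨ *-identityˡ P ⟩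
  P            ∎

-- The number `d` bounds the degree of `P` and of all `Ωz C j ▷ P`, so the first `d + d`
-- coefficients of the Cauchy product contain every pair of indices with a nonzero contribution.
Ω▷-+ : ∀ {A C} → NoConstant A → NoConstant C → ∀ P → Ω▷ (A + C) P ≈ Ω▷ A (Ω▷ C P)
Ω▷-+ {A} {C} lA lC P = begin
  Ω▷ (A + C) P                                       ≈⟨ total-at (▷-finite (noConstant-+ lA lC)) (d ℕ.+ d) (low-mono (ℕₚ.m≤m+n d d) (low-deg P)) ⟩
  Σ< (d ℕ.+ d) (λ n → Ωz (A + C) n ▷ P)              ≈⟨ Σ<-cong (d ℕ.+ d) (λ n → ≈-trans (▷-congˡ (≈-sym (Ωz-+ A C n)) P) (⋆-▷ (Ωz A) (Ωz C) P n)) ⟩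
  Σ< (d ℕ.+ d) (Ωz A ▷⋆.⋆ (λ k → Ωz C k ▷ P))        ≈⟨ ▷⋆.Σ<-⋆ d {d} {F = Ωz A} {G = λ k → Ωz C k ▷ P} (λ i d≤i j → ▷-finite lA d _ (low j) i d≤i) (▷-finite lC d P (low-deg P)) ℕₚ.≤-refl ⟩
  Σ< d (λ i → Ωz A i ▷ Ω▷ C P)                       ≈⟨ total-at (▷-finite lA) d (low-Σ< d d low) ⟨
  Ω▷ A (Ω▷ C P)                                      ∎
  where
  d : ℕ
  d = suc (deg P)
  low : ∀ j → Low d (Ωz C j ▷ P)
  low j = low-mono (ℕₚ.m∸n≤m d j) (Lowers.low-▷ (Ωz-lowers lC j) d (low-deg P))

-- Primitive elements and translations

-- If all p_k[A]^⊥ are derivations, then Ω[A]^⊥ is a ring homomorphism.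

IsConstant : Λ → Set
IsConstant P = ∃[ c ] P ≈ con c

-- Primitive in the sense of the coproduct, expressed by the operators p_k[A]^⊥: they are
-- derivations, and by `on-var` derivations with constant coefficients, whose exponential is a
-- translation.
record Primitive (A : Λ) : Set where
  field
    leibniz : ∀ k P Q → adams (suc k) A ▷ (P * Q) ≈ (adams (suc k) A ▷ P) * Q + P * (adams (suc k) A ▷ Q)
    on-con  : ∀ k c → adams (suc k) A ▷ con c ≈ 0Λ
    on-var  : ∀ k v → IsConstant (adams (suc k) A ▷ var v)

δ-constant : ∀ j i → IsConstant (δ j i)
δ-constant zero    zero    = _ , ≈-refl
δ-constant (suc j) (suc i) = δ-constant j i
δ-constant zero    (suc i) = _ , ≈-refl
δ-constant (suc j) zero    = _ , ≈-refl

+-constant : ∀ {P Q} → IsConstant P → IsConstant Q → IsConstant (P + Q)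
+-constant (a , e) (b , e′) = _ , ≈-trans (+-cong e e′) (≈-sym (con-+ a b))

*-constant : ∀ {P Q} → IsConstant P → IsConstant Q → IsConstant (P * Q)
*-constant (a , e) (b , e′) = _ , ≈-trans (*-cong e e′) (≈-sym (con-* a b))

·-constant : ∀ n {P} → IsConstant P → IsConstant (n · P)
·-constant zero    c = _ , ≈-refl
·-constant (suc n) c = +-constant c (·-constant n c)

primitive-var : ∀ j → Primitive (var (tt , j))
primitive-var j = record
  { leibniz = λ k P Q → ≈-refl
  ; on-con  = λ k c → ≈-refl
  ; on-var  = λ k (_ , i) → ·-constant (suc (ℕ.pred (suc j ℕ.* suc k))) (δ-constant (ℕ.pred (suc j ℕ.* suc k)) i)
  }

con-neg : ∀ a → con (ℚt.- a) ≈ - con a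
con-neg a = +-inverseʳ-unique _ _ (≈-trans (≈-sym (con-+ a (ℚt.- a))) (con-cong (CommutativeRing.-‿inverseʳ ℚ[t]-ring a)))

neg-constant : ∀ {P} → IsConstant P → IsConstant (- P)
neg-constant (a , e) = _ , ≈-trans (-‿cong e) (≈-sym (con-neg a))

primitive-neg : ∀ {A} → Primitive A → Primitive (- A)
primitive-neg p = record
  { leibniz = λ k P Q → ≈-trans (-‿cong (leibniz k P Q))
      (solve 4 (λ p q p′ q′ → :- (p′ :* q :+ p :* q′) := (:- p′) :* q :+ p :* (:- q′)) ≈-refl P Q _ _)
  ; on-con  = λ k c → ≈-trans (-‿cong (on-con k c)) -0#≈0#
  ; on-var  = λ k v → neg-constant (on-var k v)
  }
  where open Primitive p

θ-▷ : ∀ A P → θ (λ n → Ωz A n ▷ P) ≋ powerSums A ▷⋆.⋆ (λ n → Ωz A n ▷ P)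
θ-▷ A P n = begin
  n · (Ωz A n ▷ P)                                ≈⟨ additive⇒· (_▷ P) (zeroˡ P) (λ _ _ → ≈-refl) n (Ωz A n) ⟨
  (n · Ωz A n) ▷ P                                ≈⟨ ▷-congˡ (θ-Ωz A n) P ⟩
  (powerSums A ⋆ Ωz A) n ▷ P                      ≈⟨ ⋆-▷ (powerSums A) (Ωz A) P n ⟩
  (powerSums A ▷⋆.⋆ (λ k → Ωz A k ▷ P)) n         ∎

module ▷U = ▷⋆.Uniqueness ·-cancel

module _ (c : ℕ → ℚ[t]) where

  translateBy : Λ → Λ
  translateBy = SymRing.Eval.eval ⊤ Λ-ring con λ (_ , j) → var (tt , j) + con (c j)

  translateBy-cong : ∀ {P Q} → P ≈ Q → translateBy P ≈ translateBy Q
  translateBy-cong = eval-cong ℚ[t]-ring (⊤ × ℕ) Λ-ring con-cong con-+ con-* ≈-refl ≈-refl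

module Translation {A : Λ} (prim : Primitive A) where
  open Primitive prim

  -- The exponential of a derivation is multiplicative: the right-hand side satisfies the
  -- differential equation of the left-hand side because convolution with the derivations p_k[A]^⊥
  -- obeys the Leibniz rule.
  ▷-* : ∀ P Q → (λ n → Ωz A n ▷ (P * Q)) ≋ (λ n → Ωz A n ▷ P) ⋆ (λ n → Ωz A n ▷ Q)
  ▷-* P Q = ▷U.θ-unique {powerSums A} zeroˡ at-0 λ n e → ≈-trans (θ-▷ A (P * Q) n) (≈-trans e (≈-sym (product n)))
    where
    FP FQ : Seq
    FP n = Ωz A n ▷ P
    FQ n = Ωz A n ▷ Q

    id-at-0 : ∀ S → Ωz A 0 ▷ S ≈ S
    id-at-0 S = ≈-trans (▷-congˡ (Ωz-0 A) S) (*-identityˡ S)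

    at-0 : Ωz A 0 ▷ (P * Q) ≈ FP 0 * FQ 0
    at-0 = ≈-trans (id-at-0 (P * Q)) (≈-sym (*-cong (id-at-0 P) (id-at-0 Q)))

    leibniz′ : ∀ k P Q → powerSums A k ▷ (P * Q) ≈ (powerSums A k ▷ P) * Q + P * (powerSums A k ▷ Q)
    leibniz′ zero    P Q = solve 2 (λ p q → K 0ℤ :* (p :* q) := (K 0ℤ :* p) :* q :+ p :* (K 0ℤ :* q)) ≈-refl P Q
    leibniz′ (suc k) P Q = leibniz k P Q

    product : ∀ n → θ (FP ⋆ FQ) n ≈ (powerSums A ▷⋆.⋆ (FP ⋆ FQ)) n
    product n = begin
      θ (FP ⋆ FQ) n                                                     ≈⟨ θ-⋆ FP FQ n ⟩
      (θ FP ⋆ FQ) n + (FP ⋆ θ FQ) n                                     ≈⟨ +-cong (⋆-cong {G = FQ} (θ-▷ A P) (λ _ → ≈-refl) n) (⋆-cong {FP} (λ _ → ≈-refl) (θ-▷ A Q) n) ⟩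
      ((powerSums A ▷⋆.⋆ FP) ⋆ FQ) n + (FP ⋆ (powerSums A ▷⋆.⋆ FQ)) n   ≈⟨ ⋆-Leibniz ▷-biadditive {powerSums A} leibniz′ FP FQ n ⟨
      (powerSums A ▷⋆.⋆ (FP ⋆ FQ)) n                                    ∎

  ▷-constant : ∀ n {P} → IsConstant P → IsConstant (powerSums A n ▷ P)
  ▷-constant zero    (c , e) = _ , zeroˡ _
  ▷-constant (suc n) (c , e) = _ , ≈-trans (▷-cong {adams (suc n) A} ≈-refl e) (on-con n c)

  -- In Newton's recursion either a power sum acts on the variable itself, with a constant as
  -- result, or it acts on an earlier coefficient, which is already constant.
  ▷-var : ∀ n v → IsConstant (Ωz A (suc n) ▷ var v)
  ▷-var n v = upTo n n ℕₚ.≤-refl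
    where
    convolution : ∀ m n α F → (∀ i → i ℕ.≤ n → IsConstant (α i ▷ F (n ℕ.∸ i))) → IsConstant ((α ▷⋆.⋆ F) n)
    convolution m zero    α F c = c 0 z≤n
    convolution m (suc n) α F c = +-constant (c 0 z≤n) (convolution (suc m) n (α ∘ suc) F (λ i i≤n → c (suc i) (s≤s i≤n)))

    upTo : ∀ N n → n ℕ.≤ N → IsConstant (Ωz A (suc n) ▷ var v)
    upTo N n n≤N = let c , e = *-constant {rational (+ 1 ℚ./ suc n)} (_ , ≈-refl) (convolution 0 (suc n) (powerSums A) (λ k → Ωz A k ▷ var v) (term N n n≤N))
      in c , ≈-trans (≈-sym (1/·-· n _)) (≈-trans (*-congˡ (θ-▷ A (var v) (suc n))) e)
      where
      term : ∀ N n → n ℕ.≤ N → ∀ i → i ℕ.≤ suc n → IsConstant (powerSums A i ▷ (Ωz A (suc n ℕ.∸ i) ▷ var v))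
      term N n n≤N zero    _         = _ , zeroˡ _
      term N n n≤N (suc i) (s≤s i≤n) with n ℕ.∸ i in eq
      ... | zero  = let c , e = on-var i v in c , ≈-trans (▷-cong {adams (suc i) A} ≈-refl (≈-trans (▷-congˡ (Ωz-0 A) (var v)) (*-identityˡ _))) e
      ... | suc m = ▷-constant (suc i) (upTo′ N n m n≤N (≡.subst (ℕ._≤ n) eq (ℕₚ.m∸n≤m n i)))
        where
        upTo′ : ∀ N n m → n ℕ.≤ N → suc m ℕ.≤ n → IsConstant (Ωz A (suc m) ▷ var v)
        upTo′ (suc N) n m n≤N m<n = upTo N m (ℕₚ.≤-pred (ℕₚ.≤-trans m<n n≤N))
        upTo′ zero zero m n≤N ()

  sum-constant : ∀ N {F} → (∀ n → IsConstant (F n)) → IsConstant (Σ< N F)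
  sum-constant zero    c = _ , ≈-refl
  sum-constant (suc N) c = +-constant (c 0) (sum-constant N (c ∘ suc))

  -- `var (tt , j)` has degree `suc j`, so these are exactly the terms of `Ω▷ A (var (tt , j))`
  -- after the leading one, which is the variable itself.
  shift : ∀ j → IsConstant (Σ< (suc j) (λ n → Ωz A (suc n) ▷ var (tt , j)))
  shift j = sum-constant (suc j) (λ n → ▷-var n (tt , j))

  translate : Λ → Λ
  translate = translateBy (proj₁ ∘ shift)

  translate-cong : ∀ {P Q} → P ≈ Q → translate P ≈ translate Q
  translate-cong = translateBy-cong (proj₁ ∘ shift)

  module _ (lA : NoConstant A) where

    Ω▷-* : ∀ P Q → Ω▷ A (P * Q) ≈ Ω▷ A P * Ω▷ A Q
    Ω▷-* P Q = begin
      Ω▷ A (P * Q)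
        ≈⟨ total-at (▷-finite lA) (d ℕ.+ e) (low-mono d+e (low-deg (P * Q))) ⟩
      Σ< (d ℕ.+ e) (λ n → Ωz A n ▷ (P * Q))
        ≈⟨ Σ<-cong (d ℕ.+ e) (▷-* P Q) ⟩
      Σ< (d ℕ.+ e) ((λ n → Ωz A n ▷ P) ⋆ (λ n → Ωz A n ▷ Q))
        ≈⟨ Σ<-⋆ d {e} {F = λ n → Ωz A n ▷ P} {G = λ n → Ωz A n ▷ Q} (λ i d≤i j → ≈-trans (*-congʳ (▷-finite lA d P (low-deg P) i d≤i)) (zeroˡ _))
             (▷-finite lA e Q (low-deg Q)) ℕₚ.≤-refl ⟩
      Σ< d (λ i → (Ωz A i ▷ P) * Ω▷ A Q)
        ≈⟨ Σ<-hom (_* Ω▷ A Q) (zeroˡ _) (λ x y → distribʳ _ x y) d (λ i → Ωz A i ▷ P) ⟨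
      Ω▷ A P * Ω▷ A Q ∎
      where
      d e : ℕ
      d = suc (deg P)
      e = suc (deg Q)
      d+e : suc (deg P ℕ.+ deg Q) ℕ.≤ d ℕ.+ e
      d+e = s≤s (ℕₚ.+-monoʳ-≤ (deg P) (ℕₚ.n≤1+n (deg Q)))

    Ω▷≈translate : ∀ P → Ω▷ A P ≈ translate P
    Ω▷≈translate (con c) = ≈-trans (+-identityʳ _) (≈-trans (▷-congˡ (Ωz-0 A) (con c)) (*-identityˡ _))
    Ω▷≈translate (var (tt , j)) = +-cong (≈-trans (▷-congˡ (Ωz-0 A) (var (tt , j))) (*-identityˡ _)) (proj₂ (shift j))
    Ω▷≈translate (P + Q) = ≈-trans (Linear.add (Ω▷-linear lA) P Q) (+-cong (Ω▷≈translate P) (Ω▷≈translate Q))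
    Ω▷≈translate (P * Q) = ≈-trans (Ω▷-* P Q) (*-cong (Ω▷≈translate P) (Ω▷≈translate Q))
    Ω▷≈translate (- P)   = ≈-trans (Linear.neg (Ω▷-linear lA) P) (-‿cong (Ω▷≈translate P))

-- The action of e_l^⊥ on h_m and e_m

up : ℕ → Seq → Seq
up zero    F = F
up (suc k) F = ↑ (up k F)

up-cong : ∀ k {F G} → F ≋ G → up k F ≋ up k G
up-cong zero    e = e
up-cong (suc k) e = ↑-cong (up-cong k e)

⋆-up : ∀ k F G → F ⋆ up k G ≋ up k (F ⋆ G)
⋆-up zero    F G n = ≈-refl
⋆-up (suc k) F G n = ≈-trans (⋆-↑ʳ F (up k G) n) (↑-cong (⋆-up k F G) n)

θ-up : ∀ k F n → θ (up k F) n ≈ k · up k F n + up k (θ F) n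
θ-up zero    F n       = ≈-sym (+-identityˡ _)
θ-up (suc k) F zero    = ≈-sym (≈-trans (+-identityʳ _) (·-zero (suc k)))
θ-up (suc k) F (suc n) = ≈-trans (+-congˡ (θ-up k F n)) (≈-sym (+-assoc _ _ _))

up-unit : ∀ j i → up j unit i ≡ δ j i
up-unit zero    zero    = ≡.refl
up-unit zero    (suc i) = ≡.refl
up-unit (suc j) zero    = ≡.refl
up-unit (suc j) (suc i) = up-unit j i

D-⋆ : ∀ j F G n → D j ((F ⋆ G) n) ≈ ((D j ∘ F) ⋆ G) n + (F ⋆ (D j ∘ G)) n
D-⋆ j F G zero    = ≈-refl
D-⋆ j F G (suc n) = ≈-trans (+-congˡ (D-⋆ j (F ∘ suc) G n))
  (solve 4 (λ a b c d → (a :+ b) :+ (c :+ d) := (a :+ c) :+ (b :+ d)) ≈-refl _ _ _ _)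

-- p_{j+1}^⊥ shifts a series exp (v Σ p_k z^k / k) by j + 1 places, up to the factor v.
D-shift : ∀ {A} v j → D j v ≈ 0Λ → (∀ i → powerSums A (suc i) ≈ v * var (tt , i)) →
          ∀ n → D j (Ωz A n) ≈ v * up (suc j) (Ωz A) n
D-shift {A} v j Dv≈0 ps = ⋆U.θ-unique {α} zeroˡ (≈-trans (D-cong j (Ωz-0 A)) (≈-sym (zeroʳ v))) step
  where
  α F Y : Seq
  α = powerSums A
  F = Ωz A
  Y = up (suc j) F

  Dα : D j ∘ α ≋ λ n → v * (suc j · up (suc j) unit n)
  Dα zero    = ≈-sym (≈-trans (*-congˡ {v} (·-zero (suc j))) (zeroʳ v))
  Dα (suc i) = begin
    D j (α (suc i))                                  ≈⟨ D-cong j (ps i) ⟩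
    D j v * var (tt , i) + v * (suc j · δ j i)        ≈⟨ +-cong (≈-trans (*-congʳ Dv≈0) (zeroˡ _)) (*-congˡ (·-congʳ (suc j) (reflexive (≡.sym (up-unit j i))))) ⟩
    0Λ + v * (suc j · up j unit i)                    ≈⟨ +-identityˡ _ ⟩
    v * (suc j · up j unit i)                         ∎

  source : ∀ n → ((D j ∘ α) ⋆ F) n ≈ v * (suc j · Y n)
  source n = begin
    ((D j ∘ α) ⋆ F) n                                     ≈⟨ ⋆-cong {G = F} Dα (λ _ → ≈-refl) n ⟩
    ((λ k → v * (suc j · up (suc j) unit k)) ⋆ F) n       ≈⟨ ⋆-comm _ F n ⟩
    (F ⋆ (λ k → v * (suc j · up (suc j) unit k))) n       ≈⟨ ⋆-scaleʳ v F _ n ⟩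
    v * (F ⋆ (λ k → suc j · up (suc j) unit k)) n         ≈⟨ *-congˡ (⋆-·ʳ (suc j) F (up (suc j) unit) n) ⟩
    v * (suc j · (F ⋆ up (suc j) unit) n)                 ≈⟨ *-congˡ (·-congʳ (suc j) (⋆-up (suc j) F unit n)) ⟩
    v * (suc j · up (suc j) (F ⋆ unit) n)                 ≈⟨ *-congˡ (·-congʳ (suc j) (up-cong (suc j) (λ k → ≈-trans (⋆-comm F unit k) (⋆-identityˡ F k)) n)) ⟩
    v * (suc j · Y n)                                     ∎

  -- Differentiating the power sums gives a source term, and it equals what θ produces from the
  -- factor z^(j+1) of `Y`.
  step : ∀ n → (α ⋆ (D j ∘ F)) n ≈ (α ⋆ (λ k → v * Y k)) n → n · D j (F n) ≈ n · (v * Y n)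
  step n e = begin
    n · D j (F n)                                  ≈⟨ Linear.multiple (D-linear j) n (F n) ⟨
    D j (n · F n)                                  ≈⟨ D-cong j (θ-Ωz A n) ⟩
    D j ((α ⋆ F) n)                                ≈⟨ D-⋆ j α F n ⟩
    ((D j ∘ α) ⋆ F) n + (α ⋆ (D j ∘ F)) n          ≈⟨ +-cong (source n) (≈-trans e (⋆-scaleʳ v α Y n)) ⟩
    v * (suc j · Y n) + v * (α ⋆ Y) n              ≈⟨ distribˡ v _ _ ⟨
    v * (suc j · Y n + (α ⋆ Y) n)                  ≈⟨ *-congˡ (+-congˡ (≈-trans (⋆-up (suc j) α F n) (up-cong (suc j) (λ k → ≈-sym (θ-Ωz A k)) n))) ⟩
    v * (suc j · Y n + up (suc j) (θ F) n)         ≈⟨ *-congˡ (θ-up (suc j) F n) ⟨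
    v * (n · Y n)                                  ≈⟨ ·-*ʳ n v (Y n) ⟩
    n · (v * Y n)                                  ∎

-- hs n = h_n and es n = (−1)^n e_n

hs es : Seq
hs = Ωz X
es = Ωz (- X)

powerSums-X : ∀ i → powerSums X (suc i) ≈ 1Λ * var (tt , i)
powerSums-X i = ≈-trans (reflexive (≡.cong (λ k → var (tt , k)) (ℕₚ.+-identityʳ i))) (≈-sym (*-identityˡ _))

powerSums--X : ∀ i → powerSums (- X) (suc i) ≈ (- 1Λ) * var (tt , i)
powerSums--X i = ≈-trans (-‿cong (powerSums-X i)) (-‿distribˡ-* 1Λ _)

D-hs : ∀ j n → D j (hs n) ≈ up (suc j) hs n
D-hs j n = ≈-trans (D-shift 1Λ j ≈-refl powerSums-X n) (*-identityˡ _)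

D-es : ∀ j n → - D j (es n) ≈ up (suc j) es n
D-es j n = ≈-trans (-‿cong (D-shift (- 1Λ) j -0#≈0# powerSums--X n))
  (≈-trans (-‿distribˡ-* _ _) (≈-trans (*-congʳ (-‿involutive 1Λ)) (*-identityˡ _)))

powerSums--X-▷ : ∀ i P → powerSums (- X) (suc i) ▷ P ≈ - D i P
powerSums--X-▷ i P = -‿cong (reflexive (≡.cong (λ k → D k P) (ℕₚ.+-identityʳ i)))

noConstant--X : NoConstant (- X)
noConstant--X = noConstant-neg noConstant-var

module E = Translation (primitive-neg (primitive-var 0))

E-0 : ∀ P → es 0 ▷ P ≈ P
E-0 P = ≈-trans (▷-congˡ (Ωz-0 (- X)) P) (*-identityˡ P)

-- Ω[−uX]^⊥ h_m = h_m − u h_{m−1}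

E-h-series : ℕ → Seq
E-h-series n zero          = hs n
E-h-series n (suc zero)    = - ↑ hs n
E-h-series n (suc (suc _)) = 0Λ

E-h : ∀ n → (λ l → es l ▷ hs n) ≋ E-h-series n
E-h n = ▷U.θ-unique {powerSums (- X)} zeroˡ (E-0 (hs n)) λ l e → ≈-trans (θ-▷ (- X) (hs n) l) (≈-trans e (≈-sym (θ-series l)))
  where
  α y : Seq
  α = powerSums (- X)
  y = E-h-series n

  D-↑ : ∀ l n → D l (↑ hs n) ≈ ↑ (up (suc l) hs) n
  D-↑ l zero    = ≈-refl
  D-↑ l (suc n) = D-hs l n

  θ-series : ∀ l → θ y l ≈ (α ▷⋆.⋆ y) l
  θ-series zero = ≈-sym (zeroˡ _)
  θ-series (suc zero) = ≈-sym (begin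
    0Λ * y 1 + α 1 ▷ hs n    ≈⟨ +-cong (zeroˡ _) (≈-trans (powerSums--X-▷ 0 (hs n)) (-‿cong (D-hs 0 n))) ⟩
    0Λ + - ↑ hs n            ≈⟨ +-comm _ _ ⟩
    - ↑ hs n + 0Λ            ∎)
  -- Only two summands survive: one power sum acting on the coefficient of u and the next one acting
  -- on h_n. Both give h_{n-l-2}, with opposite signs.
  θ-series (suc (suc l)) = ≈-trans (·-zero (suc (suc l))) (≈-sym (begin
    (α ▷⋆.⋆ y) (suc (suc l))
      ≈⟨ ▷⋆.⋆-suc α y (suc l) ⟩
    (α ▷⋆.⋆ (y ∘ suc)) (suc l) + α (suc (suc l)) ▷ hs n
      ≈⟨ +-congʳ (▷⋆.⋆-suc α (y ∘ suc) l) ⟩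
    ((α ▷⋆.⋆ (y ∘ suc ∘ suc)) l + α (suc l) ▷ (- ↑ hs n)) + α (suc (suc l)) ▷ hs n
      ≈⟨ +-cong (+-cong (▷⋆.⋆-zero {α} (λ i _ → Biadditive.∙-zeroʳ ▷-biadditive (α i)) l)
           (≈-trans (powerSums--X-▷ l (- ↑ hs n)) (-‿cong (-‿cong (D-↑ l n)))))
           (≈-trans (powerSums--X-▷ (suc l) (hs n)) (-‿cong (D-hs (suc l) n))) ⟩
    (0Λ + - - up (suc (suc l)) hs n) + - up (suc (suc l)) hs n
      ≈⟨ solve 1 (λ x → (K 0ℤ :+ :- (:- x)) :+ :- x := K 0ℤ) ≈-refl _ ⟩
    0Λ ∎))

E-h-* : ∀ r l Q → es (suc l) ▷ (h r * Q) ≈ h r * (es (suc l) ▷ Q) + (- h (ℤ.pred r)) * (es l ▷ Q)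
E-h-* -[1+ n ] l Q = ≈-trans (Linear.cong (▷-linear (es (suc l))) (zeroˡ Q)) (≈-trans (Linear.zero-hom (▷-linear (es (suc l))))
  (solve 2 (λ a b → K 0ℤ := K 0ℤ :* a :+ (:- K 0ℤ) :* b) ≈-refl _ _))
E-h-* (+ n) l Q = begin
  es (suc l) ▷ (hs n * Q)                                        ≈⟨ E.▷-* (hs n) Q (suc l) ⟩
  ((λ k → es k ▷ hs n) ⋆ EQ) (suc l)                             ≈⟨ ⋆-cong {G = EQ} (E-h n) (λ _ → ≈-refl) (suc l) ⟩
  hs n * EQ (suc l) + ((E-h-series n ∘ suc) ⋆ EQ) l              ≈⟨ +-congˡ (head l) ⟩
  hs n * EQ (suc l) + - ↑ hs n * EQ l                            ≈⟨ +-congˡ (*-congʳ (-‿cong (↑-pred n))) ⟩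
  hs n * EQ (suc l) + - h (ℤ.pred (+ n)) * EQ l                  ∎
  where
  EQ : Seq
  EQ k = es k ▷ Q
  head : ∀ l → ((E-h-series n ∘ suc) ⋆ EQ) l ≈ - ↑ hs n * EQ l
  head zero    = ≈-refl
  head (suc l) = ≈-trans (+-congˡ (⋆-zero (λ _ _ → zeroˡ _) l)) (+-identityʳ _)
  ↑-pred : ∀ n → ↑ hs n ≈ h (ℤ.pred (+ n))
  ↑-pred zero    = ≈-refl
  ↑-pred (suc n) = ≈-refl

down : ℕ → Seq
down l       zero    = es l
down zero    (suc i) = 0Λ
down (suc l) (suc i) = down l i

-- Ω[−uX]^⊥ Ω[−zX] = Ω[−zX] / (1 − uz)
E-e : ∀ l → (λ i → es i ▷ es l) ≋ down l
E-e l = ▷U.θ-unique {powerSums (- X)} zeroˡ (E-0 (es l)) λ i e → ≈-trans (θ-▷ (- X) (es l) i) (≈-trans e (≈-sym (θ-down i)))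
  where
  α : Seq
  α = powerSums (- X)

  up-down : ∀ l k → up k es l ≈ down l k
  up-down l       zero    = ≈-refl
  up-down zero    (suc k) = ≈-refl
  up-down (suc l) (suc k) = up-down l k

  D-down : ∀ l j m → - D j (down l m) ≈ down l (m ℕ.+ suc j)
  D-down l       j zero    = ≈-trans (D-es j l) (up-down l (suc j))
  D-down zero    j (suc m) = -0#≈0#
  D-down (suc l) j (suc m) = D-down l j m

  equal-terms : ∀ n {β y c} → (∀ k m → k ℕ.+ m ≡ n → β k ▷ y m ≈ c) → (β ▷⋆.⋆ y) n ≈ suc n · c
  equal-terms zero    e = ≈-trans (e 0 0 ≡.refl) (≈-sym (+-identityʳ _))
  equal-terms (suc n) {β} e = +-cong (e 0 (suc n) ≡.refl) (equal-terms n {β ∘ suc} λ k m eq → e (suc k) m (≡.cong suc eq))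

  θ-down : ∀ i → θ (down l) i ≈ (α ▷⋆.⋆ down l) i
  θ-down zero    = ≈-sym (zeroˡ _)
  -- All `suc i` summands with k + m = i are equal to `down l (suc i)`, which accounts for the
  -- factor coming from θ.
  θ-down (suc i) = ≈-sym (≈-trans (+-cong (zeroˡ _) (equal-terms i {α ∘ suc} λ k m eq →
    ≈-trans (powerSums--X-▷ k (down l m)) (≈-trans (D-down l k m)
      (reflexive (≡.cong (down l) (≡.trans (ℕₚ.+-suc m k) (≡.cong suc (≡.trans (ℕₚ.+-comm m k) eq))))))))
    (+-identityˡ _))

-- Ω[-uX]^⊥ (Ω[-zX] Q) is Ω[-zX] Ω[-uX]^⊥ Q divided by 1 - uz. Clearing this denominator gives a
-- two-term recursion in place of a geometric sum.
E-e-* : ∀ l i Q → es (suc i) ▷ (es (suc l) * Q) ≈ es (suc l) * (es (suc i) ▷ Q) + es i ▷ (es l * Q)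
E-e-* l i Q = begin
  es (suc i) ▷ (es (suc l) * Q)                          ≈⟨ E.▷-* (es (suc l)) Q (suc i) ⟩
  ((λ k → es k ▷ es (suc l)) ⋆ EQ) (suc i)               ≈⟨ ⋆-cong {G = EQ} (E-e (suc l)) (λ _ → ≈-refl) (suc i) ⟩
  es (suc l) * EQ (suc i) + (down l ⋆ EQ) i              ≈⟨ +-congˡ (⋆-cong {G = EQ} (E-e l) (λ _ → ≈-refl) i) ⟨
  es (suc l) * EQ (suc i) + ((λ k → es k ▷ es l) ⋆ EQ) i ≈⟨ +-congˡ (E.▷-* (es l) Q i) ⟨
  es (suc l) * EQ (suc i) + es i ▷ (es l * Q)            ∎
  where
  EQ : Seq
  EQ k = es k ▷ Q

-- Bernstein's operators, with ▷ for ^⊥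

Bern : ℤ → Λ → Λ
Bern r = total (λ n P → h (r ℤ.+ + n) * (es n ▷ P))

e-low : ∀ l {N P} → Low N P → Low N (es l ▷ P)
e-low l {N} low = low-mono (ℕₚ.m∸n≤m N l) (Lowers.low-▷ (Ωz-lowers noConstant--X l) N low)

Bern-finite : ∀ r → LocallyFinite (λ n P → h (r ℤ.+ + n) * (es n ▷ P))
Bern-finite r N P low n N≤n = ≈-trans (*-congˡ (▷-finite noConstant--X N P low n N≤n)) (zeroʳ _)

Bern-at : ∀ r N {P} → Low N P → Bern r P ≈ Σ< N (λ n → h (r ℤ.+ + n) * (es n ▷ P))
Bern-at r = total-at (Bern-finite r)

Bern-linear : ∀ r → Linear (Bern r)
Bern-linear r = total-linear (Bern-finite r) λ n → record
  { cong  = λ e → *-congˡ (Linear.cong (▷-linear (es n)) e)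
  ; add   = λ P Q → ≈-trans (*-congˡ (Linear.add (▷-linear (es n)) P Q)) (distribˡ _ _ _)
  ; scale = λ c P → ≈-trans (*-congˡ (Linear.scale (▷-linear (es n)) c P))
      (solve 3 (λ a b x → a :* (b :* x) := b :* (a :* x)) ≈-refl _ _ _)
  }

h-≡ : ∀ {i j} → i ≡ j → h i ≈ h j
h-≡ ≡.refl = ≈-refl

h-suc : ∀ r n → h (r ℤ.+ + suc n) ≈ h (ℤ.suc r ℤ.+ + n)
h-suc r n = h-≡ (≡.trans (≡.cong (λ z → r ℤ.+ z) (ℤₚ.+-comm (+ 1) (+ n))) (≡.trans (≡.sym (ℤₚ.+-assoc r (+ n) (+ 1)))
  (≡.trans (ℤₚ.+-comm (r ℤ.+ + n) (+ 1)) (≡.sym (ℤₚ.+-assoc (+ 1) r (+ n))))))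

Σ<-minus : ∀ N F G → Σ< N (λ n → F n + - G n) ≈ Σ< N F + - Σ< N G
Σ<-minus N F G = ≈-trans (Σ<-+ N F (λ n → - G n))
  (+-congˡ (≈-sym (Σ<-hom (λ x → - x) -0#≈0# (λ x y → ≈-sym (-‿+-comm x y)) N G)))

-- Ω[-uX]^⊥ commutes with the skewing part of the generating function Σ B_r z^r and multiplies Ω[zX]
-- by 1 - uz.
E-Bern : ∀ l r P → es (suc l) ▷ Bern r P ≈ Bern r (es (suc l) ▷ P) + - Bern (ℤ.pred r) (es l ▷ P)
E-Bern l r P = begin
  es (suc l) ▷ Bern r P
    ≈⟨ Linear.Σ<-linear (▷-linear (es (suc l))) N (λ n → h (r ℤ.+ + n) * (es n ▷ P)) ⟩
  Σ< N (λ n → es (suc l) ▷ (h (r ℤ.+ + n) * (es n ▷ P)))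
    ≈⟨ Σ<-cong N term ⟩
  Σ< N (λ n → h (r ℤ.+ + n) * (es n ▷ es (suc l) ▷ P) + - (h (ℤ.pred r ℤ.+ + n) * (es n ▷ es l ▷ P)))
    ≈⟨ Σ<-minus N (λ n → h (r ℤ.+ + n) * (es n ▷ es (suc l) ▷ P)) (λ n → h (ℤ.pred r ℤ.+ + n) * (es n ▷ es l ▷ P)) ⟩
  Σ< N (λ n → h (r ℤ.+ + n) * (es n ▷ es (suc l) ▷ P)) + - Σ< N (λ n → h (ℤ.pred r ℤ.+ + n) * (es n ▷ es l ▷ P))
    ≈⟨ +-cong (Bern-at r N (e-low (suc l) {N} (low-deg P))) (-‿cong (Bern-at (ℤ.pred r) N (e-low l {N} (low-deg P)))) ⟨
  Bern r (es (suc l) ▷ P) + - Bern (ℤ.pred r) (es l ▷ P) ∎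
  where
  N : ℕ
  N = suc (deg P)
  term : ∀ n → es (suc l) ▷ (h (r ℤ.+ + n) * (es n ▷ P))
             ≈ h (r ℤ.+ + n) * (es n ▷ es (suc l) ▷ P) + - (h (ℤ.pred r ℤ.+ + n) * (es n ▷ es l ▷ P))
  term n = begin
    es (suc l) ▷ (h (r ℤ.+ + n) * (es n ▷ P))
      ≈⟨ E-h-* (r ℤ.+ + n) l (es n ▷ P) ⟩
    h (r ℤ.+ + n) * (es (suc l) ▷ es n ▷ P) + - h (ℤ.pred (r ℤ.+ + n)) * (es l ▷ es n ▷ P)
      ≈⟨ +-cong (*-congˡ (▷-comm (es (suc l)) (es n) P)) (*-cong (-‿cong (h-≡ (≡.sym (ℤₚ.+-assoc ℤ.-1ℤ r (+ n))))) (▷-comm (es l) (es n) P)) ⟩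
    h (r ℤ.+ + n) * (es n ▷ es (suc l) ▷ P) + - h (ℤ.pred r ℤ.+ + n) * (es n ▷ es l ▷ P)
      ≈⟨ +-congˡ (-‿distribˡ-* _ _) ⟨
    h (r ℤ.+ + n) * (es n ▷ es (suc l) ▷ P) + - (h (ℤ.pred r ℤ.+ + n) * (es n ▷ es l ▷ P)) ∎

-- Moving multiplication by Ω[-uX] to the left through the skewing part of Σ B_r z^r divides by 1 -
-- u/z; this is the relation with the denominator cleared.
e-Bern : ∀ l r P → es (suc l) * Bern r P ≈ Bern r (es (suc l) * P) + - Bern (ℤ.suc r) (es l * P)
e-Bern l r P = ≈-sym (begin
  Bern r (es (suc l) * P) + - Bern (ℤ.suc r) (es l * P)
    -- The first sum is one term longer, since its terms from index 1 on produce, by `E-e-*`, the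
    -- terms of the second sum from index 0 on.
    ≈⟨ +-cong (Bern-at r (suc M) low₁) (-‿cong (Bern-at (ℤ.suc r) M low₂)) ⟩
  (h (r ℤ.+ + 0) * (es 0 ▷ (es (suc l) * P)) + Σ< M (λ n → h (r ℤ.+ + suc n) * (es (suc n) ▷ (es (suc l) * P))))
    + - Σ< M (λ n → h (ℤ.suc r ℤ.+ + n) * (es n ▷ (es l * P)))
    ≈⟨ +-congʳ (+-cong head (≈-trans (Σ<-cong M term) (Σ<-+ M (λ n → es (suc l) * (h (r ℤ.+ + suc n) * (es (suc n) ▷ P)))
         (λ n → h (ℤ.suc r ℤ.+ + n) * (es n ▷ (es l * P)))))) ⟩
  (es (suc l) * (h (r ℤ.+ + 0) * (es 0 ▷ P)) + (Σ< M (λ n → es (suc l) * (h (r ℤ.+ + suc n) * (es (suc n) ▷ P)))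
      + Σ< M (λ n → h (ℤ.suc r ℤ.+ + n) * (es n ▷ (es l * P)))))
    + - Σ< M (λ n → h (ℤ.suc r ℤ.+ + n) * (es n ▷ (es l * P)))
    ≈⟨ solve 3 (λ a b c → (a :+ (b :+ c)) :+ :- c := a :+ b) ≈-refl _ _ _ ⟩
  es (suc l) * (h (r ℤ.+ + 0) * (es 0 ▷ P)) + Σ< M (λ n → es (suc l) * (h (r ℤ.+ + suc n) * (es (suc n) ▷ P)))
    ≈⟨ Σ<-hom (es (suc l) *_) (zeroʳ _) (distribˡ _) (suc M) (λ n → h (r ℤ.+ + n) * (es n ▷ P)) ⟨
  es (suc l) * Σ< (suc M) (λ n → h (r ℤ.+ + n) * (es n ▷ P))
    ≈⟨ *-congˡ (Bern-at r (suc M) low₀) ⟨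
  es (suc l) * Bern r P ∎)
  where
  d₁ d₂ M : ℕ
  d₁ = deg (es (suc l) * P)
  d₂ = deg (es l * P)
  M = suc (d₁ ℕ.+ d₂)
  low₁ : Low (suc M) (es (suc l) * P)
  low₁ = low-mono (s≤s (ℕₚ.m≤n⇒m≤1+n (ℕₚ.m≤m+n d₁ d₂))) (low-deg (es (suc l) * P))
  low₂ : Low M (es l * P)
  low₂ = low-mono (s≤s (ℕₚ.m≤n+m d₂ d₁)) (low-deg (es l * P))
  low₀ : Low (suc M) P
  low₀ = low-mono (s≤s (ℕₚ.m≤n⇒m≤1+n (ℕₚ.≤-trans (ℕₚ.m≤n+m (deg P) (deg (es (suc l)))) (ℕₚ.m≤m+n d₁ d₂)))) (low-deg P)

  head : h (r ℤ.+ + 0) * (es 0 ▷ (es (suc l) * P)) ≈ es (suc l) * (h (r ℤ.+ + 0) * (es 0 ▷ P))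
  head = ≈-trans (*-congˡ (≈-trans (E-0 _) (*-congˡ (≈-sym (E-0 P)))))
    (solve 3 (λ a b c → a :* (b :* c) := b :* (a :* c)) ≈-refl _ _ _)

  term : ∀ n → h (r ℤ.+ + suc n) * (es (suc n) ▷ (es (suc l) * P))
             ≈ es (suc l) * (h (r ℤ.+ + suc n) * (es (suc n) ▷ P)) + h (ℤ.suc r ℤ.+ + n) * (es n ▷ (es l * P))
  term n = begin
    h (r ℤ.+ + suc n) * (es (suc n) ▷ (es (suc l) * P))
      ≈⟨ *-congˡ (E-e-* l n P) ⟩
    h (r ℤ.+ + suc n) * (es (suc l) * (es (suc n) ▷ P) + es n ▷ (es l * P))
      ≈⟨ solve 4 (λ a b c d → a :* (b :* c :+ d) := b :* (a :* c) :+ a :* d) ≈-refl _ _ _ _ ⟩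
    es (suc l) * (h (r ℤ.+ + suc n) * (es (suc n) ▷ P)) + h (r ℤ.+ + suc n) * (es n ▷ (es l * P))
      ≈⟨ +-congˡ (*-congʳ (h-suc r n)) ⟩
    es (suc l) * (h (r ℤ.+ + suc n) * (es (suc n) ▷ P)) + h (ℤ.suc r ℤ.+ + n) * (es n ▷ (es l * P)) ∎

-- Fully expanded, both sides are the same double sum of h_{a+m} h_{r+n} with commuting skewing
-- operators.
Bern-swap : ∀ r N a {P} → Low N P →
  Σ< N (λ m → h (a ℤ.+ + m) * Bern r (es m ▷ P)) ≈ Σ< N (λ m → h (r ℤ.+ + m) * Bern a (es m ▷ P))
Bern-swap r N a {P} low = begin
  Σ< N (λ m → h (a ℤ.+ + m) * Bern r (es m ▷ P))
    ≈⟨ Σ<-cong N (expand a r) ⟩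
  Σ< N (λ m → Σ< N (λ n → h (a ℤ.+ + m) * (h (r ℤ.+ + n) * (es n ▷ es m ▷ P))))
    ≈⟨ Σ<-swap N N (λ m n → h (a ℤ.+ + m) * (h (r ℤ.+ + n) * (es n ▷ es m ▷ P))) ⟩
  Σ< N (λ n → Σ< N (λ m → h (a ℤ.+ + m) * (h (r ℤ.+ + n) * (es n ▷ es m ▷ P))))
    ≈⟨ Σ<-cong N (λ n → Σ<-cong N λ m → ≈-trans
         (solve 3 (λ a b c → a :* (b :* c) := b :* (a :* c)) ≈-refl (h (a ℤ.+ + m)) (h (r ℤ.+ + n)) _)
         (*-congˡ (*-congˡ (▷-comm (es n) (es m) P)))) ⟩
  Σ< N (λ n → Σ< N (λ m → h (r ℤ.+ + n) * (h (a ℤ.+ + m) * (es m ▷ es n ▷ P))))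
    ≈⟨ Σ<-cong N (expand r a) ⟨
  Σ< N (λ m → h (r ℤ.+ + m) * Bern a (es m ▷ P)) ∎
  where
  expand : ∀ a r m → h (a ℤ.+ + m) * Bern r (es m ▷ P) ≈ Σ< N (λ n → h (a ℤ.+ + m) * (h (r ℤ.+ + n) * (es n ▷ es m ▷ P)))
  expand a r m = ≈-trans (*-congˡ (Bern-at r N (e-low m {N} low)))
    (Σ<-hom (h (a ℤ.+ + m) *_) (zeroʳ _) (distribˡ _) N (λ n → h (r ℤ.+ + n) * (es n ▷ es m ▷ P)))

-- Pulling each `es m ▷_` through the inner operator by `E-Bern` gives a difference of two sums,
-- which `Bern-swap` identifies because the indices differ by exactly one.
Bern-Bern : ∀ r P → Bern r (Bern (ℤ.suc r) P) ≈ 0Λ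
Bern-Bern r P = begin
  Bern r (Bern r⁺ P)
    ≈⟨ Bern-at r (suc N) low-B ⟩
  h (r ℤ.+ + 0) * (es 0 ▷ Bern r⁺ P) + Σ< N (λ m → h (r ℤ.+ + suc m) * (es (suc m) ▷ Bern r⁺ P))
    ≈⟨ +-cong (*-congˡ (≈-trans (E-0 _) (≈-sym (Linear.cong (Bern-linear r⁺) (E-0 P))))) (≈-trans (Σ<-cong N term)
        (Σ<-minus N (λ m → h (r ℤ.+ + suc m) * Bern r⁺ (es (suc m) ▷ P)) (λ m → h (r⁺ ℤ.+ + m) * Bern r (es m ▷ P)))) ⟩
  h (r ℤ.+ + 0) * Bern r⁺ (es 0 ▷ P) + (Σ< N (λ m → h (r ℤ.+ + suc m) * Bern r⁺ (es (suc m) ▷ P))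
    + - Σ< N (λ m → h (r⁺ ℤ.+ + m) * Bern r (es m ▷ P)))
    ≈⟨ +-assoc _ _ _ ⟨
  Σ< (suc N) (λ m → h (r ℤ.+ + m) * Bern r⁺ (es m ▷ P)) + - Σ< N (λ m → h (r⁺ ℤ.+ + m) * Bern r (es m ▷ P))
    ≈⟨ +-cong (Σ<-extend (λ m → h (r ℤ.+ + m) * Bern r⁺ (es m ▷ P)) (ℕₚ.n≤1+n N) vanish) (-‿cong (Bern-swap r N r⁺ low)) ⟩
  Σ< N (λ m → h (r ℤ.+ + m) * Bern r⁺ (es m ▷ P)) + - Σ< N (λ m → h (r ℤ.+ + m) * Bern r⁺ (es m ▷ P))
    ≈⟨ -‿inverseʳ _ ⟩
  0Λ ∎
  where
  r⁺ : ℤ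
  r⁺ = ℤ.suc r
  N : ℕ
  N = suc (deg P ℕ.+ deg (Bern r⁺ P))
  low : Low N P
  low = low-mono (s≤s (ℕₚ.m≤m+n (deg P) _)) (low-deg P)
  low-B : Low (suc N) (Bern r⁺ P)
  low-B = low-mono (s≤s (ℕₚ.m≤n⇒m≤1+n (ℕₚ.m≤n+m _ (deg P)))) (low-deg (Bern r⁺ P))
  vanish : ∀ m → N ℕ.≤ m → h (r ℤ.+ + m) * Bern r⁺ (es m ▷ P) ≈ 0Λ
  vanish m N≤m = ≈-trans (*-congˡ (≈-trans (Linear.cong (Bern-linear r⁺) (▷-finite noConstant--X N P low m N≤m))
    (Linear.zero-hom (Bern-linear r⁺)))) (zeroʳ _)
  term : ∀ m → h (r ℤ.+ + suc m) * (es (suc m) ▷ Bern r⁺ P)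
             ≈ h (r ℤ.+ + suc m) * Bern r⁺ (es (suc m) ▷ P) + - (h (r⁺ ℤ.+ + m) * Bern r (es m ▷ P))
  term m = begin
    h (r ℤ.+ + suc m) * (es (suc m) ▷ Bern r⁺ P)
      ≈⟨ *-congˡ (E-Bern m r⁺ P) ⟩
    h (r ℤ.+ + suc m) * (Bern r⁺ (es (suc m) ▷ P) + - Bern (ℤ.pred r⁺) (es m ▷ P))
      ≈⟨ *-congˡ (+-congˡ (-‿cong (reflexive (≡.cong (λ k → Bern k (es m ▷ P)) (ℤₚ.pred-suc r))))) ⟩
    h (r ℤ.+ + suc m) * (Bern r⁺ (es (suc m) ▷ P) + - Bern r (es m ▷ P))
      ≈⟨ solve 3 (λ a b c → a :* (b :+ :- c) := a :* b :+ :- (a :* c)) ≈-refl _ _ _ ⟩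
    h (r ℤ.+ + suc m) * Bern r⁺ (es (suc m) ▷ P) + - (h (r ℤ.+ + suc m) * Bern r (es m ▷ P))
      ≈⟨ +-congˡ (-‿cong (*-congʳ (h-suc r m))) ⟩
    h (r ℤ.+ + suc m) * Bern r⁺ (es (suc m) ▷ P) + - (h (r⁺ ℤ.+ + m) * Bern r (es m ▷ P)) ∎

Bern-1 : ∀ r → Bern r 1Λ ≈ h r
Bern-1 r = ≈-trans (+-identityʳ _) (≈-trans (*-cong (h-≡ (ℤₚ.+-identityʳ r)) (E-0 1Λ)) (*-identityʳ _))

Bern-0-1 : Bern 0ℤ 1Λ ≈ 1Λ
Bern-0-1 = ≈-trans (Bern-1 0ℤ) (Ωz-0 X)

-- Removing columns from e_{l+1} leaves smaller e's, so the sum becomes a positive coefficient of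
-- Ω[zX] Ω[-zX] = 1.
Bern-0-e : ∀ l → Bern 0ℤ (es (suc l)) ≈ 0Λ
Bern-0-e l = begin
  Bern 0ℤ (es (suc l))                                      ≈⟨ Bern-at 0ℤ (suc (suc l) ℕ.+ N) (low-mono (ℕₚ.m≤n+m N (suc (suc l))) (low-deg (es (suc l)))) ⟩
  Σ< (suc (suc l) ℕ.+ N) (λ n → hs n * (es n ▷ es (suc l))) ≈⟨ Σ<-cong (suc (suc l) ℕ.+ N) (λ n → *-congˡ {hs n} (E-e (suc l) n)) ⟩
  Σ< (suc (suc l) ℕ.+ N) (λ n → hs n * down (suc l) n)      ≈⟨ Σ<-extend (λ n → hs n * down (suc l) n) (ℕₚ.m≤m+n (suc (suc l)) N) (λ n l<n → ≈-trans (*-congˡ (down-> (suc l) n l<n)) (zeroʳ _)) ⟩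
  Σ< (suc (suc l)) (λ n → hs n * down (suc l) n)            ≈⟨ convolve (suc l) hs ⟩
  (hs ⋆ es) (suc l)                                         ≈⟨ Ωz-inverse X (suc l) ⟩
  0Λ                                                        ∎
  where
  N : ℕ
  N = suc (deg (es (suc l)))
  down-> : ∀ l n → l ℕ.< n → down l n ≈ 0Λ
  down-> zero    (suc n) _         = ≈-refl
  down-> (suc l) (suc n) (s≤s l<n) = down-> l n l<n
  convolve : ∀ l F → Σ< (suc l) (λ n → F n * down l n) ≈ (F ⋆ es) l
  convolve zero    F = +-identityʳ _
  convolve (suc l) F = +-congˡ (convolve l (F ∘ suc))

-- Jacobi-Trudi determinants through Bernstein's operators

-- The Schur function extended to all integer sequences; sequences that are not partitions arise
-- when vertical strips are added or removed.
S : List ℤ → Λ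
S []       = 1Λ
S (a ∷ as) = Bern a (S as)

-- The Jacobi–Trudi determinant, the rows being numbered from k.

rows : ℕ → List ℤ → List (ℕ → Λ)
rows k []       = []
rows k (a ∷ as) = (λ c → h (a ℤ.- + k ℤ.+ + c)) ∷ rows (suc k) as

open Determinants Λ-ring using (Det; alt; signed; signed-*ʳ; Det-cong)
module CE = ColumnExpansion Λ-ring

E-hom : Λ → Seq
E-hom P l = es l ▷ P

E-hom-h : ∀ x y → ℤ.pred x ≡ y → E-hom (h x) ≋ CE._⊝u_ (CE.κ (h x)) (CE.κ (h y))
E-hom-h -[1+ n ] y ≡.refl l = ≈-trans (Linear.zero-hom (▷-linear (es l))) (≈-sym (zero-difference l))
  where
  zero-difference : ∀ l → (CE.κ 0Λ CE.⊝u CE.κ 0Λ) l ≈ 0Λ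
  zero-difference zero          = -‿inverseʳ 0Λ
  zero-difference (suc zero)    = -‿inverseʳ 0Λ
  zero-difference (suc (suc l)) = -‿inverseʳ 0Λ
E-hom-h (+ n) y ≡.refl l = ≈-trans (E-h n l) (series n l)
  where
  series : ∀ n l → E-h-series n l ≈ (CE.κ (hs n) CE.⊝u CE.κ (h (ℤ.pred (+ n)))) l
  series n       zero          = ≈-sym (≈-trans (+-congˡ -0#≈0#) (+-identityʳ _))
  series zero    (suc zero)    = ≈-sym (+-identityˡ _)
  series (suc n) (suc zero)    = ≈-sym (+-identityˡ _)
  series n       (suc (suc l)) = ≈-sym (-‿inverseʳ 0Λ)

E-1 : ∀ l → es l ▷ 1Λ ≈ unit l
E-1 zero    = E-0 1Λ
E-1 (suc l) = ▷-finite noConstant--X 1 1Λ (low-deg 1Λ) (suc l) (s≤s z≤n)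

pred-row : ∀ a k c → ℤ.pred (a ℤ.- + k ℤ.+ + c) ≡ a ℤ.- + suc k ℤ.+ + c
-- The number -1 enters as the variable `m`; with it, `(- m) + k` computes to `+ suc k`.
pred-row a k c = ℤS.solve 4 (λ m a k c → m ℤS.:+ ((a ℤS.:- k) ℤS.:+ c) ℤS.:= (a ℤS.:- ((ℤS.:- m) ℤS.:+ k)) ℤS.:+ c) ≡.refl ℤ.-1ℤ a (+ k) (+ c)
  where module ℤS = ℤSolver.+-*-Solver

row-suc : ∀ a k c → a ℤ.- + k ℤ.+ + c ≡ a ℤ.- + suc k ℤ.+ + suc c
row-suc a k c = ℤS.solve 4 (λ e a k c → (a ℤS.:- k) ℤS.:+ c ℤS.:= (a ℤS.:- (e ℤS.:+ k)) ℤS.:+ (e ℤS.:+ c)) ≡.refl (+ 1) a (+ k) (+ c)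
  where module ℤS = ℤSolver.+-*-Solver

module EDet = CE.Expansion E-hom (λ l → Linear.zero-hom (▷-linear (es l))) E-1
  (λ P Q l → Linear.add (▷-linear (es l)) P Q) E.▷-* (λ P l → Linear.neg (▷-linear (es l)) P)

rows-next : ∀ k as → Pointwise EDet.Next (rows k as) (rows (suc k) as)
rows-next k []       = []
rows-next k (a ∷ as) = (λ c → h-≡ (row-suc a k c) , E-hom-h (a ℤ.- + k ℤ.+ + c) (a ℤ.- + suc k ℤ.+ + c) (pred-row a k c)) ∷ rows-next (suc k) as

-- In the expansion along the first row, the minor without column l is, up to the sign of the
-- expansion, `es l ▷_` of the Jacobi-Trudi determinant of the remaining rows. The expansion is thus
-- Bernstein's operator applied to that smaller determinant.
Jacobi–Trudi : ∀ as → Det (rows 0 as) (window 0 (length as)) ≈ S as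
Jacobi–Trudi []       = ≈-refl
Jacobi–Trudi (a ∷ as) = begin
  alt (λ c r → h (a ℤ.- + 0 ℤ.+ + c) * Det (rows 1 as) r) (window 0 (suc n))
    ≈⟨ alt-window Λ-ring (λ c r → h (a ℤ.- + 0 ℤ.+ + c) * Det (rows 1 as) r) 0 n ⟩
  Σ< (suc n) (λ l → signed l (h (a ℤ.- + 0 ℤ.+ + l) * Det (rows 1 as) (skip 0 n l)))
    ≈⟨ Σ<-cong-< (suc n) term ⟩
  Σ< (suc n) F
    ≈⟨ Σ<-extend F (ℕₚ.m≤m+n (suc n) N) beyond ⟨
  Σ< (suc n ℕ.+ N) F
    ≈⟨ Bern-at a (suc n ℕ.+ N) (low-mono (ℕₚ.m≤n+m N (suc n)) (low-deg jt)) ⟨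
  Bern a jt
    ≈⟨ Linear.cong (Bern-linear a) (Jacobi–Trudi as) ⟩
  Bern a (S as) ∎
  where
  n N : ℕ
  n = length as
  jt : Λ
  jt = Det (rows 0 as) (window 0 n)
  N = suc (deg jt)
  F : Seq
  F l = h (a ℤ.+ + l) * (es l ▷ jt)

  term : ∀ l → l ℕ.< suc n → signed l (h (a ℤ.- + 0 ℤ.+ + l) * Det (rows 1 as) (skip 0 n l)) ≈ F l
  term l (s≤s l≤n) = ≈-trans (signed-*ʳ l _ _) (*-cong (h-≡ (≡.cong (ℤ._+ + l) (ℤₚ.+-identityʳ a)))
    (≈-sym (EDet.σ-Det-≤ (rows-next 0 as) n l l≤n)))

  -- A determinant with n columns, each linear in u, has no coefficient beyond u^n.
  beyond : ∀ l → suc n ℕ.≤ l → F l ≈ 0Λ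
  beyond l n<l = ≈-trans (*-congˡ (EDet.σ-Det-> (rows-next 0 as) n l n<l)) (zeroʳ _)

-- The signs in det are local to its definition, hence this detour.
det-suc : ∀ n (M : Fin (suc n) → Fin (suc n) → Λ) →
  let minor j = M Fin.zero j * det n (λ i k → M (Fin.suc i) (punchIn j k)) in
  Σ[ sg ∈ (Fin n → Λ) ] det (suc n) M ≡ 1Λ * minor Fin.zero + sum (λ j → (- sg j) * minor (Fin.suc j))
det-suc n M = _ , ≡.refl

det-sign : ∀ n M (j : Fin n) → proj₁ (det-suc n M) j ≡ signed (toℕ j) 1Λ
-- With `toℕ j` generalised to a variable, unification identifies the implicit `sg` with the sign
-- function hidden in `det`, whose two equations hold by computation.
det-sign n M j with alternates {_} ≡.refl (λ _ → ≡.refl) | toℕ j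
  where
  alternates : ∀ {sg : ℕ → Λ} → sg 0 ≡ 1Λ → (∀ k → sg (suc k) ≡ - sg k) → ∀ k → sg k ≡ signed k 1Λ
  alternates e₀ e zero    = e₀
  alternates e₀ e (suc k) = ≡.trans (e k) (≡.cong (λ x → - x) (alternates e₀ e k))
... | sign≡ | k = sign≡ k

det≈Det : ∀ n (Φ : Fin n → ℕ → Λ) (c : Fin n → ℕ) →
          det n (λ i k → Φ i (c k)) ≈ Det (tabulate Φ) (tabulate c)
det≈Det zero    Φ c = ≈-refl
det≈Det (suc n) Φ c = begin
  det (suc n) M
    ≡⟨ proj₂ (det-suc n M) ⟩
  1Λ * minor Fin.zero + sum (λ j → (- proj₁ (det-suc n M) j) * minor (Fin.suc j))
    ≈⟨ +-cong (*-identityˡ _) (sum-cong-≋ λ j → ≈-trans (*-congʳ (-‿cong (reflexive (det-sign n M j)))) (sign-* (suc (toℕ j)) (minor (Fin.suc j)))) ⟩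
  sum (λ j → signed (toℕ j) (minor j))
    ≈⟨ alternating (λ x r → Φ Fin.zero x * Det (tabulate (Φ ∘ Fin.suc)) r) c (λ j → *-congˡ (det≈Det n (Φ ∘ Fin.suc) (c ∘ punchIn j))) ⟩
  Det (tabulate Φ) (tabulate c) ∎
  where
  M : Fin (suc n) → Fin (suc n) → Λ
  M i k = Φ i (c k)
  minor : Fin (suc n) → Λ
  minor j = M Fin.zero j * det n (λ i k → M (Fin.suc i) (punchIn j k))

  sign-* : ∀ l x → signed l 1Λ * x ≈ signed l x
  sign-* zero    x = *-identityˡ x
  sign-* (suc l) x = ≈-trans (≈-sym (-‿distribˡ-* _ x)) (-‿cong (sign-* l x))

  alternating : ∀ {m} (g : ℕ → List ℕ → Λ) (c : Fin (suc m) → ℕ) {G : Fin (suc m) → Λ} →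
                (∀ j → G j ≈ g (c j) (tabulate (c ∘ punchIn j))) →
                sum (λ j → signed (toℕ j) (G j)) ≈ alt g (tabulate c)
  alternating {zero}  g c e = +-cong (e Fin.zero) (≈-sym -0#≈0#)
  alternating {suc m} g c {G} e = +-cong (e Fin.zero) (≈-trans (neg-sum (λ j → signed (toℕ j) (G (Fin.suc j))))
    (-‿cong (alternating (λ x r → g x (c Fin.zero ∷ r)) (c ∘ Fin.suc) (e ∘ Fin.suc))))
    where
    neg-sum : ∀ {m} (F : Fin m → Λ) → sum (λ j → - F j) ≈ - sum F
    neg-sum {zero}  F = ≈-sym -0#≈0#
    neg-sum {suc m} F = ≈-trans (+-congˡ (neg-sum (F ∘ Fin.suc))) (-‿+-comm _ _)

s≈S : ∀ μ → s μ ≈ S (map +_ (parts μ))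
s≈S μ = ≈-trans (det≈Det (length ps) (λ i c → h (+ lookup ps i ℤ.- + toℕ i ℤ.+ + c)) toℕ) (≈-trans (reflexive (≡.cong (Det (tabulate (λ i c → h (+ lookup ps i ℤ.- + toℕ i ℤ.+ + c)))) (tabulate-toℕ 0 (length ps))))
  (≈-trans (Det-cong (row-≈ 0 ps λ _ _ → ≈-refl) (window 0 (length ps)))
  (≈-trans (reflexive (≡.cong (λ n → Det (rows 0 (map +_ ps)) (window 0 n)) (≡.sym (length-map +_ ps))))
    (Jacobi–Trudi (map +_ ps)))))
  where
  ps : List ℕ
  ps = parts μ

  tabulate-toℕ : ∀ x n → tabulate {n = n} (λ j → x ℕ.+ toℕ j) ≡ window x n
  tabulate-toℕ x zero    = ≡.refl
  tabulate-toℕ x (suc n) = ≡.cong₂ _∷_ (ℕₚ.+-identityʳ x)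
    (≡.trans (tabulate-cong (λ j → ℕₚ.+-suc x (toℕ j))) (tabulate-toℕ (suc x) n))

  row-≈ : ∀ k ps {Φ : Fin (length ps) → ℕ → Λ} →
          (∀ i c → Φ i c ≈ h (+ lookup ps i ℤ.- + (k ℕ.+ toℕ i) ℤ.+ + c)) →
          Pointwise (λ φ ψ → ∀ c → φ c ≈ ψ c) (tabulate Φ) (rows k (map +_ ps))
  row-≈ k []       e = []
  row-≈ k (p ∷ ps) e =
    (λ c → ≈-trans (e Fin.zero c) (h-≡ (≡.cong (λ m → + p ℤ.- + m ℤ.+ + c) (ℕₚ.+-identityʳ k))))
    ∷ row-≈ (suc k) ps (λ i c → ≈-trans (e (Fin.suc i) c)
        (h-≡ (≡.cong (λ m → + lookup ps i ℤ.- + m ℤ.+ + c) (ℕₚ.+-suc k (toℕ i)))))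

open Shifts Λ-ring using (shifts; shifts-cong; shifts-0; shifts->; shifts-closed)

-- Straightening and the orthonormal basis

shifts-linear : ∀ {T} → Linear T → ∀ step l α F → T (shifts step l α F) ≈ shifts step l α (T ∘ F)
shifts-linear {T} L = shifts-hom Λ-ring Λ-ring T zero-hom add neg
  where open Linear L

E-S : ∀ l α → es l ▷ S α ≈ shifts ℤ.pred l α S
E-S zero    α        = ≈-trans (E-0 (S α)) (≈-sym (shifts-0 ℤ.pred α S))
E-S (suc l) []       = E-1 (suc l)
E-S (suc l) (a ∷ as) = ≈-trans (E-Bern l a (S as)) (+-cong
  (≈-trans (Linear.cong (Bern-linear a) (E-S (suc l) as)) (shifts-linear (Bern-linear a) ℤ.pred (suc l) as S))
  (-‿cong (≈-trans (Linear.cong (Bern-linear (ℤ.pred a)) (E-S l as)) (shifts-linear (Bern-linear (ℤ.pred a)) ℤ.pred l as S))))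

zeros : ℕ → List ℤ
zeros k = replicate k 0ℤ

S-zeros : ∀ k → S (zeros k) ≈ 1Λ
S-zeros zero    = ≈-refl
S-zeros (suc k) = ≈-trans (Linear.cong (Bern-linear 0ℤ) (S-zeros k)) Bern-0-1

S-++-zeros : ∀ α k → S (α ++ zeros k) ≈ S α
S-++-zeros []       k = S-zeros k
S-++-zeros (a ∷ as) k = Linear.cong (Bern-linear a) (S-++-zeros as k)

-- The final zeros make room for the new parts.
e-S : ∀ l α k → l ℕ.≤ k → es l * S (α ++ zeros k) ≈ shifts ℤ.suc l (α ++ zeros k) S
e-S zero    α        k       _         = ≈-trans (≈-trans (*-congʳ (Ωz-0 (- X))) (*-identityˡ _)) (≈-sym (shifts-0 ℤ.suc (α ++ zeros k) S))
e-S (suc l) (a ∷ as) k       l<k       = ≈-trans (e-Bern l a (S (as ++ zeros k))) (+-cong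
  (≈-trans (Linear.cong (Bern-linear a) (e-S (suc l) as k l<k)) (shifts-linear (Bern-linear a) ℤ.suc (suc l) (as ++ zeros k) S))
  (-‿cong (≈-trans (Linear.cong (Bern-linear (ℤ.suc a)) (e-S l as k (ℕₚ.<⇒≤ l<k)))
    (shifts-linear (Bern-linear (ℤ.suc a)) ℤ.suc l (as ++ zeros k) S))))
e-S (suc l) []       (suc k) (s≤s l≤k) = ≈-trans (e-Bern l 0ℤ (S (zeros k))) (+-cong unmoved-term
  (-‿cong (≈-trans (Linear.cong (Bern-linear (+ 1)) (e-S l [] k l≤k)) (shifts-linear (Bern-linear (+ 1)) ℤ.suc l (zeros k) S))))
  where
  unmoved-term : Bern 0ℤ (es (suc l) * S (zeros k)) ≈ shifts ℤ.suc (suc l) (zeros k) (λ γ → S (0ℤ ∷ γ))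
  unmoved-term = by-cases (suc l ℕₚ.≤? k)
    where
    by-cases : Dec (suc l ℕ.≤ k) → Bern 0ℤ (es (suc l) * S (zeros k)) ≈ shifts ℤ.suc (suc l) (zeros k) (λ γ → S (0ℤ ∷ γ))
    by-cases (yes l<k) = ≈-trans (Linear.cong (Bern-linear 0ℤ) (e-S (suc l) [] k l<k)) (shifts-linear (Bern-linear 0ℤ) ℤ.suc (suc l) (zeros k) S)
    -- Now the remaining k zeros are too few for l + 1 moves, and on the other side B_0 e_{l+1} = 0.
    by-cases (no l≮k)  = ≈-trans (Linear.cong (Bern-linear 0ℤ) (≈-trans (*-congˡ (S-zeros k)) (*-identityʳ _)))
      (≈-trans (Bern-0-e l) (≈-sym (shifts-> ℤ.suc (suc l) (zeros k) _ (s≤s (≡.subst (ℕ._≤ l) (≡.sym (length-replicate k)) (ℕₚ.≤-pred (ℕₚ.≰⇒> l≮k)))))))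

-- The default 0 builds a bound on the last entry into the two predicates below: at least 0 for
-- `Decreasing`, at least -1 for `Almost`.
head₀ : List ℤ → ℤ
head₀ []      = 0ℤ
head₀ (a ∷ _) = a

data Decreasing : List ℤ → Set where
  []  : Decreasing []
  _∷_ : ∀ {a as} → head₀ as ℤ.≤ a → Decreasing as → Decreasing (a ∷ as)

data Almost : List ℤ → Set where
  []  : Almost []
  _∷_ : ∀ {a as} → head₀ as ℤ.≤ ℤ.suc a → Almost as → Almost (a ∷ as)

straighten : ∀ {α} → Almost α → Decreasing α ⊎ S α ≈ 0Λ
straighten []                 = inj₁ []
straighten {a ∷ as} (le ∷ al) = extend (straighten al) (head₀ as ℤₚ.≤? a)
  where
  vanish : ∀ as → head₀ as ≡ ℤ.suc a → S (a ∷ as) ≈ 0Λ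
  vanish []       eq = ≈-trans (Bern-1 a) (h-≡ {a} { -[1+ 0 ]} (≡.trans (≡.sym (ℤₚ.pred-suc a)) (≡.cong ℤ.pred (≡.sym eq))))
  vanish (_ ∷ as) ≡.refl = Bern-Bern a (S as)

  extend : Decreasing as ⊎ S as ≈ 0Λ → Dec (head₀ as ℤ.≤ a) → Decreasing (a ∷ as) ⊎ S (a ∷ as) ≈ 0Λ
  extend (inj₂ S≈0) _         = inj₂ (≈-trans (Linear.cong (Bern-linear a) S≈0) (Linear.zero-hom (Bern-linear a)))
  extend (inj₁ dec) (yes le′) = inj₁ (le′ ∷ dec)
  extend (inj₁ dec) (no nle)  = inj₂ (vanish as (ℤₚ.≤-antisym le (ℤₚ.i<j⇒suc[i]≤j (ℤₚ.≰⇒> nle))))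

increase-almost : ∀ {α γ} → Decreasing α → Pointwise (Shifted ℤ.suc) α γ → Almost γ
increase-almost [] [] = []
increase-almost {a ∷ as} (le ∷ dec) (sh ∷ shs) = ℤₚ.≤-trans (bound shs) (ℤₚ.suc-mono (ℤₚ.≤-trans le (upper sh))) ∷ increase-almost dec shs
  where
  bound : ∀ {as γs} → Pointwise (Shifted ℤ.suc) as γs → head₀ γs ℤ.≤ ℤ.suc (head₀ as)
  bound []             = ℤ.+≤+ z≤n
  bound (unmoved ∷ _)  = ℤₚ.i≤suc[i] _
  bound (moved ∷ _)    = ℤₚ.≤-refl
  upper : ∀ {a c} → Shifted ℤ.suc a c → a ℤ.≤ c
  upper unmoved = ℤₚ.≤-refl
  upper moved   = ℤₚ.i≤suc[i] _

decrease-almost : ∀ {α γ} → Decreasing α → Pointwise (Shifted ℤ.pred) α γ → Almost γ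
decrease-almost [] [] = []
decrease-almost {a ∷ as} (le ∷ dec) (sh ∷ shs) = ℤₚ.≤-trans (bound shs) (ℤₚ.≤-trans le (lower sh)) ∷ decrease-almost dec shs
  where
  bound : ∀ {as γs} → Pointwise (Shifted ℤ.pred) as γs → head₀ γs ℤ.≤ head₀ as
  bound []             = ℤₚ.≤-refl
  bound (unmoved ∷ _)  = ℤₚ.≤-refl
  bound (moved ∷ _)    = ℤₚ.i≤j⇒pred[i]≤j ℤₚ.≤-refl
  lower : ∀ {a c} → Shifted ℤ.pred a c → a ℤ.≤ ℤ.suc c
  lower unmoved   = ℤₚ.i≤suc[i] _
  lower {a} moved = ℤₚ.≤-reflexive (≡.sym (ℤₚ.suc-pred a))

decreasing-parts : ∀ μ → Decreasing (map +_ (parts μ))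
-- The proof stored in a partition is irrelevant; a usable one is recovered by deciding the
-- property.
decreasing-parts (partition ps dec _) = go (recompute (Linked.linked? ℕₚ._≥?_ ps) dec)
  where
  go : ∀ {ps} → Linked ℕ._≥_ ps → Decreasing (map +_ ps)
  go []         = []
  go [-]        = ℤ.+≤+ z≤n ∷ []
  go (ge ∷ dec) = ℤ.+≤+ ge ∷ go dec

decreasing-zeros : ∀ k → Decreasing (zeros k)
decreasing-zeros zero          = []
decreasing-zeros (suc zero)    = ℤₚ.≤-refl ∷ []
decreasing-zeros (suc (suc k)) = ℤₚ.≤-refl ∷ decreasing-zeros (suc k)

decreasing-++-zeros : ∀ {α} k → Decreasing α → Decreasing (α ++ zeros k)
decreasing-++-zeros k [] = decreasing-zeros k
decreasing-++-zeros {a ∷ as} k (le ∷ dec) = extend as k le ∷ decreasing-++-zeros k dec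
  where
  extend : ∀ as k → head₀ as ℤ.≤ a → head₀ (as ++ zeros k) ℤ.≤ a
  extend []      zero    le = le
  extend []      (suc k) le = le
  extend (_ ∷ _) k       le = le

decreasing⇒nonneg : ∀ {α} → Decreasing α → 0ℤ ℤ.≤ head₀ α
decreasing⇒nonneg []         = ℤₚ.≤-refl
decreasing⇒nonneg (le ∷ dec) = ℤₚ.≤-trans (decreasing⇒nonneg dec) le

¬decreasing-negative : ∀ {n as} → ¬ Decreasing (-[1+ n ] ∷ as)
¬decreasing-negative dec with () ← decreasing⇒nonneg dec

-- The cut is at the first entry that is not positive; in a decreasing sequence only zeros follow
-- there.
strip : List ℤ → List ℕ
strip []                  = []
strip (+ zero ∷ as)       = []
strip (+ suc n ∷ as)      = suc n ∷ strip as
strip (-[1+ n ] ∷ as)     = []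

strip-linked : ∀ {α} → Decreasing α → Linked ℕ._≥_ (strip α)
strip-linked [] = []
strip-linked {+ zero ∷ as}     (le ∷ dec) = []
strip-linked { -[1+ n ] ∷ as}  _          = []
strip-linked {+ suc n ∷ []}    (le ∷ dec) = [-]
strip-linked {+ suc n ∷ + zero ∷ as}    (le ∷ dec) = [-]
strip-linked {+ suc n ∷ -[1+ m ] ∷ as}  (le ∷ dec) = [-]
strip-linked {+ suc n ∷ + suc m ∷ as}   (le ∷ dec) = ℤₚ.drop‿+≤+ le ∷ strip-linked dec

strip-positive : ∀ α → All ℕ.NonZero (strip α)
strip-positive []              = []
strip-positive (+ zero ∷ as)   = []
strip-positive (+ suc n ∷ as)  = _ ∷ strip-positive as
strip-positive (-[1+ n ] ∷ as) = []

toPartition : ∀ {α} → Decreasing α → Partition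
toPartition {α} dec = partition (strip α) (strip-linked dec) (strip-positive α)

decreasing-zero : ∀ {as} → Decreasing (0ℤ ∷ as) → as ≡ zeros (length as)
decreasing-zero {[]}     _                = ≡.refl
decreasing-zero {a ∷ as} (a≤0 ∷ dec) with ℤₚ.≤-antisym a≤0 (decreasing⇒nonneg dec)
... | ≡.refl = ≡.cong (0ℤ ∷_) (decreasing-zero dec)

S-strip : ∀ {α} → Decreasing α → S (map +_ (strip α)) ≈ S α
S-strip [] = ≈-refl
S-strip {+ zero ∷ as}    dec        = ≈-sym (≈-trans (reflexive (≡.cong (λ as → S (0ℤ ∷ as)) (decreasing-zero dec))) (S-zeros (suc (length as))))
S-strip {+ suc n ∷ as}   (le ∷ dec) = Linear.cong (Bern-linear (+ suc n)) (S-strip dec)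
S-strip { -[1+ n ] ∷ as} dec        = ⊥-elim (¬decreasing-negative dec)

s-toPartition : ∀ {α} (dec : Decreasing α) → S α ≈ s (toPartition dec)
s-toPartition dec = ≈-sym (≈-trans (s≈S (toPartition dec)) (S-strip dec))

-- All that `strip` forgets is the number of final zeros, which the common length restores.
strip-injective : ∀ {α β} → Decreasing α → Decreasing β → length α ≡ length β → strip α ≡ strip β → α ≡ β
strip-injective {[]} {[]} _ _ _ _ = ≡.refl
strip-injective {+ zero ∷ as}  {+ zero ∷ bs}  dα dβ eq _ = ≡.cong (0ℤ ∷_)
  (≡.trans (decreasing-zero dα) (≡.trans (≡.cong zeros (ℕₚ.suc-injective eq)) (≡.sym (decreasing-zero dβ))))
strip-injective {+ suc m ∷ as} {+ suc n ∷ bs} (_ ∷ dα) (_ ∷ dβ) eq e = ≡.cong₂ _∷_ (≡.cong +_ (Listₚ.∷-injectiveˡ e))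
  (strip-injective dα dβ (ℕₚ.suc-injective eq) (Listₚ.∷-injectiveʳ e))
strip-injective {+ zero ∷ _}   {+ suc n ∷ _}  _ _ _ ()
strip-injective {+ suc m ∷ _}  {+ zero ∷ _}   _ _ _ ()
strip-injective { -[1+ _ ] ∷ _} dα _ _ _ = ⊥-elim (¬decreasing-negative dα)
strip-injective {_ ∷ _} { -[1+ _ ] ∷ _} _ dβ _ _ = ⊥-elim (¬decreasing-negative dβ)

-- Generation of Λ by the e_l, and the span of the Schur functions

-- An induction principle for properties of multipliers `G`: that multiplication by `G` preserves
-- the span of the Schur functions, and that its adjoint is `G ▷_`.
record Subalgebra (𝒜 : Λ → Set) : Set where
  field
    𝒜-cong : ∀ {P Q} → P ≈ Q → 𝒜 P → 𝒜 Q
    𝒜-con  : ∀ c → 𝒜 (con c)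
    𝒜-+    : ∀ {P Q} → 𝒜 P → 𝒜 Q → 𝒜 (P + Q)
    𝒜-*    : ∀ {P Q} → 𝒜 P → 𝒜 Q → 𝒜 (P * Q)
    𝒜--    : ∀ {P} → 𝒜 P → 𝒜 (- P)

module _ {𝒜 : Λ → Set} (subalgebra : Subalgebra 𝒜) (𝒜-e : ∀ l → 𝒜 (es l)) where
  open Subalgebra subalgebra

  private
    𝒜-· : ∀ n {P} → 𝒜 P → 𝒜 (n · P)
    𝒜-· zero    p = 𝒜-con _
    𝒜-· (suc n) p = 𝒜-+ p (𝒜-· n p)

    𝒜-⋆ : ∀ n {F G} → (∀ i → i ℕ.≤ n → 𝒜 (F i)) → (∀ i → 𝒜 (G i)) → 𝒜 ((F ⋆ G) n)
    𝒜-⋆ zero    f g = 𝒜-* (f 0 z≤n) (g 0)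
    𝒜-⋆ (suc n) f g = 𝒜-+ (𝒜-* (f 0 z≤n) (g (suc n))) (𝒜-⋆ n (λ i i≤n → f (suc i) (s≤s i≤n)) g)

    ps : Seq
    ps i = powerSums (- X) (suc i)

    newton : ∀ n → suc n · es (suc n) ≈ (ps ⋆ es) n
    newton n = ≈-trans (θ-Ωz (- X) (suc n)) (≈-trans (+-congʳ (zeroˡ _)) (+-identityˡ _))

    -- The last summand in Newton's identity is the power sum itself times `es 0`, which is 1; all
    -- others involve earlier power sums.
    last : ∀ n → 𝒜 ((ps ⋆ es) n) → (∀ i → i ℕ.< n → 𝒜 (ps i)) → 𝒜 (ps n)
    last zero    q p = 𝒜-cong (≈-trans (*-congˡ (Ωz-0 (- X))) (*-identityʳ _)) q
    last (suc n) q p = 𝒜-cong eq (𝒜-+ q (𝒜-- (𝒜-⋆ n {ps} {es ∘ suc} (λ i i≤n → p i (s≤s i≤n)) (𝒜-e ∘ suc))))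
      where
      eq : (ps ⋆ es) (suc n) + - (ps ⋆ (es ∘ suc)) n ≈ ps (suc n)
      eq = begin
        (ps ⋆ es) (suc n) + - (ps ⋆ (es ∘ suc)) n                                    ≈⟨ +-congʳ (⋆-suc ps es n) ⟩
        ((ps ⋆ (es ∘ suc)) n + ps (suc n) * es 0) + - (ps ⋆ (es ∘ suc)) n            ≈⟨ solve 2 (λ a b → (a :+ b) :+ :- a := b) ≈-refl _ _ ⟩
        ps (suc n) * es 0                                                            ≈⟨ *-congˡ {ps (suc n)} (Ωz-0 (- X)) ⟩
        ps (suc n) * 1Λ                                                              ≈⟨ *-identityʳ _ ⟩
        ps (suc n)                                                                   ∎

    𝒜-ps : ∀ N n → n ℕ.< N → 𝒜 (ps n)
    𝒜-ps (suc N) n (s≤s n≤N) = last n (𝒜-cong (newton n) (𝒜-· (suc n) (𝒜-e (suc n))))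
      λ i i<n → 𝒜-ps N i (ℕₚ.<-≤-trans i<n n≤N)

  generated : ∀ P → 𝒜 P
  generated (con c)        = 𝒜-con c
  generated (var (tt , j)) = 𝒜-cong
    (≈-trans (-‿cong (≈-trans (powerSums--X j) (≈-trans (≈-sym (-‿distribˡ-* 1Λ _)) (-‿cong (*-identityˡ _))))) (-‿involutive _))
    (𝒜-- (𝒜-ps (suc j) j ℕₚ.≤-refl))
  generated (P + Q)        = 𝒜-+ (generated P) (generated Q)
  generated (P * Q)        = 𝒜-* (generated P) (generated Q)
  generated (- P)          = 𝒜-- (generated P)

-- Given inductively instead of by coefficient lists, so that bilinear statements can be proved by
-- induction on membership.
data Span : Λ → Set where
  schur : ∀ μ → Span (s μ)
  plus  : ∀ {P Q} → Span P → Span Q → Span (P + Q)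
  times : ∀ c {P} → Span P → Span (con c * P)
  equal : ∀ {P Q} → P ≈ Q → Span P → Span Q

minus-one : ∀ P → con (ℚt.- ℚt.con ℚ.1ℚ) * P ≈ - P
minus-one P = ≈-trans (*-congʳ (con-neg _)) (≈-trans (≈-sym (-‿distribˡ-* 1Λ P)) (-‿cong (*-identityˡ P)))

span-neg : ∀ {P} → Span P → Span (- P)
span-neg {P} p = equal (minus-one P) (times _ p)

span-0 : Span 0Λ
span-0 = equal (zeroˡ _) (times _ (schur ⟨1⟩))

span-S : ∀ {α} → Almost α → Span (S α)
span-S al with straighten al
... | inj₁ dec = equal (≈-sym (s-toPartition dec)) (schur (toPartition dec))
... | inj₂ S≈0 = equal (≈-sym S≈0) span-0

span-e : ∀ l {P} → Span P → Span (es l * P)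
span-e l (schur μ) = equal (*-congˡ (≈-trans (S-++-zeros (map +_ (parts μ)) l) (≈-sym (s≈S μ))))
  (equal (≈-sym (e-S l (map +_ (parts μ)) l ℕₚ.≤-refl))
    (shifts-closed Span span-0 plus span-neg l (map +_ (parts μ) ++ zeros l)
      λ γ sh → span-S (increase-almost (decreasing-++-zeros l (decreasing-parts μ)) sh)))
span-e l (plus p q)  = equal (≈-sym (distribˡ _ _ _)) (plus (span-e l p) (span-e l q))
span-e l (times c p) = equal (solve 3 (λ a b x → a :* (b :* x) := b :* (a :* x)) ≈-refl _ _ _) (times c (span-e l p))
span-e l (equal e p) = equal (*-congˡ e) (span-e l p)

span-* : ∀ G {P} → Span P → Span (G * P)
span-* = generated {λ G → ∀ {P} → Span P → Span (G * P)} (record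
  { 𝒜-cong = λ e m p → equal (*-congʳ e) (m p)
  ; 𝒜-con  = λ c p → times c p
  ; 𝒜-+    = λ m n p → equal (≈-sym (distribʳ _ _ _)) (plus (m p) (n p))
  ; 𝒜-*    = λ m n p → equal (≈-sym (*-assoc _ _ _)) (m (n p))
  ; 𝒜--    = λ m p → equal (-‿distribˡ-* _ _) (span-neg (m p))
  }) span-e

-- The span contains 1, the Schur function of the empty partition, and is stable under every
-- multiplication.
spanned : ∀ P → Span P
spanned P = equal (*-identityʳ P) (span-* P (schur (partition [] [] [])))

ΣList-cong : ∀ {I : Set} (is : List I) {F G} → (∀ i → F i ≈ G i) → ΣList is F ≈ ΣList is G
ΣList-cong []       e = ≈-refl
ΣList-cong (i ∷ is) e = +-cong (e i) (ΣList-cong is e)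

ΣList-zero : ∀ {I : Set} (is : List I) {F} → (∀ i → F i ≈ 0Λ) → ΣList is F ≈ 0Λ
ΣList-zero []       e = ≈-refl
ΣList-zero (i ∷ is) e = ≈-trans (+-cong (e i) (ΣList-zero is e)) (+-identityˡ 0Λ)

ΣList-+ : ∀ {I : Set} (is : List I) F G → ΣList is (λ i → F i + G i) ≈ ΣList is F + ΣList is G
ΣList-+ []       F G = ≈-sym (+-identityˡ 0Λ)
ΣList-+ (i ∷ is) F G = ≈-trans (+-congˡ (ΣList-+ is F G))
  (solve 4 (λ a b c d → (a :+ b) :+ (c :+ d) := (a :+ c) :+ (b :+ d)) ≈-refl _ _ _ _)

ΣList-hom : ∀ {I : Set} {T : Λ → Λ} → T 0Λ ≈ 0Λ → (∀ x y → T (x + y) ≈ T x + T y) →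
            ∀ (is : List I) F → T (ΣList is F) ≈ ΣList is (T ∘ F)
ΣList-hom T-0 T-+ []       F = T-0
ΣList-hom T-0 T-+ (i ∷ is) F = ≈-trans (T-+ _ _) (+-congˡ (ΣList-hom T-0 T-+ is F))

ΣList-pick : ∀ {I : Set} {is : List I} {i F} → Unique is → i ∈ is → (∀ j → ¬ i ≡ j → F j ≈ 0Λ) → ΣList is F ≈ F i
ΣList-pick {is = i ∷ is} {F = F} (i∉ ∷ _) (here ≡.refl) e = ≈-trans (+-congˡ (rest is i∉)) (+-identityʳ _)
  where
  rest : ∀ is → All (λ j → ¬ i ≡ j) is → ΣList is F ≈ 0Λ
  rest []       []        = ≈-refl
  rest (j ∷ is) (≢j ∷ ≢s) = ≈-trans (+-cong (e j ≢j) (rest is ≢s)) (+-identityˡ 0Λ)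
ΣList-pick {is = j ∷ is} (j∉ ∷ unique) (there i∈) e = ≈-trans
  (+-cong (e j λ i≡j → All.lookup j∉ i∈ (≡.sym i≡j)) (ΣList-pick unique i∈ e)) (+-identityˡ _)

_≟ₚ_ : DecidableEquality Partition
partition ps _ _ ≟ₚ partition qs _ _ = map′ (λ { ≡.refl → ≡.refl }) (≡.cong parts) (Listₚ.≡-dec ℕₚ._≟_ ps qs)

-- The scalar product: adjoints and coefficients

module Q where
  open CommutativeRing ℚ[t]-ring public
  open Algebra.Properties.Ring ring public
  open Shifts ℚ[t]-ring public

module HallProduct (Hall : ScalarProduct) where
  open ScalarProduct Hall

  ⟨⟩-congˡ : ∀ {P P′ Q} → P ≈ P′ → ⟨ P , Q ⟩ ≈ₜ ⟨ P′ , Q ⟩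
  ⟨⟩-congˡ e = ⟨⟩-cong e ≈-refl

  ⟨⟩-congʳ : ∀ {P Q Q′} → Q ≈ Q′ → ⟨ P , Q ⟩ ≈ₜ ⟨ P , Q′ ⟩
  ⟨⟩-congʳ = ⟨⟩-cong ≈-refl

  ⟨⟩-+ʳ : ∀ P Q Q′ → ⟨ P , Q + Q′ ⟩ ≈ₜ ⟨ P , Q ⟩ ℚt.+ ⟨ P , Q′ ⟩
  ⟨⟩-+ʳ P Q Q′ = Q.trans (⟨⟩-sym _ _) (Q.trans (⟨⟩-+ Q Q′ P) (Q.+-cong (⟨⟩-sym _ _) (⟨⟩-sym _ _)))

  ⟨⟩-scaleʳ : ∀ c P Q → ⟨ P , con c * Q ⟩ ≈ₜ c ℚt.* ⟨ P , Q ⟩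
  ⟨⟩-scaleʳ c P Q = Q.trans (⟨⟩-sym _ _) (Q.trans (⟨⟩-scale c Q P) (Q.*-congˡ (⟨⟩-sym _ _)))

  ⟨⟩-0 : ∀ {Q} → ⟨ 0Λ , Q ⟩ ≈ₜ Q.0#
  ⟨⟩-0 {Q} = Q.trans (⟨⟩-congˡ (≈-sym (zeroˡ 0Λ))) (Q.trans (⟨⟩-scale Q.0# 0Λ Q) (Q.zeroˡ _))

  ⟨⟩-0ʳ : ∀ {P} → ⟨ P , 0Λ ⟩ ≈ₜ Q.0#
  ⟨⟩-0ʳ = Q.trans (⟨⟩-sym _ _) ⟨⟩-0

  ⟨⟩-neg : ∀ P Q → ⟨ - P , Q ⟩ ≈ₜ ℚt.- ⟨ P , Q ⟩
  ⟨⟩-neg P Q = Q.trans (⟨⟩-congˡ (≈-sym (minus-one P))) (Q.trans (⟨⟩-scale _ P Q) (Q.-1*x≈-x _))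

  ⟨⟩-negʳ : ∀ P Q → ⟨ P , - Q ⟩ ≈ₜ ℚt.- ⟨ P , Q ⟩
  ⟨⟩-negʳ P Q = Q.trans (⟨⟩-sym _ _) (Q.trans (⟨⟩-neg Q P) (Q.-‿cong (⟨⟩-sym _ _)))

  ⟨S,S⟩ : ∀ {α β} → Decreasing α → Decreasing β → length α ≡ length β → ⟨ S α , S β ⟩ ≈ₜ Q.δ* α β
  ⟨S,S⟩ {α} {β} dα dβ len = by-cases (Listₚ.≡-dec ℤₚ._≟_ α β)
    where
    by-cases : Dec (α ≡ β) → ⟨ S α , S β ⟩ ≈ₜ Q.δ* α β
    by-cases (yes ≡.refl) = Q.trans (⟨⟩-cong (s-toPartition dα) (s-toPartition dα))
      (Q.trans (normal (toPartition dα)) (Q.sym (Q.δ*-refl α)))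
    by-cases (no α≢β) = Q.trans (⟨⟩-cong (s-toPartition dα) (s-toPartition dβ))
      (Q.trans (orthogonal (toPartition dα) (toPartition dβ) λ eq → α≢β (strip-injective dα dβ len (≡.cong parts eq))) (Q.sym (Q.δ*-≢ α≢β)))

  -- If `α` does not straighten to a decreasing sequence, `S α` is zero, and then `α` also differs
  -- from the decreasing `β`.
  ⟨S,S⟩-almost : ∀ {α β} → Almost α → Decreasing β → length α ≡ length β → ⟨ S α , S β ⟩ ≈ₜ Q.δ* α β
  ⟨S,S⟩-almost {α} {β} aα dβ len = by-cases (Listₚ.≡-dec ℤₚ._≟_ α β) (straighten aα)
    where
    by-cases : Dec (α ≡ β) → Decreasing α ⊎ S α ≈ 0Λ → ⟨ S α , S β ⟩ ≈ₜ Q.δ* α β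
    by-cases (yes ≡.refl) _          = ⟨S,S⟩ dβ dβ len
    by-cases (no _)       (inj₁ dα)  = ⟨S,S⟩ dα dβ len
    by-cases (no α≢β)     (inj₂ S≈0) = Q.trans (⟨⟩-congˡ S≈0) (Q.trans ⟨⟩-0 (Q.sym (Q.δ*-≢ α≢β)))

  δ*-sym : ∀ α β → Q.δ* α β ≈ₜ Q.δ* β α
  δ*-sym []       []       = Q.refl
  δ*-sym []       (_ ∷ _)  = Q.refl
  δ*-sym (_ ∷ _)  []       = Q.refl
  δ*-sym (a ∷ as) (b ∷ bs) = Q.*-cong (Q.δℤ-cong {a} {b} {b} {a} ≡.sym ≡.sym) (δ*-sym as bs)

  pad : Partition → ℕ → List ℤ
  pad μ k = map +_ (parts μ) ++ zeros k

  S-pad : ∀ μ k → S (pad μ k) ≈ s μ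
  S-pad μ k = ≈-trans (S-++-zeros (map +_ (parts μ)) k) (≈-sym (s≈S μ))

  -- Orthonormality turns both sides into signed counts of vertical strips of size l, added to μ to
  -- reach ν or removed from ν to reach μ; `shifts-δ*` matches the two counts.
  e-adjoint-schur : ∀ l μ ν → ⟨ es l * s μ , s ν ⟩ ≈ₜ ⟨ s μ , es l ▷ s ν ⟩
  e-adjoint-schur l μ ν =
    Q.trans (⟨⟩-cong (≈-trans (*-congˡ (≈-sym (S-pad μ k))) (e-S l (map +_ (parts μ)) k (ℕₚ.m≤m+n l _))) (≈-sym (S-pad ν k′)))
    (Q.trans (shifts-hom Λ-ring ℚ[t]-ring ⟨_, S β ⟩ ⟨⟩-0 (λ x y → ⟨⟩-+ x y _) (λ x → ⟨⟩-neg x _) ℤ.suc l α S)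
    (Q.trans (Q.shifts-cong l α λ γ sh → ⟨S,S⟩-almost (increase-almost dα sh) dβ (≡.trans (≡.sym (Pointwise-length sh)) len))
    (Q.trans (Q.shifts-δ* l α β len)
    (Q.trans (Q.sym (Q.shifts-cong l β λ γ sh → Q.trans (⟨⟩-sym _ _) (Q.trans
        (⟨S,S⟩-almost (decrease-almost dβ sh) dα (≡.trans (≡.sym (Pointwise-length sh)) (≡.sym len))) (δ*-sym γ α))))
    (Q.trans (Q.sym (shifts-hom Λ-ring ℚ[t]-ring ⟨ S α ,_⟩ ⟨⟩-0ʳ (⟨⟩-+ʳ _) (⟨⟩-negʳ _) ℤ.pred l β S))
    (⟨⟩-cong (S-pad μ k) (≈-trans (≈-sym (E-S l β)) (Linear.cong (▷-linear (es l)) (S-pad ν k′)))))))))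
    where
    -- With this padding both sequences have length ℓ(μ) + ℓ(ν) + l, and μ has room for l new parts.
    k k′ : ℕ
    k = l ℕ.+ length (parts ν)
    k′ = l ℕ.+ length (parts μ)
    α β : List ℤ
    α = pad μ k
    β = pad ν k′
    dα : Decreasing α
    dα = decreasing-++-zeros k (decreasing-parts μ)
    dβ : Decreasing β
    dβ = decreasing-++-zeros k′ (decreasing-parts ν)
    pad-length : ∀ μ k → length (pad μ k) ≡ length (parts μ) ℕ.+ k
    pad-length μ k = ≡.trans (length-++ (map +_ (parts μ))) (≡.cong₂ ℕ._+_ (length-map +_ (parts μ)) (length-replicate k))
    len : length α ≡ length β
    len = ≡.trans (pad-length μ k) (≡.trans (ℕS.solve 3 (λ a b c → a ℕS.:+ (b ℕS.:+ c) ℕS.:= c ℕS.:+ (b ℕS.:+ a)) ≡.refl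
      (length (parts μ)) l (length (parts ν))) (≡.sym (pad-length ν k′)))
      where module ℕS = ℕSolver.+-*-Solver

  e-adjoint : ∀ l {P Q} → Span P → Span Q → ⟨ es l * P , Q ⟩ ≈ₜ ⟨ P , es l ▷ Q ⟩
  e-adjoint l (schur μ)   q = right q
    where
    right : ∀ {Q} → Span Q → ⟨ es l * s μ , Q ⟩ ≈ₜ ⟨ s μ , es l ▷ Q ⟩
    right (schur ν)           = e-adjoint-schur l μ ν
    right (plus p q)          = Q.trans (⟨⟩-+ʳ _ _ _) (Q.trans (Q.+-cong (right p) (right q))
      (Q.trans (Q.sym (⟨⟩-+ʳ _ _ _)) (⟨⟩-congʳ (≈-sym (Linear.add (▷-linear (es l)) _ _)))))
    right (times c {P} q)     = Q.trans (⟨⟩-scaleʳ c _ _) (Q.trans (Q.*-congˡ (right q))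
      (Q.trans (Q.sym (⟨⟩-scaleʳ c _ _)) (⟨⟩-congʳ (≈-sym (Linear.scale (▷-linear (es l)) c P)))))
    right (equal e q)         = Q.trans (⟨⟩-congʳ (≈-sym e)) (Q.trans (right q) (⟨⟩-congʳ (Linear.cong (▷-linear (es l)) e)))
  e-adjoint l (plus p p′) q = Q.trans (⟨⟩-congˡ (distribˡ _ _ _)) (Q.trans (⟨⟩-+ _ _ _)
    (Q.trans (Q.+-cong (e-adjoint l p q) (e-adjoint l p′ q)) (Q.sym (⟨⟩-+ _ _ _))))
  e-adjoint l (times c p) q = Q.trans (⟨⟩-congˡ (solve 3 (λ a b x → a :* (b :* x) := b :* (a :* x)) ≈-refl _ _ _))
    (Q.trans (⟨⟩-scale c _ _) (Q.trans (Q.*-congˡ (e-adjoint l p q)) (Q.sym (⟨⟩-scale c _ _))))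
  e-adjoint l (equal e p) q = Q.trans (⟨⟩-congˡ (*-congˡ (≈-sym e))) (Q.trans (e-adjoint l p q) (⟨⟩-congˡ e))

  ▷-adjoint : ∀ G P Q → ⟨ G * P , Q ⟩ ≈ₜ ⟨ P , G ▷ Q ⟩
  ▷-adjoint = generated {λ G → ∀ P Q → ⟨ G * P , Q ⟩ ≈ₜ ⟨ P , G ▷ Q ⟩} (record
    { 𝒜-cong = λ e a P Q → Q.trans (⟨⟩-congˡ (*-congʳ (≈-sym e))) (Q.trans (a P Q) (⟨⟩-congʳ (▷-congˡ e Q)))
    ; 𝒜-con  = λ c P Q → Q.trans (⟨⟩-scale c P Q) (Q.sym (⟨⟩-scaleʳ c P Q))
    ; 𝒜-+    = λ a b P Q → Q.trans (⟨⟩-congˡ (distribʳ _ _ _)) (Q.trans (⟨⟩-+ _ _ _)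
        (Q.trans (Q.+-cong (a P Q) (b P Q)) (Q.sym (⟨⟩-+ʳ _ _ _))))
    -- Adjoints compose in the opposite order, which `▷-comm` reverses.
    ; 𝒜-*    = λ {G} {H} a b P Q → Q.trans (⟨⟩-congˡ (*-assoc _ _ _)) (Q.trans (a (H * P) Q)
        (Q.trans (b P (G ▷ Q)) (⟨⟩-congʳ (▷-comm H G Q))))
    ; 𝒜--    = λ a P Q → Q.trans (⟨⟩-congˡ (≈-sym (-‿distribˡ-* _ _))) (Q.trans (⟨⟩-neg _ _)
        (Q.trans (Q.-‿cong (a P Q)) (Q.sym (⟨⟩-negʳ _ _))))
    }) λ l P Q → e-adjoint l (spanned P) (spanned Q)

  -- The expansion is claimed over every duplicate-free list containing `L₀`, so that the expansions
  -- of two summands can be added over a common list.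
  schur-expansion : ∀ {P} → Span P →
    ∃[ L₀ ] (∀ L → Unique L → (∀ {μ} → μ ∈ L₀ → μ ∈ L) → P ≈ ΣList L λ μ → con ⟨ P , s μ ⟩ * s μ)
  schur-expansion (schur ν) = (ν ∷ []) , λ L unique ⊇ → ≈-sym (≈-trans
    (ΣList-pick {F = λ μ → con ⟨ s ν , s μ ⟩ * s μ} unique (⊇ (here ≡.refl))
      λ μ ν≢μ → ≈-trans (*-congʳ (con-cong (orthogonal ν μ ν≢μ))) (zeroˡ _))
    (≈-trans (*-congʳ (con-cong (normal ν))) (*-identityˡ _)))
  schur-expansion (plus p q) =
    let L , e = schur-expansion p ; L′ , e′ = schur-expansion q in
    (L ++ L′) , λ M unique ⊇ → ≈-trans (+-cong (e M unique (⊇ ∘ ∈-++⁺ˡ)) (e′ M unique (⊇ ∘ ∈-++⁺ʳ L)))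
      (≈-trans (≈-sym (ΣList-+ M _ _)) (ΣList-cong M λ μ →
        ≈-trans (≈-sym (distribʳ _ _ _)) (*-congʳ (≈-trans (≈-sym (con-+ _ _)) (con-cong (Q.sym (⟨⟩-+ _ _ _)))))))
  schur-expansion (times c p) =
    let L , e = schur-expansion p in
    L , λ M unique ⊇ → ≈-trans (*-congˡ (e M unique ⊇))
      (≈-trans (ΣList-hom {T = con c *_} (zeroʳ _) (distribˡ _) M _) (ΣList-cong M λ μ →
        ≈-trans (≈-sym (*-assoc _ _ _)) (*-congʳ (≈-trans (≈-sym (con-* _ _)) (con-cong (Q.sym (⟨⟩-scale c _ _)))))))
  schur-expansion (equal eq p) =
    let L , e = schur-expansion p in
    L , λ M unique ⊇ → ≈-trans (≈-sym eq) (≈-trans (e M unique ⊇) (ΣList-cong M λ μ → *-congʳ (con-cong (⟨⟩-congˡ eq))))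

  nondegenerate : ∀ {P Q} → (∀ S → ⟨ P , S ⟩ ≈ₜ ⟨ Q , S ⟩) → P ≈ Q
  nondegenerate {P} {Q} e =
    let L , expand = schur-expansion (spanned (P + - Q))
        P-Q≈0 = ≈-trans (expand (deduplicate _≟ₚ_ L) (Uniqueₚ.deduplicate-! _≟ₚ_ L) (∈-deduplicate⁺ _≟ₚ_))
          (ΣList-zero (deduplicate _≟ₚ_ L) λ μ → ≈-trans (*-congʳ (con-cong (vanish (s μ)))) (zeroˡ _))
    in x∙y⁻¹≈ε⇒x≈y P Q P-Q≈0
    where
    vanish : ∀ S → ⟨ P + - Q , S ⟩ ≈ₜ Q.0#
    vanish S = Q.trans (⟨⟩-+ _ _ _) (Q.trans (Q.+-cong (e S) (⟨⟩-neg Q S)) (Q.-‿inverseʳ _))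

  schur-coefficient : ∀ {L : List Partition} {d : Partition → ℚ[t]} → Unique L → (∀ μ → μ ∉ L → d μ ≈ₜ Q.0#) →
                      ∀ ν → ⟨ ΣList L (λ μ → con (d μ) * s μ) , s ν ⟩ ≈ₜ d ν
  schur-coefficient {L} {d} unique outside ν = by-cases (L ∋? ν)
    where
    term : ∀ {μ} → ¬ μ ≡ ν → ⟨ con (d μ) * s μ , s ν ⟩ ≈ₜ Q.0#
    term {μ} μ≢ν = Q.trans (⟨⟩-scale _ _ _) (Q.trans (Q.*-congˡ (orthogonal μ ν μ≢ν)) (Q.zeroʳ _))

    absent : ∀ L → ν ∉ L → ⟨ ΣList L (λ μ → con (d μ) * s μ) , s ν ⟩ ≈ₜ Q.0#
    absent []      _  = ⟨⟩-0
    absent (μ ∷ L) ν∉ = Q.trans (⟨⟩-+ _ _ _)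
      (Q.trans (Q.+-cong (term λ μ≡ν → ν∉ (here (≡.sym μ≡ν))) (absent L (ν∉ ∘ there))) (Q.+-identityˡ _))

    present : ∀ {L} → Unique L → ν ∈ L → ⟨ ΣList L (λ μ → con (d μ) * s μ) , s ν ⟩ ≈ₜ d ν
    present (ν∉ ∷ _) (here ≡.refl) = Q.trans (⟨⟩-+ _ _ _)
      (Q.trans (Q.+-cong (Q.trans (⟨⟩-scale _ _ _) (Q.trans (Q.*-congˡ (normal ν)) (Q.*-identityʳ _)))
        (absent _ λ ν∈ → All.lookup ν∉ ν∈ ≡.refl)) (Q.+-identityʳ _))
    present (μ∉ ∷ unique) (there ν∈) = Q.trans (⟨⟩-+ _ _ _)
      (Q.trans (Q.+-cong (term λ μ≡ν → All.lookup μ∉ ν∈ μ≡ν) (present unique ν∈)) (Q.+-identityˡ _))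

    _∋?_ : ∀ L ν → Dec (ν ∈ L)
    L ∋? ν = any? (ν ≟ₚ_) L

    by-cases : Dec (ν ∈ L) → ⟨ ΣList L (λ μ → con (d μ) * s μ) , s ν ⟩ ≈ₜ d ν
    by-cases (yes ν∈) = present unique ν∈
    by-cases (no ν∉)  = Q.trans (absent L ν∉) (Q.sym (outside ν ν∉))

  ⊥≈▷ : (adj : Adjoints Hall) → let open Adjoints adj in ∀ P Q → (P ⊥) Q ≈ P ▷ Q
  ⊥≈▷ adj P Q = nondegenerate λ S → Q.trans (Adjoints.adjoint adj P Q S)
    (Q.trans (⟨⟩-sym _ _) (Q.trans (▷-adjoint P S Q) (⟨⟩-sym _ _)))

-- t-analogues

ΣList-++ : ∀ {I : Set} (is js : List I) F → ΣList (is ++ js) F ≈ ΣList is F + ΣList js F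
ΣList-++ []       js F = ≈-sym (+-identityˡ _)
ΣList-++ (i ∷ is) js F = ≈-trans (+-congˡ (ΣList-++ is js F)) (≈-sym (+-assoc _ _ _))

ΣList-map : ∀ {I J : Set} (g : I → J) is F → ΣList (map g is) F ≈ ΣList is (F ∘ g)
ΣList-map g []       F = ≈-refl
ΣList-map g (i ∷ is) F = +-congˡ (ΣList-map g is F)

ΣList-product : ∀ {I J K : Set} (g : I → J → K) is js F →
                ΣList (cartesianProductWith g is js) F ≈ ΣList is (λ i → ΣList js (λ j → F (g i j)))
ΣList-product g []       js F = ≈-refl
ΣList-product g (i ∷ is) js F = ≈-trans (ΣList-++ (map (g i) js) (cartesianProductWith g is js) F)
  (+-cong (ΣList-map (g i) js F) (ΣList-product g is js F))

ΣList-swap : ∀ {I J : Set} (is : List I) (js : List J) (F : I → J → Λ) →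
             ΣList is (λ i → ΣList js (F i)) ≈ ΣList js (λ j → ΣList is (λ i → F i j))
ΣList-swap []       js F = ≈-sym (ΣList-zero js λ _ → ≈-refl)
ΣList-swap (i ∷ is) js F = ≈-trans (+-congˡ (ΣList-swap is js F)) (≈-sym (ΣList-+ js (F i) (λ j → ΣList is (λ i → F i j))))

-- Maps that factor through the tensor product of Λ with itself over ℚ[t]; for these the sum over
-- the pairs (a , b) depends only on the element Σ a[X] b[Y].
record Bilinear (β : Λ → Λ → Λ) : Set where
  field
    cong     : ∀ {a a′ b b′} → a ≈ a′ → b ≈ b′ → β a b ≈ β a′ b′
    addˡ     : ∀ a a′ b → β (a + a′) b ≈ β a b + β a′ b
    addʳ     : ∀ a b b′ → β a (b + b′) ≈ β a b + β a b′
    balanced : ∀ c a b → β a (con c * b) ≈ β (con c * a) b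

  zeroˡ-β : ∀ b → β 0Λ b ≈ 0Λ
  zeroˡ-β b = additive⇒0 (λ a → β a b) (λ e → cong e ≈-refl) (λ a a′ → addˡ a a′ b)

  negˡ : ∀ a b → β (- a) b ≈ - β a b
  negˡ a b = +-inverseʳ-unique _ _ (≈-trans (≈-sym (addˡ a (- a) b)) (≈-trans (cong (-‿inverseʳ a) ≈-refl) (zeroˡ-β b)))

-- The same element as the one local to `tAnalogue`, so that `tAnalogue V P` is an instance of
-- `mixed` by computation.
tX+[1-t]Y : Sym XY
tX+[1-t]Y = SymRing.con t SymRing.* alphabet X-alphabet
      SymRing.+ SymRing.con (ℚt.con ℚ.1ℚ ℚt.+ ℚt.- t) SymRing.* alphabet Y-alphabet

-- mixed P β is Σ β (a , b) for P[tX + (1−t)Y] = Σ a[X] b[Y].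

mixed : Λ → (Λ → Λ → Λ) → Λ
mixed P β = ΣList (separate (P ⟦ tX+[1-t]Y ⟧)) λ (a , b) → β a b

mixed-β-cong : ∀ P {β γ} → (∀ a b → β a b ≈ γ a b) → mixed P β ≈ mixed P γ
mixed-β-cong P e = ΣList-cong (separate (P ⟦ tX+[1-t]Y ⟧)) λ (a , b) → e a b

mixed-β-+ : ∀ P β γ → mixed P (λ a b → β a b + γ a b) ≈ mixed P β + mixed P γ
mixed-β-+ P β γ = ΣList-+ (separate (P ⟦ tX+[1-t]Y ⟧)) _ _

multiplied : (Λ → Λ → Λ) → Λ → Λ → Λ → Λ → Λ
multiplied β a b a′ b′ = β (a * a′) (b * b′)

mixed-+ : ∀ P Q β → mixed (P + Q) β ≈ mixed P β + mixed Q β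
mixed-+ P Q β = ΣList-++ (separate (P ⟦ tX+[1-t]Y ⟧)) _ _

mixed-* : ∀ P Q β → mixed (P * Q) β ≈ mixed P (λ a b → mixed Q (multiplied β a b))
mixed-* P Q β = ΣList-product _ (separate (P ⟦ tX+[1-t]Y ⟧)) (separate (Q ⟦ tX+[1-t]Y ⟧)) _

mixed-con : ∀ c β → mixed (con c) β ≈ β (con c) 1Λ
mixed-con c β = +-identityʳ _

mixed-neg : ∀ P {β} → Bilinear β → mixed (- P) β ≈ - mixed P β
mixed-neg P {β} bil = ≈-trans (ΣList-map _ (separate (P ⟦ tX+[1-t]Y ⟧)) _)
  (≈-trans (ΣList-cong (separate (P ⟦ tX+[1-t]Y ⟧)) (λ (a , b) → Bilinear.negˡ bil a b))
  (≈-sym (ΣList-hom {T = λ x → - x} -0#≈0# (λ x y → ≈-sym (-‿+-comm x y)) (separate (P ⟦ tX+[1-t]Y ⟧)) _)))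

mixed-var : ∀ j {β} → Bilinear β → let u = adamsₜ (suc j) t in
            mixed (var (tt , j)) β ≈ β (con u * var (tt , j)) 1Λ + β (con (ℚt.con ℚ.1ℚ ℚt.+ ℚt.- u)) (var (tt , j))
mixed-var j {β} bil = +-cong
  (cong (*-congˡ (reflexive (≡.cong (λ k → var (tt , k)) (ℕₚ.+-identityʳ j)))) (*-identityˡ _))
  (≈-trans (+-identityʳ _) (cong (*-identityʳ _) (≈-trans (*-identityˡ _) (reflexive (≡.cong (λ k → var (tt , k)) (ℕₚ.+-identityʳ j))))))
  where open Bilinear bil

multiplied-bilinear : ∀ {β} → Bilinear β → ∀ a b → Bilinear (multiplied β a b)
multiplied-bilinear bil a b = record
  { cong     = λ e e′ → cong (*-congˡ e) (*-congˡ e′)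
  ; addˡ     = λ _ _ _ → ≈-trans (cong (distribˡ _ _ _) ≈-refl) (addˡ _ _ _)
  ; addʳ     = λ _ _ _ → ≈-trans (cong ≈-refl (distribˡ _ _ _)) (addʳ _ _ _)
  ; balanced = λ c a′ b′ → ≈-trans (cong ≈-refl (swap b (con c) b′)) (≈-trans (balanced c _ _) (cong (swap (con c) a a′) ≈-refl))
  }
  where
  open Bilinear bil
  swap : ∀ x y z → x * (y * z) ≈ y * (x * z)
  swap = solve 3 (λ x y z → x :* (y :* z) := y :* (x :* z)) ≈-refl

mixed-bilinear : ∀ Q {β} → Bilinear β → Bilinear (λ a b → mixed Q (multiplied β a b))
mixed-bilinear Q {β} bil = record
  { cong     = λ e e′ → mixed-β-cong Q λ a b → cong (*-congʳ e) (*-congʳ e′)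
  ; addˡ     = λ a a′ b → ≈-trans (mixed-β-cong Q λ x y → ≈-trans (cong (distribʳ _ _ _) ≈-refl) (addˡ _ _ _))
      (mixed-β-+ Q (multiplied β a b) (multiplied β a′ b))
  ; addʳ     = λ a b b′ → ≈-trans (mixed-β-cong Q λ x y → ≈-trans (cong ≈-refl (distribʳ _ _ _)) (addʳ _ _ _))
      (mixed-β-+ Q (multiplied β a b) (multiplied β a b′))
  ; balanced = λ c a b → mixed-β-cong Q λ x y → ≈-trans (cong ≈-refl (*-assoc _ _ _))
      (≈-trans (balanced c _ _) (cong (≈-sym (*-assoc _ _ _)) ≈-refl))
  }
  where open Bilinear bil

-- A product of terms nests one sum inside the other, with `β` changed for the inner one; therefore
-- the induction on the derivation of `P ≈ Q` keeps `β` general. Commutativity of the product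
-- becomes an interchange of sums.
mixed-cong : ∀ {P Q} → P ≈ Q → ∀ {β} → Bilinear β → mixed P β ≈ mixed Q β
mixed-cong SymRing.≈-refl bil = ≈-refl
mixed-cong (SymRing.≈-sym e) bil = ≈-sym (mixed-cong e bil)
mixed-cong (SymRing.≈-trans e e′) bil = ≈-trans (mixed-cong e bil) (mixed-cong e′ bil)
mixed-cong (SymRing.+-cong {P} {P′} {Q} {Q′} e e′) {β} bil = ≈-trans (mixed-+ P Q β)
  (≈-trans (+-cong (mixed-cong e bil) (mixed-cong e′ bil)) (≈-sym (mixed-+ P′ Q′ β)))
mixed-cong (SymRing.*-cong {P} {P′} {Q} {Q′} e e′) {β} bil = ≈-trans (mixed-* P Q β)
  (≈-trans (mixed-cong e (mixed-bilinear Q bil))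
  (≈-trans (mixed-β-cong P′ λ a b → mixed-cong e′ (multiplied-bilinear bil a b)) (≈-sym (mixed-* P′ Q′ β))))
mixed-cong (SymRing.-‿cong {P} {P′} e) bil = ≈-trans (mixed-neg P bil)
  (≈-trans (-‿cong (mixed-cong e bil)) (≈-sym (mixed-neg P′ bil)))
mixed-cong (SymRing.+-assoc P Q S) {β} bil = ≈-trans (mixed-+ (P + Q) S β) (≈-trans (+-congʳ (mixed-+ P Q β))
  (≈-trans (+-assoc _ _ _) (≈-trans (+-congˡ (≈-sym (mixed-+ Q S β))) (≈-sym (mixed-+ P (Q + S) β)))))
mixed-cong (SymRing.+-comm P Q) {β} bil = ≈-trans (mixed-+ P Q β) (≈-trans (+-comm _ _) (≈-sym (mixed-+ Q P β)))
mixed-cong (SymRing.+-identityˡ P) {β} bil = ≈-trans (mixed-+ 0Λ P β)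
  (≈-trans (+-congʳ (≈-trans (mixed-con _ β) (Bilinear.zeroˡ-β bil 1Λ))) (+-identityˡ _))
mixed-cong (SymRing.-‿inverseˡ P) {β} bil = ≈-trans (mixed-+ (- P) P β) (≈-trans (+-congʳ (mixed-neg P bil))
  (≈-trans (SymRing.-‿inverseˡ _) (≈-sym (≈-trans (mixed-con _ β) (Bilinear.zeroˡ-β bil 1Λ)))))
mixed-cong (SymRing.*-assoc P Q S) {β} bil = begin
  mixed (P * Q * S) β
    ≈⟨ mixed-* (P * Q) S β ⟩
  mixed (P * Q) (λ a b → mixed S (multiplied β a b))
    ≈⟨ mixed-* P Q _ ⟩
  mixed P (λ a b → mixed Q (λ a′ b′ → mixed S (multiplied β (a * a′) (b * b′))))
    ≈⟨ mixed-β-cong P (λ a b → mixed-β-cong Q λ a′ b′ → mixed-β-cong S λ a″ b″ → Bilinear.cong bil (*-assoc a a′ a″) (*-assoc b b′ b″)) ⟩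
  mixed P (λ a b → mixed Q (λ a′ b′ → mixed S (multiplied (multiplied β a b) a′ b′)))
    ≈⟨ mixed-β-cong P (λ a b → mixed-* Q S (multiplied β a b)) ⟨
  mixed P (λ a b → mixed (Q * S) (multiplied β a b))
    ≈⟨ mixed-* P (Q * S) β ⟨
  mixed (P * (Q * S)) β ∎
mixed-cong (SymRing.*-comm P Q) {β} bil = begin
  mixed (P * Q) β
    ≈⟨ mixed-* P Q β ⟩
  mixed P (λ a b → mixed Q (multiplied β a b))
    ≈⟨ ΣList-swap (separate (P ⟦ tX+[1-t]Y ⟧)) (separate (Q ⟦ tX+[1-t]Y ⟧)) _ ⟩
  mixed Q (λ a′ b′ → mixed P (λ a b → multiplied β a b a′ b′))
    ≈⟨ mixed-β-cong Q (λ a′ b′ → mixed-β-cong P λ a b → Bilinear.cong bil (*-comm a a′) (*-comm b b′)) ⟩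
  mixed Q (λ a′ b′ → mixed P (multiplied β a′ b′))
    ≈⟨ mixed-* Q P β ⟨
  mixed (Q * P) β ∎
mixed-cong (SymRing.*-identityˡ P) {β} bil = ≈-trans (mixed-* 1Λ P β) (≈-trans (+-identityʳ _)
  (mixed-β-cong P λ a b → Bilinear.cong bil (*-identityˡ a) (*-identityˡ b)))
mixed-cong (SymRing.distribˡ P Q S) {β} bil = begin
  mixed (P * (Q + S)) β
    ≈⟨ mixed-* P (Q + S) β ⟩
  mixed P (λ a b → mixed (Q + S) (multiplied β a b))
    ≈⟨ mixed-β-cong P (λ a b → mixed-+ Q S (multiplied β a b)) ⟩
  mixed P (λ a b → mixed Q (multiplied β a b) + mixed S (multiplied β a b))
    ≈⟨ mixed-β-+ P _ _ ⟩
  mixed P (λ a b → mixed Q (multiplied β a b)) + mixed P (λ a b → mixed S (multiplied β a b))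
    ≈⟨ +-cong (mixed-* P Q β) (mixed-* P S β) ⟨
  mixed (P * Q) β + mixed (P * S) β
    ≈⟨ mixed-+ (P * Q) (P * S) β ⟨
  mixed (P * Q + P * S) β ∎
mixed-cong (SymRing.con-cong e) bil = +-congʳ (Bilinear.cong bil (con-cong e) ≈-refl)
mixed-cong (SymRing.con-+ a b) {β} bil = ≈-trans (mixed-con _ β) (≈-trans (Bilinear.cong bil (con-+ a b) ≈-refl)
  (≈-trans (Bilinear.addˡ bil _ _ _) (≈-sym (≈-trans (mixed-+ (con a) (con b) β) (+-cong (mixed-con a β) (mixed-con b β))))))
mixed-cong (SymRing.con-* a b) {β} bil = ≈-trans (mixed-con _ β) (≈-trans (Bilinear.cong bil (con-* a b) (≈-sym (*-identityˡ 1Λ)))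
  (≈-sym (≈-trans (mixed-* (con a) (con b) β) (≈-trans (mixed-con a (λ a b′ → mixed (con b) (multiplied β a b′))) (mixed-con b (multiplied β (con a) 1Λ))))))

operator-bilinear : ∀ {V} → Linear V → Bilinear (λ a b → a * V b)
operator-bilinear L = record
  { cong     = λ e e′ → *-cong e (Linear.cong L e′)
  ; addˡ     = λ _ _ _ → distribʳ _ _ _
  ; addʳ     = λ _ _ _ → ≈-trans (*-congˡ (Linear.add L _ _)) (distribˡ _ _ _)
  ; balanced = λ _ _ _ → ≈-trans (*-congˡ (Linear.scale L _ _))
      (solve 3 (λ a c b → a :* (c :* b) := (c :* a) :* b) ≈-refl _ _ _)
  }

tAnalogue-cong : ∀ {V} → Linear V → ∀ {P Q} → P ≈ Q → tAnalogue V P ≈ tAnalogue V Q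
tAnalogue-cong L e = mixed-cong e (operator-bilinear L)

-- A translation p_k ↦ p_k + c_k applied to both X and Y commutes with the
-- substitution of tX + (1−t)Y, because t^k c_k + (1 − t^k) c_k = c_k.

module _ (c : ℕ → ℚ[t]) where

  mixed-translate : ∀ P {β} → Bilinear β → mixed (translateBy c P) β ≈ mixed P (λ a b → β (translateBy c a) (translateBy c b))
  mixed-translate (con a) bil = ≈-refl
  mixed-translate (var (tt , j)) {β} bil = begin
    mixed (var (tt , j) + con (c j)) β
      ≈⟨ ≈-trans (mixed-+ (var (tt , j)) (con (c j)) β) (+-cong (mixed-var j bil) (mixed-con (c j) β)) ⟩
    (β (U * p) 1Λ + β W p) + β C 1Λ
      -- The constant is divided in the proportions t^k and 1 - t^k; balancedness then carries the
      -- second share over to the Y side.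
      ≈⟨ +-congˡ (cong split ≈-refl) ⟩
    (β (U * p) 1Λ + β W p) + β (U * C + C * W) 1Λ
      ≈⟨ +-congˡ (addˡ _ _ _) ⟩
    (β (U * p) 1Λ + β W p) + (β (U * C) 1Λ + β (C * W) 1Λ)
      ≈⟨ +-congˡ (+-congˡ (≈-trans (≈-sym (balanced (c j) W 1Λ)) (cong ≈-refl (*-identityʳ C)))) ⟩
    (β (U * p) 1Λ + β W p) + (β (U * C) 1Λ + β W C)
      ≈⟨ solve 4 (λ a b c d → (a :+ b) :+ (c :+ d) := (a :+ c) :+ (b :+ d)) ≈-refl _ _ _ _ ⟩
    (β (U * p) 1Λ + β (U * C) 1Λ) + (β W p + β W C)
      ≈⟨ +-cong (≈-trans (cong (distribˡ _ _ _) ≈-refl) (addˡ _ _ _)) (addʳ _ _ _) ⟨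
    β (U * (p + C)) 1Λ + β W (p + C)
      ≈⟨ mixed-var j translated-bilinear ⟨
    mixed (var (tt , j)) (λ a b → β (translateBy c a) (translateBy c b)) ∎
    where
    open Bilinear bil
    p U W C : Λ
    p = var (tt , j)
    U = con (adamsₜ (suc j) t)
    W = con (ℚt.con ℚ.1ℚ ℚt.+ ℚt.- adamsₜ (suc j) t)
    C = con (c j)
    split : C ≈ U * C + C * W
    split = ≈-sym (≈-trans (+-congˡ (*-congˡ (≈-trans (con-+ _ _) (+-congˡ (con-neg _)))))
      (≈-trans (solve 3 (λ u c e → u :* c :+ c :* (e :- u) := c :* e) ≈-refl U C 1Λ) (*-identityʳ C)))
    translated-bilinear : Bilinear (λ a b → β (translateBy c a) (translateBy c b))
    translated-bilinear = record
      { cong = λ e e′ → cong (translateBy-cong c e) (translateBy-cong c e′)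
      ; addˡ = λ _ _ _ → addˡ _ _ _
      ; addʳ = λ _ _ _ → addʳ _ _ _
      ; balanced = λ _ _ _ → balanced _ _ _
      }
  mixed-translate (P + Q) {β} bil = ≈-trans (mixed-+ (translateBy c P) (translateBy c Q) β)
    (≈-trans (+-cong (mixed-translate P bil) (mixed-translate Q bil)) (≈-sym (mixed-+ P Q _)))
  mixed-translate (P * Q) {β} bil = ≈-trans (mixed-* (translateBy c P) (translateBy c Q) β)
    (≈-trans (mixed-translate P (mixed-bilinear (translateBy c Q) bil))
    (≈-trans (mixed-β-cong P λ a b → mixed-translate Q (multiplied-bilinear bil (translateBy c a) (translateBy c b)))
    (≈-sym (mixed-* P Q _))))
  mixed-translate (- P) {β} bil = ≈-trans (mixed-neg (translateBy c P) bil)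
    (≈-trans (-‿cong (mixed-translate P bil)) (≈-sym (≈-trans (ΣList-map _ sep _)
      (≈-trans (ΣList-cong sep (λ (a , b) → Bilinear.negˡ bil (translateBy c a) (translateBy c b)))
      (≈-sym (ΣList-hom {T = λ x → - x} -0#≈0# (λ x y → ≈-sym (-‿+-comm x y)) sep _))))))
    where sep = separate (P ⟦ tX+[1-t]Y ⟧)

  tAnalogue-translate : ∀ {V V′} → Linear V′ → (∀ b → V′ (translateBy c b) ≈ translateBy c (V b)) →
                        ∀ P → tAnalogue V′ (translateBy c P) ≈ translateBy c (tAnalogue V P)
  tAnalogue-translate {V} {V′} L e P = ≈-trans (mixed-translate P (operator-bilinear L))
    (≈-trans (mixed-β-cong P λ a b → *-congˡ (e b))
    (≈-sym (ΣList-hom {T = translateBy c} ≈-refl (λ _ _ → ≈-refl) (separate (P ⟦ tX+[1-t]Y ⟧)) (λ (a , b) → a * V b))))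

-- The three symbols compared

Bern* : List ℤ → Λ → Λ
Bern* ν = foldr (λ r V → Bern r ∘ V) id ν

Bern*-linear : ∀ ν → Linear (Bern* ν)
Bern*-linear []      = record { cong = id ; add = λ _ _ → ≈-refl ; scale = λ _ _ → ≈-refl }
Bern*-linear (r ∷ ν) = ∘-linear (Bern-linear r) (Bern*-linear ν)

p₂ : Λ
p₂ = var (tt , 1)

Ωz-1 : ∀ A → Ωz A 1 ≈ adams 1 A
Ωz-1 A = ≈-trans (≈-sym (+-identityʳ _)) (≈-trans (θ-Ωz A 1)
  (≈-trans (+-cong (zeroˡ _) (≈-trans (*-congˡ {adams 1 A} (Ωz-0 A)) (*-identityʳ _))) (+-identityˡ _)))

s⟨1⟩≈ : s ⟨1⟩ ≈ X
s⟨1⟩≈ = ≈-trans (s≈S ⟨1⟩) (≈-trans (Bern-1 (+ 1)) (Ωz-1 X))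

s⟨2⟩≈ : s ⟨2⟩ ≈ hs 2
s⟨2⟩≈ = ≈-trans (s≈S ⟨2⟩) (Bern-1 (+ 2))

-- The rule for adding strips to two zeros leaves a single term, the one in which both zeros are
-- raised; its two signs cancel.
s⟨1,1⟩≈ : s ⟨1,1⟩ ≈ es 2
s⟨1,1⟩≈ = ≈-trans (s≈S ⟨1,1⟩) (≈-sym (≈-trans (≈-sym (*-identityʳ _)) (≈-trans (*-congˡ (≈-sym (S-zeros 2)))
  (≈-trans (e-S 2 [] 2 ℕₚ.≤-refl) (solve 1 (λ x → (K 0ℤ :- K 0ℤ) :- (K 0ℤ :- x) := x) ≈-refl _)))))

2·h₂ : 2 · hs 2 ≈ X * X + p₂
2·h₂ = ≈-trans (θ-Ωz X 2) (≈-trans (+-cong (zeroˡ _) (+-cong (*-congˡ {X} (Ωz-1 X)) (≈-trans (*-congˡ {p₂} (Ωz-0 X)) (*-identityʳ p₂))))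
  (+-identityˡ _))

2·e₂ : 2 · es 2 ≈ X * X + - p₂
2·e₂ = ≈-trans (θ-Ωz (- X) 2) (≈-trans (+-cong (zeroˡ _) (+-cong (*-congˡ {(- X)} (Ωz-1 (- X))) (≈-trans (*-congˡ {(- p₂)} (Ωz-0 (- X))) (*-identityʳ (- p₂)))))
  (solve 2 (λ x p → K 0ℤ :+ ((:- x) :* (:- x) :+ :- p) := x :* x :+ :- p) ≈-refl X p₂))

-- Doubling clears the denominators in h_2 = (p_1² + p_2)/2 and e_2 = (p_1² - p_2)/2.
f𝗁≈ : f 𝗁 ≈ p₂ + f 𝗏
f𝗁≈ = ≈-trans s⟨2⟩≈ (≈-trans (·-cancel 1 (begin
  2 · hs 2                       ≈⟨ 2·h₂ ⟩
  X * X + p₂                     ≈⟨ solve 2 (λ x p → x :* x :+ p := (p :+ (p :+ K 0ℤ)) :+ (x :* x :+ :- p)) ≈-refl X p₂ ⟩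
  2 · p₂ + (X * X + - p₂)        ≈⟨ +-congˡ 2·e₂ ⟨
  2 · p₂ + 2 · es 2              ≈⟨ ·-distrib-+ p₂ (es 2) 2 ⟨
  2 · (p₂ + es 2)                ∎)) (+-congˡ (≈-sym s⟨1,1⟩≈)))

f□≈ : f □ ≈ X + f 𝗏
f□≈ = +-congʳ s⟨1⟩≈

noConstant-f𝗏 : NoConstant (f 𝗏)
noConstant-f𝗏 = noConstant-cong (≈-trans (*-congˡ (≈-sym 2·e₂)) (≈-trans (1/·-· 1 (es 2)) (≈-sym s⟨1,1⟩≈)))
  (noConstant-con (noConstant-+ (noConstant-* noConstant-var noConstant-var) (noConstant-neg noConstant-var)))

noConstant-f : ∀ ◇ → NoConstant (f ◇)
noConstant-f □ = noConstant-cong (≈-sym f□≈) (noConstant-+ noConstant-var noConstant-f𝗏)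
noConstant-f 𝗁 = noConstant-cong (≈-sym f𝗁≈) (noConstant-+ noConstant-var noConstant-f𝗏)
noConstant-f 𝗏 = noConstant-f𝗏

-- B◇ with ▷ for ^⊥
conjugate : Symbol → List ℤ → Λ → Λ
conjugate ◇ ν = Ω▷ (- f ◇) ∘ Bern* ν ∘ Ω▷ (f ◇)

conjugate-linear : ∀ ◇ ν → Linear (conjugate ◇ ν)
conjugate-linear ◇ ν = ∘-linear (Ω▷-linear (noConstant-neg (noConstant-f ◇)))
  (∘-linear (Bern*-linear ν) (Ω▷-linear (noConstant-f ◇)))

module _ {Hall : ScalarProduct} (adj : Adjoints Hall) where
  open HallProduct Hall
  open Adjoints adj
  open Operators adj

  Ω⊥≈Ω▷ : ∀ A P → Ω[ A ]⊥ P ≈ Ω▷ A P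
  Ω⊥≈Ω▷ A P = ≈-trans (reflexive (sum-toℕ (suc (deg P)) (λ n → (Ωz A n ⊥) P)))
    (Σ<-cong (suc (deg P)) λ n → ⊥≈▷ adj (Ωz A n) P)

  B≈Bern : ∀ r P → B r P ≈ Bern r P
  B≈Bern r P = ≈-trans (reflexive (sum-toℕ (suc (deg P)) (λ n → h (r ℤ.+ + n) * (es n ⊥) P)))
    (Σ<-cong (suc (deg P)) λ n → *-congˡ {h (r ℤ.+ + n)} (⊥≈▷ adj (es n) P))

  Bs≈Bern* : ∀ ν P → Bs ν P ≈ Bern* ν P
  Bs≈Bern* []      P = ≈-refl
  Bs≈Bern* (r ∷ ν) P = ≈-trans (B≈Bern r (Bs ν P)) (Linear.cong (Bern-linear r) (Bs≈Bern* ν P))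

  B◇≈conjugate : ∀ ◇ ν P → B◇ ◇ ν P ≈ conjugate ◇ ν P
  B◇≈conjugate ◇ ν P = ≈-trans (Ω⊥≈Ω▷ (- f ◇) _) (Linear.cong (Ω▷-linear (noConstant-neg (noConstant-f ◇)))
    (≈-trans (Bs≈Bern* ν _) (Linear.cong (Bern*-linear ν) (Ω⊥≈Ω▷ (f ◇) P))))

  module Change {◇ ◇′ : Symbol} {C : Λ} (prim : Primitive C) (lC : NoConstant C) (f≈ : f ◇ ≈ C + f ◇′) where
    open Translation prim

    Ωf-translate : ∀ P → Ω▷ (f ◇′) (translate P) ≈ Ω▷ (f ◇) P
    Ωf-translate P = ≈-trans (Linear.cong (Ω▷-linear (noConstant-f ◇′)) (≈-sym (Ω▷≈translate lC P)))
      (≈-trans (≈-sym (Ω▷-+ (noConstant-f ◇′) lC P)) (Ω▷-cong (≈-trans (+-comm _ _) (≈-sym f≈)) P))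

    translate-Ω-f : ∀ P → Ω▷ (- f ◇′) P ≈ translate (Ω▷ (- f ◇) P)
    translate-Ω-f P = ≈-trans (Ω▷-cong -f≈ P) (≈-trans (Ω▷-+ lC (noConstant-neg (noConstant-f ◇)) P) (Ω▷≈translate lC _))
      where
      -f≈ : - f ◇′ ≈ C + - f ◇
      -f≈ = ≈-sym (≈-trans (+-congˡ (-‿cong f≈)) (solve 2 (λ c f → c :+ :- (c :+ f) := :- f) ≈-refl C (f ◇′)))

    conjugate-translate : ∀ ν P → conjugate ◇′ ν (translate P) ≈ translate (conjugate ◇ ν P)
    conjugate-translate ν P = ≈-trans
      (Linear.cong (∘-linear (Ω▷-linear (noConstant-neg (noConstant-f ◇′))) (Bern*-linear ν)) (Ωf-translate P))
      (translate-Ω-f _)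

    s◇-translate : ∀ μ → s◇ ◇′ μ ≈ translate (s◇ ◇ μ)
    s◇-translate μ = ≈-trans (Ω⊥≈Ω▷ (- f ◇′) (s μ)) (≈-trans (translate-Ω-f (s μ)) (translate-cong (≈-sym (Ω⊥≈Ω▷ (- f ◇) (s μ)))))

    B̃◇-translate : ∀ ν P {P′} → P′ ≈ translate P → B̃◇ ◇′ ν P′ ≈ translate (B̃◇ ◇ ν P)
    B̃◇-translate ν P {P′} e = ≈-trans (mixed-β-cong P′ λ a b → *-congˡ (B◇≈conjugate ◇′ ν b))
      (≈-trans (tAnalogue-cong (conjugate-linear ◇′ ν) e)
      (≈-trans (tAnalogue-translate _ (conjugate-linear ◇′ ν) (conjugate-translate ν) P)
      (translate-cong (mixed-β-cong P λ a b → *-congˡ (≈-sym (B◇≈conjugate ◇ ν b))))))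

    product-translate : ∀ R → B̃◇-product ◇′ R ≈ translate (B̃◇-product ◇ R)
    product-translate []      = ≈-refl
    product-translate (μ ∷ R) = B̃◇-translate (map +_ (parts μ)) (B̃◇-product ◇ R) (product-translate R)

    Ωf-s◇ : ∀ μ → Ω▷ (f ◇′) (s◇ ◇′ μ) ≈ s μ
    Ωf-s◇ μ = ≈-trans (Linear.cong (Ω▷-linear (noConstant-f ◇′)) (Ω⊥≈Ω▷ (- f ◇′) (s μ)))
      (≈-trans (≈-sym (Ω▷-+ (noConstant-f ◇′) (noConstant-neg (noConstant-f ◇′)) (s μ)))
      (≈-trans (Ω▷-cong (-‿inverseʳ (f ◇′)) (s μ)) (Ω▷-0 (s μ))))

    Ωf-expansion : ∀ (L : List Partition) (d : Partition → ℚ[t]) → Ω▷ (f ◇′) (ΣList L λ μ → con (d μ) * s◇ ◇′ μ) ≈ ΣList L λ μ → con (d μ) * s μ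
    Ωf-expansion L d = ≈-trans (ΣList-hom (Linear.zero-hom Ωf) (Linear.add Ωf) L _)
      (ΣList-cong L λ μ → ≈-trans (Linear.scale Ωf (d μ) _) (*-congˡ (Ωf-s◇ μ)))
      where Ωf = Ω▷-linear (noConstant-f ◇′)

    -- Applying Ω[f]^⊥ for the second symbol undoes the skewing in its basis. Both expansions become
    -- combinations of Schur functions, whose coefficients the scalar product reads off even when
    -- the two supports differ.
    coefficients≈ : ∀ R {d d′} → Expansion ◇ (B̃◇-product ◇ R) d → Expansion ◇′ (B̃◇-product ◇′ R) d′ →
                    ∀ μ → d μ ≈ₜ d′ μ
    coefficients≈ R {d} {d′} x x′ μ = Q.trans (Q.sym (schur-coefficient x.unique x.outside μ))
      (Q.trans (⟨⟩-congˡ equal-sums) (schur-coefficient x′.unique x′.outside μ))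
      where
      module x = Expansion x
      module x′ = Expansion x′
      equal-sums : ΣList x.support (λ μ → con (d μ) * s μ) ≈ ΣList x′.support (λ μ → con (d′ μ) * s μ)
      equal-sums = begin
        ΣList x.support (λ μ → con (d μ) * s μ)
          ≈⟨ Ωf-expansion x.support d ⟨
        Ω▷ (f ◇′) (ΣList x.support λ μ → con (d μ) * s◇ ◇′ μ)
          ≈⟨ Linear.cong (Ω▷-linear (noConstant-f ◇′)) (begin
            (ΣList x.support λ μ → con (d μ) * s◇ ◇′ μ)             ≈⟨ ΣList-cong x.support (λ μ → *-congˡ (s◇-translate μ)) ⟩
            (ΣList x.support λ μ → con (d μ) * translate (s◇ ◇ μ))  ≈⟨ ΣList-hom {T = translate} ≈-refl (λ _ _ → ≈-refl) x.support _ ⟨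
            translate (ΣList x.support λ μ → con (d μ) * s◇ ◇ μ)    ≈⟨ translate-cong x.expansion ⟨
            translate (B̃◇-product ◇ R)                              ≈⟨ product-translate R ⟨
            B̃◇-product ◇′ R                                         ≈⟨ x′.expansion ⟩
            (ΣList x′.support λ μ → con (d′ μ) * s◇ ◇′ μ)           ∎) ⟩
        Ω▷ (f ◇′) (ΣList x′.support λ μ → con (d′ μ) * s◇ ◇′ μ)
          ≈⟨ Ωf-expansion x′.support d′ ⟩
        ΣList x′.support (λ μ → con (d′ μ) * s μ) ∎

theorem23 : {Hall : ScalarProduct} (adj : Adjoints Hall) →
    let open Operators adj in
    (R : List Partition) (d : Symbol → Partition → ℚ[t]) →
    (∀ ◇ → Expansion ◇ (B̃◇-product ◇ R) (d ◇)) →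
    ∀ μ → (d □ μ ≈ₜ d 𝗏 μ) × (d 𝗏 μ ≈ₜ d 𝗁 μ)
theorem23 adj R d x μ =
  Change.coefficients≈ adj (primitive-var 0) noConstant-var f□≈ R (x □) (x 𝗏) μ ,
  Q.sym (Change.coefficients≈ adj (primitive-var 1) noConstant-var f𝗁≈ R (x 𝗁) (x 𝗏) μ)
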